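{- The procedure CACTUS-SG described in the context is correct: for every cactus graph $G=(V,E)$ whose cut-tree $T$ has at least two nodes, the set $S$ returned by the procedure on input $(G,T)$ is a strong geodetic set of $G$ of minimum cardinality.
   Context: All graphs are finite, simple, undirected and connected. $D(u,v)$ denotes the distance between $u$ and $v$. A shortest path assignment $I(S)$ of $S\subseteq V(G)$ consists of exactly one chosen shortest path of $G$ between $u$ and $v$ for each unordered pair of distinct vertices $u,v\in S$. The set $S$ is a strong geodetic set of $G$ if there is a shortest path assignment $I(S)$ such that every vertex of $V(G)\setminus S$ lies on some path of $I(S)$ (for $|S|\ge 2$ this is the same as $\bigcup_{P\in I(S)}V(P)=V(G)$). A cactus graph is a connected graph in which every edge belongs to at most one simple cycle; hence each of its biconnected components (blocks) with at least one edge is a single edge or a cycle. The cut-tree $T$ of $G$ is the tree with one node for each biconnected component and one node for each cut-vertex of $G$, where a cut-vertex $a$ and a biconnected component $C$ are joined by an edge iff $a\in C$. (Leaves of $T$ are biconnected components.) Procedure CACTUS-SG, on input a cactus graph $G$ and its cut-tree $T$ (with at least two nodes): (1) Initialize $S=\emptyset$. (2) For each leaf $\ell$ of $T$: if $\ell$ corresponds to an edge of $G$, add its simplicial vertex (its endpoint of degree one in $G$) to $S$. If $\ell$ corresponds to an even cycle $C$ of length $l$ whose cut-vertex is $a$, add to $S$ the vertex $v\in C$ with $D(a,v)=l/2$. If $\ell$ corresponds to an odd cycle $C$ of length $l$ whose cut-vertex is $a$, add to $S$ the two vertices $u,v\in C$ with $D(a,u)=D(a,v)=\lfloor l/2\rfloor$.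 (3) For each internal node of $T$ that represents a cycle $C$ of length $l$, let $A$ be the set of cut-vertices of $G$ contained in $C$. If $l$ is even and there are $a_1,a_2\in A$ with $D(a_1,a_2)=l/2$, do nothing for this block. Otherwise, for $p,q\in A$ let $p(p,q)$ be the vertex set of the unique shortest path between $p$ and $q$ in $C$; if $\bigcup_{p,q\in A}p(p,q)=V(C)$, do nothing for this block; if $\bigcup_{p,q\in A}p(p,q)\ne V(C)$, let $x_1\neq x_k$ be two vertices of $A$ at maximum distance from each other in $C$, let $(x_1,x_2,\dots,x_k)$ be the longest path between $x_1$ and $x_k$ in $C$, and add $x_j$ to $S$, where $j=\lfloor (1+k)/2\rfloor$. Internal nodes of $T$ representing edges or cut-vertices require no action. (4) If $|S|\ge 3$, return $S$. Otherwise, if $G$ contains a block that is an even cycle, add an arbitrary vertex of $V(G)\setminus S$ to $S$ and return $S$; if not, return $S$. -}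

module Defs where

open import Data.Nat using (ℕ; zero; suc; _+_; _≤_; _<_; _/_)
open import Data.Nat.Divisibility using (_∣_)
open import Data.Fin using (Fin; toℕ)
import Data.Fin as Fin
open import Data.Fin.Subset using (Subset; _∈_; _∉_; _⊆_; _∪_; _-_; ⁅_⁆; ⊥; ⊤; ∣_∣; Nonempty)
open import Data.Fin.Subset.Properties using (_∈?_)
open import Data.List using (List; []; _∷_; length; lookup)
open import Data.List.Membership.Propositional renaming (_∈_ to _∈ˡ_) using ()
open import Data.List.Relation.Unary.Unique.Propositional using (Unique)
open import Data.Product using (Σ; ∃; ∃-syntax; ∃!; _×_; _,_)
open import Data.Sum using (_⊎_)
open import Function.Bundles using (_⇔_)
open import Relation.Binary.Construct.Closure.ReflexiveTransitive using (Star; ε; _◅_)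
open import Relation.Binary.Definitions using (Decidable; Symmetric)
open import Relation.Binary.PropositionalEquality using (_≡_; _≢_)
open import Relation.Nullary using (¬_)
open import Relation.Nullary.Decidable using (_×-dec_)

record Graph (n : ℕ) : Set₁ where
  field
    Adj    : Fin n → Fin n → Set
    adj?   : Decidable Adj
    sym    : Symmetric Adj
    irrefl : ∀ {v} → ¬ Adj v v

open Graph public using (Adj)

-- G [ B ] keeps all n vertices, but those outside B become isolated; so
-- walks of G [ B ] between vertices of B are exactly the walks of the
-- subgraph of G induced by B.
_[_] : ∀ {n} → Graph n → Subset n → Graph n
G [ B ] = record
  { Adj    = λ u v → u ∈ B × v ∈ B × Adj G u v
  ; adj?   = λ u v → u ∈? B ×-dec v ∈? B ×-dec Graph.adj? G u v
  ; sym    = λ { (u∈B , v∈B , e) → v∈B , u∈B , Graph.sym G e }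
  ; irrefl = λ { (_ , _ , e) → Graph.irrefl G e }
  }

Walk : ∀ {n} → Graph n → Fin n → Fin n → Set
Walk G = Star (Adj G)

-- Stated for an arbitrary relation E, as E (unlike G) can be inferred
-- from the type Walk G u v = Star (Adj G) u v.
module _ {n} {E : Fin n → Fin n → Set} where

  ∥_∥ : ∀ {u v} → Star E u v → ℕ
  ∥ ε ∥     = 0
  ∥ _ ◅ P ∥ = suc ∥ P ∥

  vertices : ∀ {u v} → Star E u v → List (Fin n)
  vertices {u} ε       = u ∷ []
  vertices {u} (_ ◅ P) = u ∷ vertices P

  edges : ∀ {u v} → Star E u v → List (Fin n × Fin n)
  edges     ε                 = []
  edges {u} (_◅_ {j = w} _ P) = (u , w) ∷ edges P

  IsPath : ∀ {u v} → Star E u v → Set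
  IsPath P = Unique (vertices P)

  -- A walk of minimum length is automatically a path.
  IsShortest : ∀ {u v} → Star E u v → Set
  IsShortest {u} {v} P = ∀ (Q : Star E u v) → ∥ P ∥ ≤ ∥ Q ∥

  IsLongestPath : ∀ {u v} → Star E u v → Set
  IsLongestPath {u} {v} P = IsPath P × (∀ (Q : Star E u v) → IsPath Q → ∥ Q ∥ ≤ ∥ P ∥)

ShortestPath : ∀ {n} → Graph n → Fin n → Fin n → Set
ShortestPath G u v = Σ (Walk G u v) IsShortest

-- D(u,v) = d
Dist : ∀ {n} → Graph n → Fin n → Fin n → ℕ → Set
Dist G u v d = Σ (Walk G u v) λ P → IsShortest P × ∥ P ∥ ≡ d

Connected : ∀ {n} → Graph n → Set
Connected G = ∀ u v → Walk G u v

-- Unordered pairs of distinct vertices are represented by u < v.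
Assignment : ∀ {n} → Graph n → Subset n → Set
Assignment G S = ∀ u v → .(u ∈ S) → .(v ∈ S) → .(u Fin.< v) → ShortestPath G u v

LiesOn : ∀ {n} {E : Fin n → Fin n → Set} {u v} → Fin n → Σ (Star E u v) IsShortest → Set
LiesOn w (P , _) = w ∈ˡ vertices P

StrongGeodetic : ∀ {n} → Graph n → Subset n → Set
StrongGeodetic {n} G S =
  Σ (Assignment G S) λ I →
    ∀ w → w ∉ S →
      Σ (Fin n) λ u → Σ (Fin n) λ v →
      Σ (u ∈ S) λ u∈S → Σ (v ∈ S) λ v∈S → Σ (u Fin.< v) λ u<v →
        LiesOn w (I u v u∈S v∈S u<v)

MinimumStrongGeodetic : ∀ {n} → Graph n → Subset n → Set
MinimumStrongGeodetic G S =
  StrongGeodetic G S × (∀ S′ → StrongGeodetic G S′ → ∣ S ∣ ≤ ∣ S′ ∣)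

-- A simple cycle is a path with at least three vertices together with an
-- edge joining its two ends.
record Cycle {n} (G : Graph n) : Set where
  field
    start end : Fin n
    path      : Walk G start end
    simple    : IsPath path
    long      : 2 ≤ ∥ path ∥
    closing   : Adj G end start

module _ {n} {G : Graph n} where

  cycleLength : Cycle G → ℕ
  cycleLength C = suc ∥ Cycle.path C ∥

  cycleVertices : Cycle G → List (Fin n)
  cycleVertices C = vertices (Cycle.path C)

  CycleEdge : Cycle G → Fin n → Fin n → Set
  CycleEdge C u v = (u , v) ∈ˡ es ⊎ (v , u) ∈ˡ es
    where es = (Cycle.end C , Cycle.start C) ∷ edges (Cycle.path C)

-- Different listings of the same cycle (rotations, reversals) are
-- identified by comparing edge sets.
Cactus : ∀ {n} → Graph n → Set
Cactus G =
  Connected G ×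
  (∀ (C C′ : Cycle G) u v → CycleEdge C u v → CycleEdge C′ u v →
     ∀ x y → CycleEdge C x y ⇔ CycleEdge C′ x y)

module _ {n} (G : Graph n) where

  ConnectedOn : Subset n → Set
  ConnectedOn B = ∀ u v → u ∈ B → v ∈ B → Walk (G [ B ]) u v

  Biconnected : Subset n → Set
  Biconnected B = Nonempty B × ConnectedOn B × (∀ x → x ∈ B → ConnectedOn (B - x))

  -- Maximal biconnected subgraphs are induced, hence given by vertex sets.
  IsBlock : Subset n → Set
  IsBlock B = Biconnected B × (∀ B′ → Biconnected B′ → B ⊆ B′ → B′ ⊆ B)

  IsCutVertex : Fin n → Set
  IsCutVertex a = ¬ ConnectedOn (⊤ - a)

  data Node : Set where
    block : Subset n → Node
    cut   : Fin n → Node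

  IsNode : Node → Set
  IsNode (block B) = IsBlock B
  IsNode (cut a)   = IsCutVertex a

  data TreeEdge : Node → Node → Set where
    block—cut : ∀ {B a} → IsBlock B → IsCutVertex a → a ∈ B → TreeEdge (block B) (cut a)
    cut—block : ∀ {B a} → IsBlock B → IsCutVertex a → a ∈ B → TreeEdge (cut a) (block B)

  Leaf : Node → Set
  Leaf x = IsNode x × ∃! _≡_ (TreeEdge x)

  Internal : Node → Set
  Internal x = IsNode x × ¬ Leaf x

  CutTreeHasTwoNodes : Set
  CutTreeHasTwoNodes = ∃[ x ] ∃[ y ] IsNode x × IsNode y × x ≢ y

  IsEdge : Subset n → Set
  IsEdge B = ∃[ u ] ∃[ v ] Adj G u v × B ≡ ⁅ u ⁆ ∪ ⁅ v ⁆

  -- The subgraph induced by B is a cycle of length l.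
  IsCycle : Subset n → ℕ → Set
  IsCycle B l = Σ (Cycle (G [ B ])) λ C →
    (∀ v → v ∈ B → v ∈ˡ cycleVertices C) ×
    (∀ u v → Adj (G [ B ]) u v → CycleEdge C u v) ×
    cycleLength C ≡ l

  -- The procedure makes arbitrary choices, so each step is a relation
  -- between its input and the sets that it may produce.

  CutIn : Subset n → Fin n → Set
  CutIn B a = a ∈ B × IsCutVertex a

  data Step2 (B : Subset n) : Subset n → Set where
    edge : ∀ {v} → IsEdge B →
           v ∈ B → ∃! _≡_ (Adj G v) →
           Step2 B ⁅ v ⁆
    even : ∀ {l a v} → IsCycle B l → 2 ∣ l → CutIn B a →
           v ∈ B → Dist G a v (l / 2) →
           Step2 B ⁅ v ⁆
    odd  : ∀ {l a u v} → IsCycle B l → ¬ 2 ∣ l → CutIn B a →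
           u ∈ B → v ∈ B → u ≢ v → Dist G a u (l / 2) → Dist G a v (l / 2) →
           Step2 B (⁅ u ⁆ ∪ ⁅ v ⁆)

  HasAntipodalCuts : Subset n → ℕ → Set
  HasAntipodalCuts B l =
    2 ∣ l × ∃[ a₁ ] ∃[ a₂ ] CutIn B a₁ × CutIn B a₂ × Dist G a₁ a₂ (l / 2)

  -- The union of the sets p(p,q), for p and q in A, is the whole cycle.
  CoveredByCuts : Subset n → Set
  CoveredByCuts B = ∀ w → w ∈ B →
    ∃[ p ] ∃[ q ] CutIn B p × CutIn B q × Σ (ShortestPath (G [ B ]) p q) (LiesOn w)

  Farthest : Subset n → Fin n → Fin n → Set
  Farthest B x y = ∀ p q d e → CutIn B p → CutIn B q →
    Dist (G [ B ]) p q d → Dist (G [ B ]) x y e → d ≤ e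

  -- w = x_j, where (x_1,…,x_k) are the vertices of P and j = ⌊(1+k)/2⌋;
  -- list positions start at 0, hence the suc.
  IsMiddle : ∀ {E : Fin n → Fin n → Set} {x y} → Star E x y → Fin n → Set
  IsMiddle P w = Σ (Fin k) λ i → suc (toℕ i) ≡ (1 + k) / 2 × lookup (vertices P) i ≡ w
    where k = length (vertices P)

  data Step3 (B : Subset n) : Subset n → Set where
    edge      : IsEdge B → Step3 B ⊥
    antipodal : ∀ {l} → IsCycle B l → HasAntipodalCuts B l → Step3 B ⊥
    covered   : ∀ {l} → IsCycle B l → ¬ HasAntipodalCuts B l →
                CoveredByCuts B → Step3 B ⊥
    uncovered : ∀ {l x₁ xₖ xⱼ} → IsCycle B l → ¬ HasAntipodalCuts B l →
                ¬ CoveredByCuts B →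
                CutIn B x₁ → CutIn B xₖ → x₁ ≢ xₖ → Farthest B x₁ xₖ →
                (P : Walk (G [ B ]) x₁ xₖ) → IsLongestPath P → IsMiddle P xⱼ →
                Step3 B ⁅ xⱼ ⁆

  -- S is a possible value of the set after the loops of steps 2 and 3.
  -- The leaves of the cut-tree are blocks, and nothing is done for
  -- cut-vertices, so it suffices to range over the blocks.
  record AfterLoops (S : Subset n) : Set where
    field
      added    : Subset n → Subset n
      leaf     : ∀ B → Leaf (block B) → Step2 B (added B)
      internal : ∀ B → Internal (block B) → Step3 B (added B)
      union    : ∀ v → v ∈ S ⇔ (∃[ B ] IsBlock B × v ∈ added B)

  HasEvenCycleBlock : Set
  HasEvenCycleBlock = ∃[ B ] ∃[ l ] IsBlock B × IsCycle B l × 2 ∣ l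

  data Step4 (S : Subset n) : Subset n → Set where
    enough : 3 ≤ ∣ S ∣ → Step4 S S
    extra  : ∀ {v} → ∣ S ∣ < 3 → HasEvenCycleBlock → v ∉ S → Step4 S (S ∪ ⁅ v ⁆)
    noEven : ∣ S ∣ < 3 → ¬ HasEvenCycleBlock → Step4 S S

  CactusSG : Subset n → Set
  CactusSG S = ∃[ S₃ ] AfterLoops S₃ × Step4 S₃ S

{-# OPTIONS --safe #-}
module Submission where

-- Blocks are the maximal sets of vertices that no single vertex separates. Each vertex x has a gate in a
-- block B, the vertex where every walk from x enters B, and distances decompose at gates. In a cactus a block
-- is an edge or an induced cycle, so its metric is that of a cycle of length l (with l = 2 for an edge).
--
-- Upper bound: for every block there are three vertices of S whose gates divide the cycle into arcs of length
-- at most l / 2; an uncovered vertex that is not a cut vertex is charged to the pair spanning its arc. Vertices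
-- charged to the same pair lie pairwise on a common geodesic (those of one block lie on one arc, those of
-- different blocks are separated by a cut vertex), hence all of them lie on one geodesic. A cut vertex lies on
-- every walk between vertices of S on its two sides.
--
-- Lower bound: gates project geodesics onto blocks. Therefore every strong geodetic set has, among the
-- vertices of each block that are not cut vertices, at least as many elements as the procedure adds there, and
-- those vertices belong to no other block. If there is a cycle, a strong geodetic set has three elements, since
-- no geodesic from s contains both cycle neighbours of the gate of s.

-- The difficulty of the upper bound is that a pair of vertices of `S` receives a single path, while
-- it may span arcs in many blocks. Inside one block a pair must therefore span only one arc, which
-- is why each cycle needs three distinct vertices of `S`: with an antipodal pair alone, both halves
-- of the cycle would fall to the same path. This is the purpose of step 4. An edge, read as a cycle
-- of length 2, also has antipodal ends, but it leaves nothing to cover. In step 3 the longest path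
-- is more than half of the cycle, so its two halves and the remaining arc all have length at most l
-- / 2. If instead the cut vertices cover the cycle, no gap between consecutive ones exceeds half of
-- it, and three of them can be selected. The procedure is a relation between inputs and outputs, so
-- the theorem also claims that an output exists. This rests on deciding the notions involved and on
-- exhibiting a legal choice in every step.

open import Defs
open import Data.Nat using (ℕ; zero; suc; _+_; _*_; _∸_; _≤_; _<_; _/_; _%_; z≤n; s≤s; >-nonZero)
open import Data.Product using (∃; _×_)
open import Data.Nat.Properties
open import Data.Nat.DivMod using (m%n<n; m<n⇒m%n≡m; n%n≡0; [m+n]%n≡m%n; [m+kn]%n≡m%n; m≡m%n+[m/n]*n; m*n/n≡m; m/n≡1+[m∸n]/n)
open import Data.Nat.Divisibility using (_∣_; _∣?_; divides; m%n≡0⇒n∣m)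
open import Data.Nat.Tactic.RingSolver using (solve)
open import Data.Bool as Bool using (true; false)
open import Data.Empty using () renaming (⊥ to Empty)
open import Data.Fin using (Fin; toℕ; fromℕ<)
import Data.Fin as Fin
import Data.Fin.Properties as Finₚ
open import Data.Fin.Subset using (Subset; _∈_; _∉_; _⊆_; _∪_; _-_; ⁅_⁆; ⊥; ⊤; ∣_∣; Nonempty)
open import Data.Fin.Subset.Properties using (_∈?_; ∈⊤; ∉⊥; x∈⁅x⁆; x∈⁅y⁆⇒x≡y; ⊆-antisym; x∈p∪q⁻; p⊆p∪q; q⊆p∪q; p─q⊆p; x∈p∧x≢y⇒x∈p-y; p⊂q⇒∣p∣<∣q∣; p⊆q⇒∣p∣≤∣q∣; ∣p∣≤n; anySubset?; x∈p⇒∣p-x∣<∣p∣; ∪-identityʳ; ∣⁅x⁆∣≡1)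
open import Data.List using (List; []; _∷_; length; lookup)
open import Data.List.Membership.Propositional renaming (_∈_ to _∈ˡ_) using ()
open import Data.List.Relation.Unary.All as All using ()
open import Data.List.Relation.Unary.AllPairs as AllPairs using ()
open import Data.List.Relation.Unary.Any using (here; there)
open import Data.Product using (Σ; ∃-syntax; ∃!; _,_; proj₁; proj₂)
open import Data.Sum as Sum using (_⊎_; inj₁; inj₂; [_,_]′)
open import Data.Vec as Vec using ()
import Data.Vec.Properties as Vecₚ
open import Function using (_∘_; id)
open import Function.Bundles using (Equivalence; mk⇔)
open import Relation.Binary.Construct.Closure.ReflexiveTransitive using (Star; ε; _◅_; _◅◅_)
import Relation.Binary.Construct.Closure.ReflexiveTransitive as Star
open import Relation.Binary.Definitions using (Decidable; Tri; tri<; tri≈; tri>)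
open import Relation.Binary.PropositionalEquality hiding ([_])
open import Relation.Nullary using (¬_; Dec; yes; no; contradiction; does)
open import Relation.Nullary.Decidable using (_×-dec_; _→-dec_; _⊎-dec_; ¬?; map′; decidable-stable; dec-true; dec-false)

-- A linear inequality is certified by a sum h of hypotheses, a slack k and a ring identity.
linear : ∀ {a b x y} k → x ≤ y → a + y + k ≡ b + x → a ≤ b
linear {a} {b} {x} {y} k h e = +-cancelʳ-≤ x a b (begin
  a + x     ≤⟨ +-monoʳ-≤ a h ⟩
  a + y     ≤⟨ m≤m+n (a + y) k ⟩
  a + y + k ≡⟨ e ⟩
  b + x     ∎)
  where open ≤-Reasoning

infixr 5 _⊕_
_⊕_ : ∀ {a b c d} → a ≤ b → c ≤ d → a + c ≤ b + d
_⊕_ = +-mono-≤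

≤= : ∀ {a b : ℕ} → a ≡ b → a ≤ b
≤= = ≤-reflexive

≥= : ∀ {a b : ℕ} → a ≡ b → b ≤ a
≥= e = ≤-reflexive (sym e)

-- Walks: their vertices, positions and shortening.

module _ {n} {E : Fin n → Fin n → Set} where

  length-◅◅ : ∀ {x y z} (P : Star E x y) (Q : Star E y z) → ∥ P ◅◅ Q ∥ ≡ ∥ P ∥ + ∥ Q ∥
  length-◅◅ ε       Q = refl
  length-◅◅ (_ ◅ P) Q = cong suc (length-◅◅ P Q)

  start∈ : ∀ {x y} (P : Star E x y) → x ∈ˡ vertices P
  start∈ ε       = here refl
  start∈ (_ ◅ _) = here refl

  end∈ : ∀ {x y} (P : Star E x y) → y ∈ˡ vertices P
  end∈ ε       = here refl
  end∈ (_ ◅ P) = there (end∈ P)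

  ∈-◅◅ˡ : ∀ {x y z w} (P : Star E x y) (Q : Star E y z) → w ∈ˡ vertices P → w ∈ˡ vertices (P ◅◅ Q)
  ∈-◅◅ˡ ε       Q (here refl) = start∈ Q
  ∈-◅◅ˡ (_ ◅ P) Q (here refl) = here refl
  ∈-◅◅ˡ (_ ◅ P) Q (there i)   = there (∈-◅◅ˡ P Q i)

  ∈-◅◅ʳ : ∀ {x y z w} (P : Star E x y) (Q : Star E y z) → w ∈ˡ vertices Q → w ∈ˡ vertices (P ◅◅ Q)
  ∈-◅◅ʳ ε       Q i = i
  ∈-◅◅ʳ (_ ◅ P) Q i = there (∈-◅◅ʳ P Q i)

  split∈ : ∀ {x y w} (P : Star E x y) → w ∈ˡ vertices P →
           Σ (Star E x w) λ Q → Σ (Star E w y) λ R → ∥ Q ∥ + ∥ R ∥ ≡ ∥ P ∥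
  split∈ ε       (here refl) = ε , ε , refl
  split∈ (e ◅ P) (here refl) = ε , e ◅ P , refl
  split∈ (e ◅ P) (there i) with split∈ P i
  ... | Q , R , eq = e ◅ Q , R , cong suc eq

  -- Constant past the end of the walk.
  at : ∀ {x y} → Star E x y → ℕ → Fin n
  at {x} _       zero    = x
  at {x} ε       (suc _) = x
  at     (_ ◅ P) (suc i) = at P i

  at-end : ∀ {x y} (P : Star E x y) → at P ∥ P ∥ ≡ y
  at-end ε       = refl
  at-end (_ ◅ P) = at-end P

  at-edge : ∀ {x y} (P : Star E x y) i → i < ∥ P ∥ → E (at P i) (at P (suc i))
  at-edge (e ◅ ε)     zero    _       = e
  at-edge (e ◅ _ ◅ _) zero    _       = e
  at-edge (_ ◅ P)     (suc i) (s≤s h) = at-edge P i h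

  at∈ : ∀ {x y} (P : Star E x y) i → at P i ∈ˡ vertices P
  at∈ ε       zero    = here refl
  at∈ ε       (suc _) = here refl
  at∈ (_ ◅ _) zero    = here refl
  at∈ (_ ◅ P) (suc i) = there (at∈ P i)

  ∈-at : ∀ {x y w} (P : Star E x y) → w ∈ˡ vertices P → ∃[ i ] i ≤ ∥ P ∥ × at P i ≡ w
  ∈-at ε       (here refl) = 0 , z≤n , refl
  ∈-at (_ ◅ P) (here refl) = 0 , z≤n , refl
  ∈-at (_ ◅ P) (there i) with ∈-at P i
  ... | k , h , eq = suc k , s≤s h , eq

  edges-at : ∀ {x y u v} (P : Star E x y) → (u , v) ∈ˡ edges P →
             ∃[ i ] i < ∥ P ∥ × at P i ≡ u × at P (suc i) ≡ v
  edges-at (_ ◅ ε)     (here refl) = 0 , s≤s z≤n , refl , refl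
  edges-at (_ ◅ _ ◅ _) (here refl) = 0 , s≤s z≤n , refl , refl
  edges-at (_ ◅ P) (there i) with edges-at P i
  ... | k , h , eq , eq′ = suc k , s≤s h , eq , eq′

  at-injective : ∀ {x y} (P : Star E x y) → IsPath P → ∀ i j → i < j → j ≤ ∥ P ∥ → at P i ≢ at P j
  at-injective (_ ◅ P) (h AllPairs.∷ _) zero    (suc j) _       _       eq = All.lookup h (at∈ P j) eq
  at-injective (_ ◅ P) (_ AllPairs.∷ u) (suc i) (suc j) (s≤s p) (s≤s q) eq = at-injective P u i j p q eq

  length-vertices : ∀ {x y} (P : Star E x y) → length (vertices P) ≡ suc ∥ P ∥
  length-vertices ε       = refl
  length-vertices (_ ◅ P) = cong suc (length-vertices P)

  lookup-at : ∀ {x y} (P : Star E x y) (i : Fin (length (vertices P))) → lookup (vertices P) i ≡ at P (toℕ i)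
  lookup-at ε       Fin.zero    = refl
  lookup-at (_ ◅ P) Fin.zero    = refl
  lookup-at (_ ◅ P) (Fin.suc i) = lookup-at P i

  private
    tail-shortest : ∀ {x y z} (e : E x y) (P : Star E y z) → IsShortest (e ◅ P) → IsShortest P
    tail-shortest e P s Q = ≤-pred (s (e ◅ Q))

  shortest⇒path : ∀ {x y} (P : Star E x y) → IsShortest P → IsPath P
  shortest⇒path ε       s = All.[] AllPairs.∷ AllPairs.[]
  shortest⇒path {x} (e ◅ P) s = All.tabulate fresh AllPairs.∷ shortest⇒path P (tail-shortest e P s)
    where
    fresh : ∀ {w} → w ∈ˡ vertices P → x ≢ w
    fresh i refl with split∈ P i
    ... | Q , R , eq = <⇒≱ (s≤s (≤-trans (m≤n+m ∥ R ∥ ∥ Q ∥) (≤= eq))) (s R)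

  module _ (E? : Decidable E) where

    walkOfLength? : ∀ k x y → Dec (Σ (Star E x y) λ P → ∥ P ∥ ≡ k)
    walkOfLength? zero x y = map′ (λ { refl → ε , refl }) (λ { (ε , _) → refl ; (_ ◅ _ , ()) }) (x Finₚ.≟ y)
    walkOfLength? (suc k) x y =
      map′ (λ { (_ , e , P , eq) → e ◅ P , cong suc eq })
           (λ { (ε , ()) ; (e ◅ P , eq) → _ , e , P , suc-injective eq })
           (Finₚ.any? λ z → E? x z ×-dec walkOfLength? k z y)

    shorten : ∀ {x y} k (P : Star E x y) → ∥ P ∥ ≤ k → Σ (Star E x y) IsShortest
    shorten {x} {y} k P h with Finₚ.any? {n = ∥ P ∥} (λ i → walkOfLength? (toℕ i) x y)
    shorten k P h | no none = P , λ Q → ≮⇒≥ λ q → none (fromℕ< q , Q , sym (Finₚ.toℕ-fromℕ< q))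
    shorten zero    P h | yes (i , Q , eq) with ≤-trans (Finₚ.toℕ<n i) h
    ... | ()
    shorten (suc k) P h | yes (i , Q , eq) =
      shorten k Q (≤-trans (≤= eq) (≤-pred (≤-trans (Finₚ.toℕ<n i) h)))

    shortest : ∀ {x y} → Star E x y → Σ (Star E x y) IsShortest
    shortest P = shorten ∥ P ∥ P ≤-refl

    path-length : ∀ {x y} (P : Star E x y) → IsPath P → ∥ P ∥ < n
    path-length P u = ≮⇒≥ λ { (s≤s h) → clash (Finₚ.pigeonhole (s≤s h) (at P ∘ toℕ)) }
      where
      clash : ¬ (∃[ i ] ∃[ j ] i Fin.< j × at P (toℕ {suc ∥ P ∥} i) ≡ at P (toℕ j))
      clash (i , j , lt , eq) = at-injective P u (toℕ i) (toℕ j) lt (≤-pred (Finₚ.toℕ<n j)) eq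

    -- A shortest walk is a path and so has fewer than `n` edges; searching the lengths below `n` is
    -- therefore complete.
    walk? : Decidable (Star E)
    walk? x y = map′ (λ { (_ , P , _) → P }) short (Finₚ.any? {n = n} λ i → walkOfLength? (toℕ i) x y)
      where
      short : Star E x y → ∃[ i ] Σ (Star E x y) λ P → ∥ P ∥ ≡ toℕ {n} i
      short P with shortest P
      ... | Q , s = let h = path-length Q (shortest⇒path Q s) in
                    fromℕ< h , Q , sym (Finₚ.toℕ-fromℕ< h)
bounded : ∀ {n} (f : Fin n → ℕ) → ∃[ m ] ∀ i → f i < m
bounded {zero}  f = 0 , λ ()
bounded {suc n} f with bounded (f ∘ Fin.suc)
... | m , h = suc (f Fin.zero) + m , λ where
  Fin.zero    → m≤m+n _ m
  (Fin.suc i) → ≤-trans (h i) (m≤n+m m _)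

module _ {n} {G H : Graph n} (f : ∀ {u v} → Adj G u v → Adj H u v) where

  mapWalk : ∀ {x y} → Walk G x y → Walk H x y
  mapWalk = Star.map f

  length-map : ∀ {x y} (P : Walk G x y) → ∥ mapWalk P ∥ ≡ ∥ P ∥
  length-map ε       = refl
  length-map (_ ◅ P) = cong suc (length-map P)

  vertices-map : ∀ {x y} (P : Walk G x y) → vertices (mapWalk P) ≡ vertices P
  vertices-map ε       = refl
  vertices-map {x} (_ ◅ P) = cong (x ∷_) (vertices-map P)

  edges-map : ∀ {x y} (P : Walk G x y) → edges (mapWalk P) ≡ edges P
  edges-map ε       = refl
  edges-map {x} (_◅_ {j = w} _ P) = cong ((x , w) ∷_) (edges-map P)

module _ {n} (G : Graph n) where

  back : ∀ {x y} → Walk G x y → Walk G y x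
  back ε       = ε
  back (e ◅ P) = back P ◅◅ (Graph.sym G e ◅ ε)

  length-back : ∀ {x y} (P : Walk G x y) → ∥ back P ∥ ≡ ∥ P ∥
  length-back ε       = refl
  length-back (e ◅ P) = begin
    ∥ back P ◅◅ (Graph.sym G e ◅ ε) ∥ ≡⟨ length-◅◅ (back P) _ ⟩
    ∥ back P ∥ + 1                    ≡⟨ +-comm _ 1 ⟩
    suc ∥ back P ∥                    ≡⟨ cong suc (length-back P) ⟩
    suc ∥ P ∥                         ∎
    where open ≡-Reasoning

-- Auxiliary facts on subsets, cycles, halves, bounded search and counting.

x∉p-x : ∀ {n} (p : Subset n) x → x ∉ p - x
x∉p-x (_ Vec.∷ p) Fin.zero    ()
x∉p-x (_ Vec.∷ p) (Fin.suc x) (Vec.there h) = x∉p-x p x h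

∈-remove : ∀ {n} {p : Subset n} {x y} → x ∈ p → x ≢ y → x ∈ p - y
∈-remove = x∈p∧x≢y⇒x∈p-y

∈-remove⁻ : ∀ {n} {p : Subset n} {x y} → x ∈ p - y → x ∈ p × x ≢ y
∈-remove⁻ {p = p} {x} h = p─q⊆p p _ h , λ { refl → x∉p-x p x h }

edge∈ : ∀ {n} {E : Fin n → Fin n → Set} {x y} (P : Star E x y) i → i < ∥ P ∥ →
        (at P i , at P (suc i)) ∈ˡ edges P
edge∈ (_ ◅ ε)     zero    _       = here refl
edge∈ (_ ◅ _ ◅ _) zero    _       = here refl
edge∈ (_ ◅ P)     (suc i) (s≤s h) = there (edge∈ P i h)

walk⊆ : ∀ {n} {G : Graph n} {W x y} → x ∈ W → (P : Walk (G [ W ]) x y) → ∀ {z} → z ∈ˡ vertices P → z ∈ W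
walk⊆ x∈ ε (here refl) = x∈
walk⊆ x∈ (_ ◅ P) (here refl) = x∈
walk⊆ {G = G} x∈ ((_ , y∈ , _) ◅ P) (there i) = walk⊆ {G = G} y∈ P i

module _ {n} {G : Graph n} (C : Cycle G) where
  open Cycle C

  position : ∀ {u v} → (u , v) ∈ˡ ((end , start) ∷ edges path) →
             (u ≡ end × v ≡ start) ⊎ (∃[ i ] i < ∥ path ∥ × at path i ≡ u × at path (suc i) ≡ v)
  position (here refl) = inj₁ (refl , refl)
  position (there i)   = inj₂ (edges-at path i)

  cycleEdge⇒adj : ∀ {u v} → CycleEdge C u v → Adj G u v
  cycleEdge⇒adj = Sum.[ directed , Graph.sym G ∘ directed ]′
    where
    directed : ∀ {u v} → (u , v) ∈ˡ ((end , start) ∷ edges path) → Adj G u v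
    directed e with position e
    ... | inj₁ (refl , refl)         = closing
    ... | inj₂ (i , h , refl , refl) = at-edge path i h

  cycleEdge⇒∈ : ∀ {u v} → CycleEdge C u v → v ∈ˡ vertices path
  cycleEdge⇒∈ (inj₁ e) with position e
  ... | inj₁ (_ , refl)         = start∈ path
  ... | inj₂ (i , _ , _ , refl) = at∈ path (suc i)
  cycleEdge⇒∈ (inj₂ e) with position e
  ... | inj₁ (refl , _)         = end∈ path
  ... | inj₂ (i , _ , refl , _) = at∈ path i

  ∈⇒cycleEdge : ∀ {v} → v ∈ˡ vertices path → ∃[ z ] CycleEdge C v z
  ∈⇒cycleEdge v∈ with ∈-at path v∈
  ... | i , h , refl with m≤n⇒m<n∨m≡n h
  ... | inj₁ lt   = at path (suc i) , inj₁ (there (edge∈ path i lt))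
  ... | inj₂ refl = start , inj₁ (here (cong (_, start) (at-end path)))

-- Here `L` is the number of edges of a path, which has k = L + 1 vertices, so j = (1 + k) / 2 is (2
-- + L) / 2. Counted from 0 the middle vertex has position `a`, and `b` edges follow it.
halves : ∀ L → ∃[ a ] ∃[ b ] a + b ≡ L × a ≤ b × b ≤ suc a × (2 + L) / 2 ≡ suc a
halves L with L % 2 in eq | m%n<n L 2
... | r | r<2 = L / 2 , r + L / 2 , total , m≤n+m _ r , +-monoˡ-≤ (L / 2) (≤-pred r<2) ,
  m/n≡1+[m∸n]/n {2 + L} {2} (s≤s (s≤s z≤n))
  where
  total : L / 2 + (r + L / 2) ≡ L
  total = trans (arith (L / 2) r) (trans (cong (_+ L / 2 * 2) (sym eq)) (sym (m≡m%n+[m/n]*n L 2)))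
    where
    arith : ∀ a r → a + (r + a) ≡ r + a * 2
    arith a r = solve (a ∷ r ∷ [])

last-below : ∀ {A : ℕ → Set} → (∀ i → Dec (A i)) → A 0 → ∀ m →
             ∃[ j ] A j × (∀ i → j < i → i ≤ m → ¬ A i)
last-below A? a₀ zero = 0 , a₀ , λ { _ lt z≤n → contradiction lt λ () }
last-below A? a₀ (suc m) with A? (suc m)
... | yes a = suc m , a , λ i lt h _ → <⇒≱ lt h
... | no ¬a with last-below A? a₀ m
... | j , a , f = j , a , λ i lt h a′ → [ (λ h′ → f i lt (≤-pred h′) a′) , (λ { refl → ¬a a′ }) ]′ (m≤n⇒m<n∨m≡n h)

-- The argument `g` is fuel: `A` is known to hold at `suc g + j`, so the search stops there at the
-- latest.
first-above : ∀ {A : ℕ → Set} → (∀ i → Dec (A i)) → ∀ g j → A (suc g + j) →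
              ∃[ k ] j < k × k ≤ suc g + j × A k × (∀ i → j < i → i < k → ¬ A i)
first-above A? zero    j a = suc j , ≤-refl , ≤-refl , a , λ i p q _ → <⇒≱ p (≤-pred q)
first-above {A} A? (suc g) j a with A? (suc j)
... | yes a′ = suc j , ≤-refl , s≤s (m≤n+m j (suc g)) , a′ , λ i p q _ → <⇒≱ p (≤-pred q)
... | no ¬a with first-above A? g (suc j) (subst A (sym (cong suc (+-suc g j))) a)
... | k , lt , h , a′ , f = k , ≤-trans (n≤1+n _) lt , ≤-trans h (≤= (cong suc (+-suc g j))) , a′ ,
  λ i p q a″ → [ (λ p′ → f i p′ q a″) , (λ { refl → ¬a a″ }) ]′ (m≤n⇒m<n∨m≡n p)

q*2≡q+q : ∀ q → q * 2 ≡ q + q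
q*2≡q+q q = solve (q ∷ [])

odd-half : ∀ l → ¬ 2 ∣ l → l ≡ suc (l / 2 + l / 2)
odd-half l ¬2∣l with l % 2 in eq | m%n<n l 2
... | zero        | _ = contradiction (m%n≡0⇒n∣m l 2 eq) ¬2∣l
... | suc zero    | _ = trans (m≡m%n+[m/n]*n l 2) (cong₂ _+_ eq (q*2≡q+q (l / 2)))
... | suc (suc _) | s≤s (s≤s ())

count-injection : ∀ {m n} (S : Subset m) (T : Subset n) (f : Fin m → Fin n) → (∀ {x} → x ∈ S → f x ∈ T) →
                  (∀ {x y} → x ∈ S → y ∈ S → f x ≡ f y → x ≡ y) → ∣ S ∣ ≤ ∣ T ∣
count-injection Vec.[] T f into inj = z≤n
count-injection (false Vec.∷ S) T f into inj =
  count-injection S T (f ∘ Fin.suc) (into ∘ Vec.there)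
    (λ x∈ y∈ eq → Finₚ.suc-injective (inj (Vec.there x∈) (Vec.there y∈) eq))
count-injection (true Vec.∷ S) T f into inj = ≤-trans
  -- Injectivity keeps the other images away from that of the first element, which can thus be
  -- removed from `T`.
  (s≤s (count-injection S (T - f Fin.zero) (f ∘ Fin.suc)
    (λ x∈ → ∈-remove (into (Vec.there x∈)) λ eq → case-zero (inj (Vec.there x∈) Vec.here eq))
    (λ x∈ y∈ eq → Finₚ.suc-injective (inj (Vec.there x∈) (Vec.there y∈) eq))))
  (x∈p⇒∣p-x∣<∣p∣ (into Vec.here))
  where
  case-zero : ∀ {k} {x : Fin k} → Fin.suc x ≢ Fin.zero
  case-zero ()

count-insert : ∀ {n} (S : Subset n) v → ∣ S ∪ ⁅ v ⁆ ∣ ≤ suc ∣ S ∣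
count-insert (true Vec.∷ S)  Fin.zero    = s≤s (≤-trans (≤= (cong ∣_∣ (∪-identityʳ S))) (n≤1+n _))
count-insert (false Vec.∷ S) Fin.zero    = s≤s (≤= (cong ∣_∣ (∪-identityʳ S)))
count-insert (true Vec.∷ S)  (Fin.suc v) = s≤s (count-insert S v)
count-insert (false Vec.∷ S) (Fin.suc v) = count-insert S v

three∈⇒3≤ : ∀ {n} {S : Subset n} {x y z} → x ∈ S → y ∈ S → z ∈ S → x ≢ y → y ≢ z → x ≢ z → 3 ≤ ∣ S ∣
three∈⇒3≤ {S = S} {x} {y} {z} x∈ y∈ z∈ x≢y y≢z x≢z = count-injection (⊤ {3}) S f (λ {i} _ → into i) (λ {i} {j} _ _ → inj i j)
  where
  f : Fin 3 → Fin _
  f Fin.zero = x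
  f (Fin.suc Fin.zero) = y
  f (Fin.suc (Fin.suc Fin.zero)) = z
  into : ∀ i → f i ∈ S
  into Fin.zero = x∈
  into (Fin.suc Fin.zero) = y∈
  into (Fin.suc (Fin.suc Fin.zero)) = z∈
  inj : ∀ i j → f i ≡ f j → i ≡ j
  inj Fin.zero Fin.zero _ = refl
  inj Fin.zero (Fin.suc Fin.zero) eq = contradiction eq x≢y
  inj Fin.zero (Fin.suc (Fin.suc Fin.zero)) eq = contradiction eq x≢z
  inj (Fin.suc Fin.zero) Fin.zero eq = contradiction (sym eq) x≢y
  inj (Fin.suc Fin.zero) (Fin.suc Fin.zero) _ = refl
  inj (Fin.suc Fin.zero) (Fin.suc (Fin.suc Fin.zero)) eq = contradiction eq y≢z
  inj (Fin.suc (Fin.suc Fin.zero)) Fin.zero eq = contradiction (sym eq) x≢z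
  inj (Fin.suc (Fin.suc Fin.zero)) (Fin.suc Fin.zero) eq = contradiction (sym eq) y≢z
  inj (Fin.suc (Fin.suc Fin.zero)) (Fin.suc (Fin.suc Fin.zero)) _ = refl

third∈ : ∀ {n} {S : Subset n} → 3 ≤ ∣ S ∣ → ∀ s t → ∃[ u ] u ∈ S × u ≢ s × u ≢ t
third∈ {S = S} h s t with Finₚ.any? (λ u → (u ∈? S) ×-dec ¬? (u Finₚ.≟ s) ×-dec ¬? (u Finₚ.≟ t))
... | yes k = k
... | no none = contradiction (≤-trans h (≤-trans (p⊆q⇒∣p∣≤∣q∣ sub)
  (≤-trans (count-insert ⁅ s ⁆ t) (s≤s (≤= (∣⁅x⁆∣≡1 s)))))) λ { (s≤s (s≤s ())) }
  where
  sub : S ⊆ ⁅ s ⁆ ∪ ⁅ t ⁆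
  sub {u} u∈ with u Finₚ.≟ s | u Finₚ.≟ t
  ... | yes refl | _        = p⊆p∪q ⁅ t ⁆ (x∈⁅x⁆ s)
  ... | no _     | yes refl = q⊆p∪q ⁅ s ⁆ ⁅ t ⁆ (x∈⁅x⁆ t)
  ... | no p     | no q     = contradiction (u , u∈ , p , q) none

argmax : ∀ {n} {P : Fin n → Set} (f : Fin n → ℕ) → (∀ i → Dec (P i)) → ∃ P →
         ∃[ i ] P i × (∀ {j} → P j → f j ≤ f i)
argmax {P = P} f P? (i₀ , p₀) with bounded f
... | m , bound = climb m i₀ p₀ (m≤m+n m _)
  where
  -- All values of `f` are below `m`, so `m ≤ k + f i` leaves at most `k` further increases.
  climb : ∀ k i → P i → m ≤ k + f i → ∃[ i ] P i × (∀ {j} → P j → f j ≤ f i)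
  climb k i p h with Finₚ.any? (λ j → P? j ×-dec (f i <? f j))
  ... | no none = i , p , λ {j} q → ≮⇒≥ λ lt → none (j , q , lt)
  climb zero    i p h | yes (j , q , lt) = contradiction (≤-trans h (<⇒≤ lt)) (<⇒≱ (bound j))
  climb (suc k) i p h | yes (j , q , lt) = climb k j q (≤-trans h (≤-trans (≥= (+-suc k (f i))) (+-monoʳ-≤ k lt)))

module _ {n} {P : Fin n → Set} (P? : ∀ i → Dec (P i)) where

  toSubset : Subset n
  toSubset = Vec.tabulate (does ∘ P?)

  ∈-toSubset⁺ : ∀ {i} → P i → i ∈ toSubset
  ∈-toSubset⁺ {i} p = Vecₚ.lookup⇒[]= i toSubset (trans (Vecₚ.lookup∘tabulate (does ∘ P?) i) (dec-true (P? i) p))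

  ∈-toSubset⁻ : ∀ {i} → i ∈ toSubset → P i
  ∈-toSubset⁻ {i} i∈ = decidable-stable (P? i) λ ¬p → contradiction
    (trans (sym (dec-false (P? i) ¬p)) (trans (sym (Vecₚ.lookup∘tabulate (does ∘ P?) i)) (Vecₚ.[]=⇒lookup i∈))) λ ()

-- Distances, betweenness and geodesics through prescribed vertices.

module BlockStructure {n} (G : Graph n) (conn : Connected G) where

  abstract
    geodesic : ∀ x y → ShortestPath G x y
    geodesic x y = shortest (Graph.adj? G) (conn x y)

  D : Fin n → Fin n → ℕ
  D x y = ∥ proj₁ (geodesic x y) ∥

  D-min : ∀ {x y} (P : Walk G x y) → D x y ≤ ∥ P ∥
  D-min {x} {y} = proj₂ (geodesic x y)

  D-shortest : ∀ {x y} (P : Walk G x y) → IsShortest P → ∥ P ∥ ≡ D x y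
  D-shortest {x} {y} P s = ≤-antisym (s (proj₁ (geodesic x y))) (D-min P)

  shortest-D : ∀ {x y} (P : Walk G x y) → ∥ P ∥ ≡ D x y → IsShortest P
  shortest-D P eq Q = ≤-trans (≤= eq) (D-min Q)

  Dist⇒D : ∀ {x y d} → Dist G x y d → D x y ≡ d
  Dist⇒D (P , s , eq) = trans (sym (D-shortest P s)) eq

  D⇒Dist : ∀ {x y d} → D x y ≡ d → Dist G x y d
  D⇒Dist {x} {y} eq = let P , s = geodesic x y in P , s , eq

  D-refl : ∀ x → D x x ≡ 0
  D-refl x = n≤0⇒n≡0 (D-min ε)

  D-zero : ∀ {x y} → D x y ≡ 0 → x ≡ y
  D-zero {x} {y} eq with proj₁ (geodesic x y)
  ... | ε = refl

  D-pos : ∀ {x y} → x ≢ y → 1 ≤ D x y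
  D-pos ne = n≢0⇒n>0 (ne ∘ D-zero)

  D-sym : ∀ x y → D x y ≡ D y x
  D-sym x y = ≤-antisym (half x y) (half y x)
    where
    half : ∀ x y → D x y ≤ D y x
    half x y = let P , _ = geodesic y x in ≤-trans (D-min (back G P)) (≤= (length-back G P))

  D-tri : ∀ x y z → D x z ≤ D x y + D y z
  D-tri x y z = let P , _ = geodesic x y ; Q , _ = geodesic y z in
    ≤-trans (D-min (P ◅◅ Q)) (≤= (length-◅◅ P Q))

  D-adj : ∀ {x y} → Adj G x y → D x y ≡ 1
  D-adj e = ≤-antisym (D-min (e ◅ ε)) (D-pos λ { refl → Graph.irrefl G e })

  D-step : ∀ {x y} → x ≢ y → ∃[ z ] Adj G x z × suc (D z y) ≡ D x y
  D-step {x} {y} ne with geodesic x y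
  ... | ε , _ = contradiction refl ne
  ... | (e ◅ P) , s = _ , e , cong suc (sym (D-shortest P λ Q → ≤-pred (s (e ◅ Q))))

  Btw : Fin n → Fin n → Fin n → Set
  Btw x y z = D x y + D y z ≡ D x z

  btw? : ∀ x y z → Dec (Btw x y z)
  btw? x y z = D x y + D y z ≟ D x z

  btw-sym : ∀ {x y z} → Btw x y z → Btw z y x
  btw-sym {x} {y} {z} h = trans (+-comm (D z y) (D y x))
    (trans (cong₂ _+_ (D-sym y x) (D-sym z y)) (trans h (D-sym x z)))

  btw-start : ∀ {x y} → Btw x x y
  btw-start {x} {y} = cong (_+ D x y) (D-refl x)

  btw-end : ∀ {x y} → Btw x y y
  btw-end {x} {y} = trans (cong (D x y +_) (D-refl y)) (+-identityʳ _)

  btw-antisym : ∀ {x y z} → Btw x y z → Btw x z y → y ≡ z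
  btw-antisym {x} {y} {z} h h′ = D-zero (n≤0⇒n≡0 (arith (D x y) (D y z) (D x z) (D z y) h h′))
    where
    arith : ∀ a b c d → a + b ≡ c → c + d ≡ a → b ≤ 0
    arith a b c d h h′ = linear d (≤= h ⊕ ≤= h′) (solve (a ∷ b ∷ c ∷ d ∷ []))

  btw-transˡ : ∀ {x v w t} → Btw x v w → Btw x w t → Btw x v t
  btw-transˡ {x} {v} {w} {t} h h′ = ≤-antisym
    (arith (D x v) (D v w) (D x w) (D w t) (D x t) (D v t) h h′ (D-tri v w t)) (D-tri x v t)
    where
    arith : ∀ a b c d e f → a + b ≡ c → c + d ≡ e → f ≤ b + d → a + f ≤ e
    arith a b c d e f h h′ k = linear 0 (k ⊕ ≤= h ⊕ ≤= h′) (solve (a ∷ b ∷ c ∷ d ∷ e ∷ f ∷ []))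

  btw-transʳ : ∀ {x v w t} → Btw x v w → Btw x w t → Btw v w t
  btw-transʳ {x} {v} {w} {t} h h′ = ≤-antisym
    (arith (D x v) (D v w) (D x w) (D w t) (D x t) (D v t) h h′ (D-tri x v t)) (D-tri v w t)
    where
    arith : ∀ a b c d e f → a + b ≡ c → c + d ≡ e → e ≤ a + f → b + d ≤ f
    arith a b c d e f h h′ k = linear 0 (k ⊕ ≤= h ⊕ ≤= h′) (solve (a ∷ b ∷ c ∷ d ∷ e ∷ f ∷ []))

  ∈-shortest⇒btw : ∀ {x y w} (P : Walk G x y) → ∥ P ∥ ≡ D x y → w ∈ˡ vertices P → Btw x w y
  ∈-shortest⇒btw {x} {y} {w} P eq i with split∈ P i
  ... | Q , R , eq′ = ≤-antisym
    (≤-trans (D-min Q ⊕ D-min R) (≤= (trans eq′ eq))) (D-tri x w y)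

  -- Both orders, as a geodesic may visit w and w′ in either one.
  Compatible : Fin n → Fin n → Fin n → Fin n → Set
  Compatible s t w w′ = (D s w + D w w′ + D w′ t ≡ D s t) ⊎ (D s w′ + D w′ w + D w t ≡ D s t)

  private
    -- A vertex between `s` and `u` reaches `t` through `u`, so the stretch from `u` to `t` cancels.
    inside-left : ∀ {s t u w w′} → Btw s w u → Btw s w′ u → Btw s u t →
                  D s w + D w w′ + D w′ t ≡ D s t → D s w + D w w′ + D w′ u ≡ D s u
    inside-left {s} {t} {u} {w} {w′} h h′ k eq =
      arith (D s w + D w w′) (D w′ t) (D s t) (D w′ u) (D s u) (D u t) eq (btw-transʳ h′ k) k
      where
      arith : ∀ a b c d e f → a + b ≡ c → d + f ≡ b → e + f ≡ c → a + d ≡ e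
      arith a b c d e f refl refl p = +-cancelʳ-≡ f (a + d) e (trans (+-assoc a d f) (sym p))

    inside-right : ∀ {s t u w w′} → Btw u w t → Btw u w′ t → Btw s u t →
                   D s w + D w w′ + D w′ t ≡ D s t → D u w + D w w′ + D w′ t ≡ D u t
    inside-right {s} {t} {u} {w} {w′} h h′ k eq =
      arith (D s w) (D w w′) (D w′ t) (D s t) (D u w) (D s u) (D u t) eq
        (btw-sym (btw-transʳ (btw-sym h) (btw-sym k))) k
      where
      arith : ∀ a b c d e f g → a + b + c ≡ d → f + e ≡ a → f + g ≡ d → e + b + c ≡ g
      arith a b c d e f g p q r = ≤-antisym
        (linear 0 (≤= p ⊕ ≤= q ⊕ ≥= r) (solve (a ∷ b ∷ c ∷ d ∷ e ∷ f ∷ g ∷ [])))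
        (linear 0 (≥= p ⊕ ≥= q ⊕ ≤= r) (solve (a ∷ b ∷ c ∷ d ∷ e ∷ f ∷ g ∷ [])))

  module _ (R : Fin n → Set) (R? : ∀ w → Dec (R w)) where

    Through : Fin n → Fin n → Set
    Through s t = Σ (Walk G s t) λ P → ∥ P ∥ ≡ D s t × (∀ w → R w → Btw s w t → w ∈ˡ vertices P)

    private
      -- Compatibility with `u` places each required vertex before or after `u`, hence on one of the
      -- two halves.
      glue : ∀ {s u t} → Btw s u t → (∀ w → R w → Btw s w t → Compatible s t w u) →
             Through s u → Through u t → Through s t
      glue {s} {u} {t} b comp (P , lP , onP) (Q , lQ , onQ) =
        P ◅◅ Q , trans (length-◅◅ P Q) (trans (cong₂ _+_ lP lQ) b) , λ w r h → on w r (comp w r h)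
        where
        on : ∀ w → R w → Compatible s t w u → w ∈ˡ vertices (P ◅◅ Q)
        on w r (inj₁ e) = ∈-◅◅ˡ P Q (onP w r (+-cancelʳ-≡ (D u t) _ _ (trans e (sym b))))
        on w r (inj₂ e) = ∈-◅◅ʳ P Q (onQ w r
          (+-cancelˡ-≡ (D s u) _ _ (trans (sym (+-assoc (D s u) _ _)) (trans e (sym b)))))

    -- By splitting at any one of the vertices.
    common-geodesic : ∀ k s t → D s t ≤ k →
      (∀ w w′ → R w → R w′ → Btw s w t → Btw s w′ t → Compatible s t w w′) → Through s t
    common-geodesic k s t bound comp
      with Finₚ.any? (λ w → R? w ×-dec btw? s w t ×-dec ¬? (w Finₚ.≟ s) ×-dec ¬? (w Finₚ.≟ t))
    ... | no none = proj₁ (geodesic s t) , refl , on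
      where
      on : ∀ w → R w → Btw s w t → w ∈ˡ vertices (proj₁ (geodesic s t))
      on w r b with w Finₚ.≟ s | w Finₚ.≟ t
      ... | yes refl | _        = start∈ (proj₁ (geodesic s t))
      ... | no _     | yes refl = end∈ (proj₁ (geodesic s t))
      ... | no p     | no q     = contradiction (w , r , b , p , q) none
    common-geodesic zero s t bound comp | yes (w , r , b , p , q) =
      contradiction (D-zero (m+n≡0⇒m≡0 (D s w) (trans b (n≤0⇒n≡0 bound)))) (≢-sym p)
    common-geodesic (suc k) s t bound comp | yes (u , r , b , p , q) =
      -- As `u` differs from both ends, each half is strictly shorter than the whole, which lowers
      -- the bound to `k`.
      glue b (λ w r′ h → comp w u r′ r h b)
        (common-geodesic k s u (arith (D s u) (D u t) (D s t) k b bound (D-pos q))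
          λ w w′ r r′ h h′ → left h h′ (comp w w′ r r′ (btw-transˡ h b) (btw-transˡ h′ b)))
        (common-geodesic k u t
          (arith (D u t) (D s u) (D s t) k (trans (+-comm (D u t) (D s u)) b) bound (D-pos (≢-sym p)))
          λ w w′ r r′ h h′ → right h h′ (comp w w′ r r′ (up h) (up h′)))
      where
      arith : ∀ a b c k → a + b ≡ c → c ≤ suc k → 1 ≤ b → a ≤ k
      arith a b c k h h′ h″ = linear 0 (≤= h ⊕ h′ ⊕ h″) (solve (a ∷ b ∷ c ∷ k ∷ []))
      left : ∀ {w w′} → Btw s w u → Btw s w′ u → Compatible s t w w′ → Compatible s u w w′
      left h h′ (inj₁ e) = inj₁ (inside-left h h′ b e)
      left h h′ (inj₂ e) = inj₂ (inside-left h′ h b e)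
      up : ∀ {w} → Btw u w t → Btw s w t
      up h = btw-sym (btw-transˡ (btw-sym h) (btw-sym b))
      right : ∀ {w w′} → Btw u w t → Btw u w′ t → Compatible s t w w′ → Compatible u t w w′
      right h h′ (inj₁ e) = inj₁ (inside-right h h′ b e)
      right h h′ (inj₂ e) = inj₂ (inside-right h′ h b e)

  -- Separation by a single vertex.

  Conn : Fin n → Fin n → Fin n → Set
  Conn c = Walk (G [ ⊤ - c ])

  conn-adj : ∀ {c x y} → x ≢ c → y ≢ c → Adj G x y → Conn c x y
  conn-adj p q e = (∈-remove ∈⊤ p , ∈-remove ∈⊤ q , e) ◅ ε

  conn-sym : ∀ {c x y} → Conn c x y → Conn c y x
  conn-sym {c} = back (G [ ⊤ - c ])

  -- The empty walk counts even at the deleted vertex, so `Conn c c c` holds; only a nonempty walk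
  -- keeps its source away from `c`.
  conn-source : ∀ {c x y} → x ≢ y → Conn c x y → x ≢ c
  conn-source ne ε = contradiction refl ne
  conn-source ne ((x∈ , _) ◅ _) = proj₂ (∈-remove⁻ x∈)

  abstract
    conn? : ∀ c x y → Dec (Conn c x y)
    conn? c = walk? (Graph.adj? (G [ ⊤ - c ]))

  meets-or-avoids : ∀ {c x y} (P : Walk G x y) → c ∈ˡ vertices P ⊎ x ≢ c × Conn c x y
  meets-or-avoids {c} {x} P with x Finₚ.≟ c
  ... | yes refl = inj₁ (start∈ P)
  meets-or-avoids ε | no ne = inj₂ (ne , ε)
  meets-or-avoids (e ◅ P) | no ne with meets-or-avoids P
  ... | inj₁ i        = inj₁ (there i)
  ... | inj₂ (p , Q) = inj₂ (ne , conn-adj ne p e ◅◅ Q)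

  separator-on-walk : ∀ {c x y} → ¬ Conn c x y → (P : Walk G x y) → c ∈ˡ vertices P
  separator-on-walk h P with meets-or-avoids P
  ... | inj₁ i       = i
  ... | inj₂ (_ , Q) = contradiction Q h

  separator-btw : ∀ {c x y} → ¬ Conn c x y → Btw x c y
  separator-btw {c} {x} {y} h =
    let P = proj₁ (geodesic x y) in ∈-shortest⇒btw P refl (separator-on-walk h P)

  ¬btw⇒conn : ∀ {c x y} → ¬ Btw x c y → Conn c x y
  ¬btw⇒conn {c} {x} {y} h = decidable-stable (conn? c x y) (h ∘ separator-btw)

  -- The first step of a geodesic out of `v` lowers the distance to `x`, so `v` cannot lie between
  -- `z` and `x` again.
  toward : ∀ {v x} → v ≢ x → ∃[ z ] Adj G v z × Conn v z x
  toward {v} {x} ne with D-step ne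
  ... | z , e , d = z , e , ¬btw⇒conn λ h →
    <⇒≢ (≤-trans (≤= d) (≤-trans (m≤n+m (D v x) (D z v)) (≤= h))) refl

  -- This holds exactly for the vertices of a common block, by `pair-block` and
  -- `biconnected⇒clique`. The two ends are exempt as separators, so adjacent vertices qualify.
  Insep : Fin n → Fin n → Set
  Insep x y = ∀ c → c ≢ x → c ≢ y → Conn c x y

  insep-adj : ∀ {x y} → Adj G x y → Insep x y
  insep-adj e c p q = conn-adj (≢-sym p) (≢-sym q) e

  insep-sym : ∀ {x y} → Insep x y → Insep y x
  insep-sym h c p q = conn-sym (h c q p)

  insep-refl : ∀ {x} → Insep x x
  insep-refl c _ _ = ε

  abstract
    insep? : ∀ x y → Dec (Insep x y)
    insep? x y = Finₚ.all? λ c → ¬? (c Finₚ.≟ x) →-dec (¬? (c Finₚ.≟ y) →-dec conn? c x y)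

    separator : ∀ {x y} → ¬ Insep x y → ∃[ c ] c ≢ x × c ≢ y × ¬ Conn c x y
    separator {x} {y} h
      with Finₚ.any? (λ c → ¬? (c Finₚ.≟ x) ×-dec ¬? (c Finₚ.≟ y) ×-dec ¬? (conn? c x y))
    ... | yes s = s
    ... | no none = contradiction
      (λ c p q → decidable-stable (conn? c x y) λ ¬c → none (c , p , q , ¬c)) h

  Cut : Fin n → Set
  Cut = IsCutVertex G

  separates⇒cut : ∀ {a x y} → x ≢ a → y ≢ a → ¬ Conn a x y → Cut a
  separates⇒cut {a} {x} {y} p q h c = h (c x y (∈-remove ∈⊤ p) (∈-remove ∈⊤ q))

  abstract
    connectedOff? : ∀ a → Dec (ConnectedOn G (⊤ - a))
    connectedOff? a = Finₚ.all? λ x → Finₚ.all? λ y →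
      (x ∈? (⊤ - a)) →-dec ((y ∈? (⊤ - a)) →-dec conn? a x y)

    cut? : ∀ a → Dec (Cut a)
    cut? a = ¬? (connectedOff? a)

    cut⇒separates : ∀ {a} → Cut a → ∃[ x ] ∃[ y ] x ≢ a × y ≢ a × ¬ Conn a x y
    cut⇒separates {a} h
      with Finₚ.any? (λ x → Finₚ.any? λ y →
             ¬? (x Finₚ.≟ a) ×-dec ¬? (y Finₚ.≟ a) ×-dec ¬? (conn? a x y))
    ... | yes s = s
    ... | no none = contradiction
      (λ x y x∈ y∈ → decidable-stable (conn? a x y) λ ¬c →
        none (x , y , proj₂ (∈-remove⁻ x∈) , proj₂ (∈-remove⁻ y∈) , ¬c)) h

  -- Cliques of the inseparability relation and their gates.

  Clique : Subset n → Set
  Clique B = ∀ {x y} → x ∈ B → y ∈ B → Insep x y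

  -- A form of `IsBlock` whose maximality is tested by single vertices. It can be decided, and it
  -- can be reached by adding one vertex at a time, because a vertex inseparable from all elements
  -- of a clique extends it to a clique.
  record MaxClique (B : Subset n) : Set where
    field
      inhabited : Nonempty B
      clique    : Clique B
      maximal   : ∀ {z} → (∀ {b} → b ∈ B → Insep z b) → z ∈ B

  open MaxClique public

  -- Every walk from x to B enters B at g.
  GateOf : Subset n → Fin n → Fin n → Set
  GateOf B x g = g ∈ B × (∀ {b} → b ∈ B → b ≢ g → ¬ Conn g x b)

  module _ {B : Subset n} (M : MaxClique B) where

    private
      -- If `x` reached the block off `g`, then `x` would have two independent accesses to it, would
      -- be inseparable from all its vertices, and would belong to it by maximality.
      neighbour-gate : ∀ {x g} → x ∉ B → g ∈ B → Adj G x g → GateOf B x g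
      neighbour-gate {x} {g} x∉ g∈ e = g∈ , λ b∈ ne w → x∉ (maximal M λ b′∈ → insep b∈ ne w b′∈)
        where
        insep : ∀ {b b′} → b ∈ B → b ≢ g → Conn g x b → b′ ∈ B → Insep x b′
        insep {b} {b′} b∈ ne w b′∈ c p q with b′ Finₚ.≟ g | c Finₚ.≟ g
        ... | yes refl | _        = insep-adj e c p q
        ... | no _     | yes refl = w ◅◅ clique M b∈ b′∈ c (≢-sym ne) q
        ... | no _     | no r     = conn-adj (≢-sym p) (≢-sym r) e ◅◅ clique M g∈ b′∈ c r q

      -- The last vertex before the walk first meets `B` has its successor as gate. The gate passes
      -- back along the walk, since a way from `x` into `B` off the gate would give one from `z`.
      gate-along : ∀ {x y} → Walk G x y → y ∈ B → ∃[ g ] GateOf B x g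
      gate-along {x} P y∈ with x ∈? B
      ... | yes x∈ = x , x∈ , λ b∈ ne w → conn-source (≢-sym ne) w refl
      gate-along ε       y∈ | no x∉ = contradiction y∈ x∉
      gate-along (_◅_ {j = z} e P) y∈ | no x∉ with z ∈? B
      ... | yes z∈ = z , neighbour-gate x∉ z∈ e
      ... | no z∉ with gate-along P y∈
      ... | g , g∈ , h = g , g∈ , λ b∈ ne w →
        h b∈ ne (conn-adj (λ { refl → z∉ g∈ }) (λ { refl → x∉ g∈ }) (Graph.sym G e) ◅◅ w)

    abstract
      gate : ∀ x → ∃[ g ] GateOf B x g
      gate x = gate-along (conn x (proj₁ (inhabited M))) (proj₂ (inhabited M))

    r : Fin n → Fin n
    r x = proj₁ (gate x)

    r∈ : ∀ x → r x ∈ B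
    r∈ x = proj₁ (proj₂ (gate x))

    r-separates : ∀ {x b} → b ∈ B → b ≢ r x → ¬ Conn (r x) x b
    r-separates {x} = proj₂ (proj₂ (gate x))

    r-btw : ∀ {x b} → b ∈ B → Btw x (r x) b
    r-btw {x} {b} b∈ with b Finₚ.≟ r x
    ... | yes refl = btw-end
    ... | no ne    = separator-btw (r-separates b∈ ne)

    r-unique : ∀ {x g} → GateOf B x g → r x ≡ g
    r-unique {x} {g} (g∈ , h) with r x Finₚ.≟ g
    ... | yes eq = eq
    ... | no ne  = btw-antisym (r-btw g∈) (separator-btw (h (r∈ x) ne))

    r-id : ∀ {x} → x ∈ B → r x ≡ x
    r-id {x} x∈ = r-unique (x∈ , λ b∈ ne w → conn-source (≢-sym ne) w refl)

    -- The gate lies between `x` and `a`, so by antisymmetry `a` does not lie between `x` and the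
    -- gate, and hence does not separate them.
    conn-r : ∀ {a x} → a ∈ B → r x ≢ a → Conn a x (r x)
    conn-r a∈ ne = ¬btw⇒conn λ h → ne (btw-antisym (r-btw a∈) h)

    conn-same-side : ∀ {a x b} → a ∈ B → b ∈ B → r x ≢ a → b ≢ a → Conn a x b
    conn-same-side {a} {x} a∈ b∈ p q = conn-r a∈ p ◅◅ clique M (r∈ x) b∈ a (≢-sym p) (≢-sym q)

    r-via : ∀ {a x z} → a ∈ B → z ≢ a → Conn a x z → r x ≡ a → r z ≡ a
    r-via {a} {x} {z} a∈ ne w eq with r z Finₚ.≟ a
    ... | yes eq′ = eq′
    ... | no ne′  = contradiction (w ◅◅ conn-r a∈ ne′)
      (subst (λ g → ¬ Conn g x (r z)) eq (r-separates (r∈ z) λ eq″ → ne′ (trans eq″ eq)))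

    separated : ∀ {x y} → r x ≢ r y → ¬ Conn (r x) x y
    separated {x} {y} ne w =
      r-separates (r∈ y) (≢-sym ne) (w ◅◅ conn-r (r∈ x) (≢-sym ne))

    D-via-gates : ∀ {x y} → r x ≢ r y → D x y ≡ D x (r x) + (D (r x) (r y) + D (r y) y)
    D-via-gates {x} {y} ne = sym (begin
      D x (r x) + (D (r x) (r y) + D (r y) y)
        ≡⟨ cong (D x (r x) +_) (btw-sym (r-btw {y} (r∈ x))) ⟩
      D x (r x) + D (r x) y
        ≡⟨ separator-btw (separated ne) ⟩
      D x y ∎)
      where open ≡-Reasoning

  -- The maximal cliques are exactly the blocks.

  private
    retract-edge : ∀ {B} (M : MaxClique B) {x y} → x ∉ B → Adj G x y → r M x ≡ r M y
    retract-edge M {x} {y} x∉ e with y Finₚ.≟ r M x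
    ... | yes eq = trans (sym eq) (sym (r-id M (subst (_∈ _) (sym eq) (r∈ M x))))
    ... | no ne  = sym (r-via M (r∈ M x) ne (conn-adj (λ eq → x∉ (subst (_∈ _) (sym eq) (r∈ M x))) ne e) refl)

    -- A walk is contracted onto its gates: edges inside the block survive, and all others collapse
    -- by `retract-edge`. The target `W` is kept general to serve for both `B` and `B - x`.
    retract : ∀ {B} (M : MaxClique B) {W} {H : Graph n} → (∀ {u v} → Adj H u v → Adj G u v) →
              ∀ {x y} → (∀ {z} → Walk H z y → r M z ∈ W) → Walk H x y → Walk (G [ W ]) (r M x) (r M y)
    retract M f into ε = ε
    retract {B} M {W} {H} f {x} into (_◅_ {j = z} e P) with x ∈? B | z ∈? B
    ... | no x∉  | _      = subst (λ a → Walk (G [ W ]) a _) (sym (retract-edge M x∉ (f e))) (retract M {H = H} f into P)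
    ... | yes _  | no z∉  = subst (λ a → Walk (G [ W ]) a _) (retract-edge M z∉ (Graph.sym G (f e))) (retract M {H = H} f into P)
    ... | yes x∈ | yes z∈ =
      (into (e ◅ P) , into P , subst₂ (Adj G) (sym (r-id M x∈)) (sym (r-id M z∈)) (f e)) ◅ retract M {H = H} f into P

  maxClique⇒biconnected : ∀ {B} → MaxClique B → Biconnected G B
  maxClique⇒biconnected {B} M = inhabited M , whole , punctured
    where
    whole : ConnectedOn G B
    whole u v u∈ v∈ = subst₂ (Walk (G [ B ])) (r-id M u∈) (r-id M v∈)
      (retract M {H = G} id (λ {z} _ → r∈ M z) (conn u v))
    punctured : ∀ x → x ∈ B → ConnectedOn G (B - x)
    punctured x x∈ u v u∈ v∈ with ∈-remove⁻ u∈ | ∈-remove⁻ v∈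
    ... | u∈B , p | v∈B , q = subst₂ (Walk (G [ B - x ])) (r-id M u∈B) (r-id M v∈B)
      (retract M {H = G [ ⊤ - x ]} (λ { (_ , _ , e) → e })
        -- Were `x` the gate of `z`, it would separate `z` from `v`, yet the rest of the walk joins
        -- them off `x`.
        (λ {z} w → ∈-remove (r∈ M z) λ eq → r-separates M v∈B (λ eq′ → q (trans eq′ eq))
          (subst (λ c → Conn c z v) (sym eq) w))
        (clique M u∈B v∈B x (≢-sym p) (≢-sym q)))

  biconnected⇒clique : ∀ {B} → Biconnected G B → Clique B
  biconnected⇒clique {B} (_ , whole , punctured) {x} {y} x∈ y∈ c p q with c ∈? B
  ... | yes c∈ = mapWalk {G = G [ B - c ]} {H = G [ ⊤ - c ]}
    (λ { (u∈ , v∈ , e) → ∈-remove ∈⊤ (proj₂ (∈-remove⁻ u∈)) , ∈-remove ∈⊤ (proj₂ (∈-remove⁻ v∈)) , e })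
    (punctured c c∈ x y (∈-remove x∈ (≢-sym p)) (∈-remove y∈ (≢-sym q)))
  ... | no c∉ = mapWalk {G = G [ B ]} {H = G [ ⊤ - c ]}
    (λ { (u∈ , v∈ , e) → ∈-remove ∈⊤ (λ { refl → c∉ u∈ }) , ∈-remove ∈⊤ (λ { refl → c∉ v∈ }) , e })
    (whole x y x∈ y∈)

  clique-insert : ∀ {B z} → Clique B → (∀ {b} → b ∈ B → Insep z b) → Clique (B ∪ ⁅ z ⁆)
  clique-insert {B} {z} cl f x∈ y∈ with x∈p∪q⁻ B ⁅ z ⁆ x∈ | x∈p∪q⁻ B ⁅ z ⁆ y∈
  ... | inj₁ i | inj₁ j = cl i j
  ... | inj₁ i | inj₂ j = subst (Insep _) (sym (x∈⁅y⁆⇒x≡y z j)) (insep-sym (f i))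
  ... | inj₂ i | inj₁ j = subst (λ x → Insep x _) (sym (x∈⁅y⁆⇒x≡y z i)) (f j)
  ... | inj₂ i | inj₂ j = subst₂ Insep (sym (x∈⁅y⁆⇒x≡y z i)) (sym (x∈⁅y⁆⇒x≡y z j)) insep-refl

  private
    -- The fuel `k` is at least the number of vertices outside `B`.
    grow : ∀ k {B} → n ≤ ∣ B ∣ + k → Nonempty B → Clique B → ∃[ B′ ] MaxClique B′ × B ⊆ B′
    grow k {B} h ne cl
      with Finₚ.any? (λ z → ¬? (z ∈? B) ×-dec Finₚ.all? (λ b → (b ∈? B) →-dec insep? z b))
    ... | no none = B , record
      { inhabited = ne ; clique = cl
      ; maximal = λ {z} f → decidable-stable (z ∈? B) λ z∉ → none (z , z∉ , λ b b∈ → f b∈) } , id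
    ... | yes (z , z∉ , f) with k
    ... | zero  = contradiction (≤-trans larger (∣p∣≤n (B ∪ ⁅ z ⁆)))
                    (≤⇒≯ (≤-trans h (≤= (+-identityʳ _))))
      where
      larger : ∣ B ∣ < ∣ B ∪ ⁅ z ⁆ ∣
      larger = p⊂q⇒∣p∣<∣q∣ (p⊆p∪q ⁅ z ⁆ , z , q⊆p∪q B ⁅ z ⁆ (x∈⁅x⁆ z) , z∉)
    ... | suc k′ with grow k′ {B ∪ ⁅ z ⁆} bound (z , q⊆p∪q B ⁅ z ⁆ (x∈⁅x⁆ z)) (clique-insert cl (f _))
      where
      larger : ∣ B ∣ < ∣ B ∪ ⁅ z ⁆ ∣
      larger = p⊂q⇒∣p∣<∣q∣ (p⊆p∪q ⁅ z ⁆ , z , q⊆p∪q B ⁅ z ⁆ (x∈⁅x⁆ z) , z∉)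
      bound : n ≤ ∣ B ∪ ⁅ z ⁆ ∣ + k′
      bound = ≤-trans h (≤-trans (≤= (+-suc ∣ B ∣ k′)) (+-monoˡ-≤ k′ larger))
    ... | B′ , M , sub = B′ , M , sub ∘ p⊆p∪q ⁅ z ⁆

  extend : ∀ {B} → Nonempty B → Clique B → ∃[ B′ ] MaxClique B′ × B ⊆ B′
  extend = grow n (m≤n+m n _)

  maxClique⇒block : ∀ {B} → MaxClique B → IsBlock G B
  maxClique⇒block M = maxClique⇒biconnected M , λ B′ bc sub z∈ →
    maximal M λ b∈ → biconnected⇒clique bc z∈ (sub b∈)

  block⇒maxClique : ∀ {B} → IsBlock G B → MaxClique B
  block⇒maxClique {B} (bc , mx) = record
    { inhabited = proj₁ bc ; clique = biconnected⇒clique bc ; maximal = max }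
    where
    max : ∀ {z} → (∀ {b} → b ∈ B → Insep z b) → z ∈ B
    -- A maximal clique around `B` and `z` is biconnected, so the maximality of the block pulls `z`
    -- back into `B`.
    max {z} f with extend (z , q⊆p∪q B ⁅ z ⁆ (x∈⁅x⁆ z)) (clique-insert (biconnected⇒clique bc) f)
    ... | B′ , M , sub = mx B′ (maxClique⇒biconnected M) (λ b∈ → sub (p⊆p∪q ⁅ z ⁆ b∈))
                           (sub (q⊆p∪q B ⁅ z ⁆ (x∈⁅x⁆ z)))

  abstract
    block? : ∀ B → Dec (MaxClique B)
    block? B = map′
      (λ { (ne , cl , mx) → record
        { inhabited = ne ; clique = λ x∈ → cl _ x∈ _
        ; maximal = λ {z} f → mx z (λ b b∈ → f b∈) } })
      (λ M → inhabited M , (λ x x∈ y y∈ → clique M x∈ y∈) , λ z f → maximal M (λ b∈ → f _ b∈))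
      (Finₚ.any? (_∈? B)
        ×-dec Finₚ.all? (λ x → (x ∈? B) →-dec Finₚ.all? λ y → (y ∈? B) →-dec insep? x y)
        ×-dec Finₚ.all? (λ z → Finₚ.all? (λ b → (b ∈? B) →-dec insep? z b) →-dec (z ∈? B)))

  -- Two blocks with a common vertex.

  module _ {B B′} (M : MaxClique B) (M′ : MaxClique B′) where

    -- A gate of `x` different from both `x` and `v` would separate these two, although they lie
    -- together in `B`.
    gate-of-shared : ∀ {v x} → v ∈ B → v ∈ B′ → x ∈ B → x ∈ B′ ⊎ r M′ x ≡ v
    gate-of-shared {v} {x} v∈ v∈′ x∈ with r M′ x Finₚ.≟ v | r M′ x Finₚ.≟ x
    ... | yes eq | _      = inj₂ eq
    ... | no _   | yes eq = inj₁ (subst (_∈ B′) eq (r∈ M′ x))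
    ... | no p   | no q   = contradiction (clique M x∈ v∈ (r M′ x) q p) (r-separates M′ v∈′ (≢-sym p))

    share-two⇒⊆ : ∀ {v x} → v ≢ x → v ∈ B → v ∈ B′ → x ∈ B → x ∈ B′ → B ⊆ B′
    share-two⇒⊆ ne v∈ v∈′ x∈ x∈′ z∈ with gate-of-shared v∈ v∈′ z∈ | gate-of-shared x∈ x∈′ z∈
    ... | inj₁ i | _      = i
    ... | inj₂ _ | inj₁ i = i
    ... | inj₂ p | inj₂ q = contradiction (trans (sym p) q) ne

  share-two⇒≡ : ∀ {B B′} → MaxClique B → MaxClique B′ → ∀ {v x} → v ≢ x →
                v ∈ B → v ∈ B′ → x ∈ B → x ∈ B′ → B ≡ B′
  share-two⇒≡ M M′ ne v∈ v∈′ x∈ x∈′ =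
    ⊆-antisym (share-two⇒⊆ M M′ ne v∈ v∈′ x∈ x∈′) (share-two⇒⊆ M′ M ne v∈′ v∈ x∈′ x∈)

  module _ {B B′} (M : MaxClique B) (M′ : MaxClique B′) (B≢ : B ≢ B′)
           {a} (a∈ : a ∈ B) (a∈′ : a ∈ B′) where

    shared-gate : ∀ {x} → x ∈ B → x ≢ a → r M′ x ≡ a
    shared-gate {x} x∈ ne with gate-of-shared M M′ a∈ a∈′ x∈
    ... | inj₁ x∈′ = contradiction (share-two⇒≡ M M′ ne x∈ x∈′ a∈ a∈′) B≢
    ... | inj₂ eq  = eq

    other-side : ∀ {x} → r M x ≢ a → r M′ x ≡ a
    other-side {x} ne with x Finₚ.≟ a
    ... | yes refl = r-id M′ a∈′
    ... | no x≢ = r-via M′ a∈′ x≢ (conn-sym (conn-r M a∈ ne)) (shared-gate (r∈ M x) ne)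

  pair-block : ∀ {x y} → Insep x y → ∃[ B ] MaxClique B × x ∈ B × y ∈ B
  pair-block {x} {y} h with extend {⁅ x ⁆ ∪ ⁅ y ⁆} (x , p⊆p∪q ⁅ y ⁆ (x∈⁅x⁆ x)) pair
    where
    singleton : Clique ⁅ x ⁆
    singleton u∈ v∈ = subst₂ Insep (sym (x∈⁅y⁆⇒x≡y x u∈)) (sym (x∈⁅y⁆⇒x≡y x v∈)) insep-refl
    pair : Clique (⁅ x ⁆ ∪ ⁅ y ⁆)
    pair = clique-insert singleton λ b∈ → subst (Insep y) (sym (x∈⁅y⁆⇒x≡y x b∈)) (insep-sym h)
  ... | B , M , sub = B , M , sub (p⊆p∪q ⁅ y ⁆ (x∈⁅x⁆ x)) , sub (q⊆p∪q ⁅ x ⁆ ⁅ y ⁆ (x∈⁅x⁆ y))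

  block-at : ∀ x → ∃[ B ] MaxClique B × x ∈ B
  block-at x with pair-block (insep-refl {x})
  ... | B , M , x∈ , _ = B , M , x∈

  -- Suppose `c` lies between `s` and `w`. If `t` shared the side of `w′`, then `c` would also lie
  -- between `w` and `t`, and a geodesic through `w` would pass `c` twice. So `c` lies between `w′`
  -- and `t`, and `w′` precedes `w`. The other case exchanges `w` and `w′`.
  separated-compatible : ∀ {c s t w w′} → c ≢ w → c ≢ w′ → ¬ Conn c w w′ →
                         Btw s w t → Btw s w′ t → Compatible s t w w′
  separated-compatible {c} {s} {t} {w} {w′} p q sep h h′ with side s
    where
    side : ∀ x → Btw x c w ⊎ Btw x c w′
    side x with conn? c x w
    ... | no ¬k = inj₁ (separator-btw ¬k)
    ... | yes k = inj₂ (separator-btw λ k′ → sep (conn-sym k ◅◅ k′))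
  ... | on = Sum.swap (go on)
    where
    core : ∀ {w w′} → c ≢ w → ¬ Conn c w w′ → Btw s w t → Btw s w′ t → Btw s c w →
           D s w′ + D w′ w + D w t ≡ D s t
    core {w} {w′} p sep h h′ k with conn? c t w′
    ... | no ¬l = ≤-antisym
      (arith (D s c) (D c w) (D s w) (D w′ c) (D c t) (D w′ t) (D w t) (D s t) (D s w′) (D w′ w)
        k (btw-sym (separator-btw ¬l)) (separator-btw (sep ∘ conn-sym)) h h′ (D-tri s c t))
      (≤-trans (D-tri s w′ t) (≤-trans (+-monoʳ-≤ (D s w′) (D-tri w′ w t)) (≥= (+-assoc (D s w′) _ _))))
      where
      arith : ∀ sc cw sw w′c ct w′t wt st sw′ w′w → sc + cw ≡ sw → w′c + ct ≡ w′t →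
              w′c + cw ≡ w′w → sw + wt ≡ st → sw′ + w′t ≡ st → st ≤ sc + ct → sw′ + w′w + wt ≤ st
      arith sc cw sw w′c ct w′t wt st sw′ w′w e₁ e₂ e₃ e₄ e₅ h =
        linear 0 (≤= e₁ ⊕ ≤= e₂ ⊕ ≥= e₃ ⊕ ≤= e₄ ⊕ ≤= e₅ ⊕ h)
          (solve (sc ∷ cw ∷ sw ∷ w′c ∷ ct ∷ w′t ∷ wt ∷ st ∷ sw′ ∷ w′w ∷ []))
    ... | yes l = contradiction (D-zero (n≤0⇒n≡0 (arith (D s c) (D c w) (D s w) (D w c) (D c t) (D w t) (D s t)
        k (btw-sym (separator-btw λ m → sep (conn-sym m ◅◅ l))) h (D-tri s c t)))) p
      where
      arith : ∀ sc cw sw wc ct wt st → sc + cw ≡ sw → wc + ct ≡ wt → sw + wt ≡ st → st ≤ sc + ct → cw ≤ 0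
      arith sc cw sw wc ct wt st e₁ e₂ e₃ h = linear wc (≤= e₁ ⊕ ≤= e₂ ⊕ ≤= e₃ ⊕ h)
        (solve (sc ∷ cw ∷ sw ∷ wc ∷ ct ∷ wt ∷ st ∷ []))
    go : Btw s c w ⊎ Btw s c w′ → Compatible s t w′ w
    go (inj₁ k) = inj₁ (core p sep h h′ k)
    go (inj₂ k) = inj₂ (core q (sep ∘ conn-sym) h′ h k)

  -- Cut vertices and the blocks around them.

  module NonTrivial (x₀ y₀ : Fin n) (x₀≢y₀ : x₀ ≢ y₀) where

    neighbour : ∀ v → ∃[ u ] Adj G v u
    neighbour v with v Finₚ.≟ x₀
    ... | yes refl = let u , e , _ = D-step x₀≢y₀ in u , e
    ... | no ne    = let u , e , _ = D-step ne in u , e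

    another-vertex : ∀ {B} → MaxClique B → ∀ v → ∃[ u ] u ∈ B × u ≢ v
    another-vertex {B} M v with Finₚ.any? (λ u → (u ∈? B) ×-dec ¬? (u Finₚ.≟ v))
    ... | yes h = h
    ... | no none = contradiction u∈ λ u∈ → none (u , u∈ , u≢v)
      where
      only : ∀ {b} → b ∈ B → b ≡ v
      only {b} b∈ = decidable-stable (b Finₚ.≟ v) λ ne → none (b , b∈ , ne)
      u = proj₁ (neighbour v)
      u≢v : u ≢ v
      u≢v eq = Graph.irrefl G (subst (Adj G v) eq (proj₂ (neighbour v)))
      u∈ : u ∈ B
      u∈ = maximal M λ b∈ → subst (Insep u) (sym (only b∈)) (insep-sym (insep-adj (proj₂ (neighbour v))))

    module _ {B} (M : MaxClique B) where

      gate-cut : ∀ {x} → x ≢ r M x → Cut (r M x)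
      gate-cut {x} ne = let b , b∈ , b≢ = another-vertex M (r M x) in
        separates⇒cut ne b≢ (r-separates M b∈ b≢)

      -- Two vertices separated by `a` cannot both have gates other than `a`, as those gates are
      -- joined within the block off `a`.
      behind-cut : ∀ {a} → a ∈ B → Cut a → ∃[ x ] x ≢ a × r M x ≡ a
      behind-cut {a} a∈ ca with cut⇒separates ca
      ... | x , y , p , q , sep with r M x Finₚ.≟ a | r M y Finₚ.≟ a
      ... | yes eq | _      = x , p , eq
      ... | no _   | yes eq = y , q , eq
      ... | no u   | no v   =
        contradiction (conn-same-side M a∈ (r∈ M y) u v ◅◅ conn-sym (conn-r M a∈ v)) sep

      -- An edge from `a` towards a vertex with gate `a` lies in some block. Were it `B`, the far
      -- end of the edge would reach that vertex off its gate.
      another-block : ∀ {a} → a ∈ B → Cut a → ∃[ B′ ] MaxClique B′ × a ∈ B′ × B ≢ B′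
      another-block {a} a∈ ca with behind-cut a∈ ca
      ... | x , x≢ , eq with toward (≢-sym x≢)
      ... | z , e , w with pair-block (insep-adj e)
      ... | B′ , M′ , a∈′ , z∈′ = B′ , M′ , a∈′ , λ { refl →
          r-separates M z∈′ (subst (z ≢_) (sym eq) z≢) (subst (λ c → Conn c x z) (sym eq) (conn-sym w)) }
        where
        z≢ : z ≢ a
        z≢ refl = Graph.irrefl G e

    shared⇒cut : ∀ {B B′} → MaxClique B → MaxClique B′ → B ≢ B′ → ∀ {v} → v ∈ B → v ∈ B′ → Cut v
    shared⇒cut M M′ B≢ {v} v∈ v∈′ = let x , x∈ , x≢ = another-vertex M v
                                        eq = shared-gate M M′ B≢ v∈ v∈′ x∈ x≢ in
      subst Cut eq (gate-cut M′ (subst (x ≢_) (sym eq) x≢))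

    noncut-block : ∀ {B B′} → MaxClique B → MaxClique B′ → ∀ {v} → ¬ Cut v → v ∈ B → v ∈ B′ → B ≡ B′
    noncut-block {B} {B′} M M′ nc v∈ v∈′ =
      decidable-stable (Vecₚ.≡-dec Bool._≟_ B B′) λ B≢ → nc (shared⇒cut M M′ B≢ v∈ v∈′)

  private
    witness : ∀ {B B′} → MaxClique B → MaxClique B′ → B ≢ B′ → ∃[ x ] x ∈ B × x ∉ B′
    witness {B} {B′} M M′ B≢ with Finₚ.any? (λ x → (x ∈? B) ×-dec ¬? (x ∈? B′))
    ... | yes k = k
    ... | no none = contradiction (⊆-antisym sub λ z∈ → maximal M λ b∈ → clique M′ z∈ (sub b∈)) B≢
      where
      sub : B ⊆ B′
      sub {x} x∈ = decidable-stable (x ∈? B′) λ x∉ → none (x , x∈ , x∉)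

  two-vertices : CutTreeHasTwoNodes G → ∃[ x ] ∃[ y ] x ≢ y
  two-vertices (cut a , _ , ca , _ , _) = let x , _ , x≢a , _ = cut⇒separates ca in x , a , x≢a
  two-vertices (block _ , cut a , _ , ca , _) = let x , _ , x≢a , _ = cut⇒separates ca in x , a , x≢a
  two-vertices (block B , block B′ , bl , bl′ , ne) =
    let M = block⇒maxClique bl
        M′ = block⇒maxClique bl′
        x , _ , x∉ = witness M M′ λ { refl → ne refl }
        b , b∈ = inhabited M′
    in x , b , λ eq → x∉ (subst (_∈ B′) (sym eq) b∈)

  cut-vertex : ∀ {x y} → x ≢ y → CutTreeHasTwoNodes G → ∃ Cut
  cut-vertex _ (cut a , _ , ca , _ , _) = a , ca
  cut-vertex _ (block _ , cut a , _ , ca , _) = a , ca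
  cut-vertex x≢y (block B , block B′ , bl , bl′ , ne) =
    let M′ = block⇒maxClique bl′
        x , _ , x∉ = witness (block⇒maxClique bl) M′ λ { refl → ne refl }
    in r M′ x , NonTrivial.gate-cut _ _ x≢y M′ λ eq → x∉ (subst (_∈ B′) (sym eq) (r∈ M′ x))

-- In a cactus every block is an edge or an induced cycle.

module CactusBlocks {n} (G : Graph n) (cactus : Cactus G) (x₀ y₀ : Fin n) (x₀≢y₀ : x₀ ≢ y₀) where
  open BlockStructure G (proj₁ cactus) public
  open NonTrivial x₀ y₀ x₀≢y₀ public

  module _ {B : Subset n} where

    private
      forget : ∀ {u v} → Adj (G [ B ]) u v → Adj G u v
      forget (_ , _ , e) = e

    ambient : Cycle (G [ B ]) → Cycle G
    ambient C = record
      { path    = mapWalk {G = G [ B ]} {H = G} forget path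
      ; simple  = subst AllPairs-≢ (sym (vertices-map {G = G [ B ]} {H = G} forget path)) simple
      ; long    = ≤-trans long (≥= (length-map {G = G [ B ]} {H = G} forget path))
      ; closing = forget closing }
      where
      open Cycle C
      AllPairs-≢ = AllPairs.AllPairs {A = Fin n} _≢_

    ambient-edges : ∀ (C : Cycle (G [ B ])) {u v} → CycleEdge C u v ≡ CycleEdge (ambient C) u v
    ambient-edges C {u} {v} = cong (λ es → (u , v) ∈ˡ (_ ∷ es) ⊎ (v , u) ∈ˡ (_ ∷ es))
      (sym (edges-map {G = G [ B ]} {H = G} forget (Cycle.path C)))

    cactus-in : ∀ (C C′ : Cycle (G [ B ])) {u v} → CycleEdge C u v → CycleEdge C′ u v →
                ∀ {x y} → CycleEdge C x y → CycleEdge C′ x y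
    cactus-in C C′ {u} {v} e e′ {x} {y} k = subst id (sym (ambient-edges C′))
      (Equivalence.to (proj₂ cactus (ambient C) (ambient C′) u v
        (subst id (ambient-edges C) e) (subst id (ambient-edges C′) e′) x y) (subst id (ambient-edges C) k))

  module _ {B : Subset n} (M : MaxClique B) where

    private
      whole : ConnectedOn G B
      whole = proj₁ (proj₂ (maxClique⇒biconnected M))

      punctured : ∀ x → x ∈ B → ConnectedOn G (B - x)
      punctured = proj₂ (proj₂ (maxClique⇒biconnected M))

    -- Deleting `v` leaves the block connected; a shortest walk from `w` to `z` off `v` is closed up
    -- by the two edges at `v`.
    cycle-through : ∀ {v w z} → w ≢ z → Adj (G [ B ]) v w → Adj (G [ B ]) v z →
                    Σ (Cycle (G [ B ])) λ C → CycleEdge C v w × CycleEdge C v z × v ∈ˡ cycleVertices C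
    cycle-through {v} {w} {z} w≢z ew@(v∈ , w∈ , e) ez@(_ , z∈ , e′) = C , inj₁ (there (here refl)) , inj₂ (here refl) , here refl
      where
      off : ∀ {u} → Adj G v u → u ≢ v
      off e refl = Graph.irrefl G e
      w∈′ = ∈-remove w∈ (off e)
      shrink : ∀ {u u′} → Adj (G [ B - v ]) u u′ → Adj (G [ B ]) u u′
      shrink (u∈ , u′∈ , k) = proj₁ (∈-remove⁻ u∈) , proj₁ (∈-remove⁻ u′∈) , k
      geo = shortest (Graph.adj? (G [ B - v ])) (punctured v v∈ w z w∈′ (∈-remove z∈ (off e′)))
      P₀ = proj₁ geo
      P = mapWalk {G = G [ B - v ]} {H = G [ B ]} shrink P₀
      same : vertices P ≡ vertices P₀
      same = vertices-map {G = G [ B - v ]} {H = G [ B ]} shrink P₀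
      positive : (Q : Walk (G [ B ]) w z) → 1 ≤ ∥ Q ∥
      positive ε       = contradiction refl w≢z
      positive (_ ◅ _) = s≤s z≤n
      C : Cycle (G [ B ])
      C = record
        { path    = ew ◅ P
        ; simple  = All.tabulate (λ {u} u∈ → ≢-sym (proj₂ (∈-remove⁻ (walk⊆ {G = G} w∈′ P₀ (subst (u ∈ˡ_) same u∈)))))
                    AllPairs.∷ subst (AllPairs.AllPairs _≢_) (sym same)
                                 (shortest⇒path P₀ (proj₂ geo))
        ; long    = s≤s (positive P)
        ; closing = Graph.sym (G [ B ]) {v} {z} ez }

    -- An edge of the block leaving the cycle at v closes, with one of the two
    -- cycle edges at v, a second cycle, which the cactus property identifies with the first.
    cycle-closed : ∀ (C : Cycle (G [ B ])) {v w} → v ∈ˡ cycleVertices C → Adj (G [ B ]) v w → CycleEdge C v w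
    cycle-closed C {v} {w} v∈ e with ∈⇒cycleEdge C v∈
    ... | z , k with w Finₚ.≟ z
    ... | yes refl = k
    ... | no w≢z with cycle-through w≢z e (cycleEdge⇒adj C k)
    ... | C′ , kw , kz , _ = cactus-in C′ C kz k kw

    cycle-spans : ∀ (C : Cycle (G [ B ])) → Cycle.start C ∈ B → ∀ v → v ∈ B → v ∈ˡ cycleVertices C
    cycle-spans C s∈ v v∈ = spread (start∈ (Cycle.path C)) (whole (Cycle.start C) v s∈ v∈)
      where
      spread : ∀ {u} → u ∈ˡ cycleVertices C → Walk (G [ B ]) u v → v ∈ˡ cycleVertices C
      spread u∈ ε       = u∈
      spread u∈ (e ◅ P) = spread (cycleEdge⇒∈ C (cycle-closed C u∈ e)) P

    edge-or-cycle : IsEdge G B ⊎ (∃[ l ] IsCycle G B l)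
    edge-or-cycle with inhabited M
    ... | x , x∈ with another-vertex M x
    ... | u , u∈ , u≢x with whole x u x∈ u∈
    ... | ε = contradiction refl u≢x
    ... | _◅_ {j = y} e@(_ , y∈ , xy) _ with Finₚ.any? (λ z → (z ∈? B) ×-dec ¬? (z Finₚ.≟ x) ×-dec ¬? (z Finₚ.≟ y))
    ... | no none = inj₁ (x , y , xy , ⊆-antisym sub sup)
      where
      sub : B ⊆ ⁅ x ⁆ ∪ ⁅ y ⁆
      sub {z} z∈ with z Finₚ.≟ x | z Finₚ.≟ y
      ... | yes refl | _        = p⊆p∪q ⁅ y ⁆ (x∈⁅x⁆ x)
      ... | no _     | yes refl = q⊆p∪q ⁅ x ⁆ ⁅ y ⁆ (x∈⁅x⁆ y)
      ... | no p     | no q     = contradiction (z , z∈ , p , q) none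
      sup : ⁅ x ⁆ ∪ ⁅ y ⁆ ⊆ B
      sup z∈ with x∈p∪q⁻ ⁅ x ⁆ ⁅ y ⁆ z∈
      ... | inj₁ i = subst (_∈ B) (sym (x∈⁅y⁆⇒x≡y x i)) x∈
      ... | inj₂ i = subst (_∈ B) (sym (x∈⁅y⁆⇒x≡y y i)) y∈
    ... | yes (z , z∈ , z≢x , z≢y)
      -- A walk from `x` to `z` off `y` begins with a second neighbour of `x`, which gives a cycle
      -- through `x`.
      with punctured y y∈ x z (∈-remove x∈ λ { refl → Graph.irrefl G xy }) (∈-remove z∈ z≢y)
    ... | ε = contradiction refl z≢x
    ... | (_ , y′∈ , e′) ◅ _ with cycle-through (≢-sym (proj₂ (∈-remove⁻ y′∈))) e (x∈ , proj₁ (∈-remove⁻ y′∈) , e′)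
    ... | C , _ , _ , _ = inj₂ (cycleLength C , C , spans , (λ u v k → cycle-closed C (spans u (proj₁ k)) k) , refl)
      where
      spans = cycle-spans C (proj₁ (cycleEdge⇒adj C (proj₂ (∈⇒cycleEdge C (start∈ (Cycle.path C))))))

  -- Blocks as periodic sequences, and their metric.

  -- A block read around its cycle, periodically; an edge counts as a cycle of length 2.
  record Listing (B : Subset n) (l : ℕ) : Set where
    field
      c        : ℕ → Fin n
      l≥2      : 2 ≤ l
      periodic : ∀ i → c (l + i) ≡ c i
      c∈       : ∀ i → c i ∈ B
      onto     : ∀ {b} → b ∈ B → ∃[ i ] i < l × c i ≡ b
      step     : ∀ i → Adj G (c i) (c (suc i))
      -- Stated at `suc i` so that both cyclic neighbours are named without a predecessor.
      nbr      : ∀ i {y} → y ∈ B → Adj G (c (suc i)) y → y ≡ c (suc (suc i)) ⊎ y ≡ c i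
      -- A vertex recurs no sooner than a full turn later, so any `l` consecutive indices give
      -- distinct vertices.
      inj      : ∀ {i j} → c i ≡ c j → i < j → l + i ≤ j

  edge-listing : ∀ {B} → IsEdge G B → Listing B 2
  edge-listing {B} (u , v , e , refl) = record
    { c = c ; l≥2 = ≤-refl ; periodic = λ i → refl ; c∈ = c∈ ; onto = onto ; step = step
    ; nbr = λ i y∈ k → inj₂ (nbr i y∈ k) ; inj = inj }
    where
    c : ℕ → Fin n
    c zero          = u
    c (suc zero)    = v
    c (suc (suc i)) = c i
    u≢v : u ≢ v
    u≢v refl = Graph.irrefl G e
    c∈ : ∀ i → c i ∈ B
    c∈ zero          = p⊆p∪q ⁅ v ⁆ (x∈⁅x⁆ u)
    c∈ (suc zero)    = q⊆p∪q ⁅ u ⁆ ⁅ v ⁆ (x∈⁅x⁆ v)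
    c∈ (suc (suc i)) = c∈ i
    onto : ∀ {b} → b ∈ B → ∃[ i ] i < 2 × c i ≡ b
    onto b∈ with x∈p∪q⁻ ⁅ u ⁆ ⁅ v ⁆ b∈
    ... | inj₁ i = 0 , s≤s z≤n , sym (x∈⁅y⁆⇒x≡y u i)
    ... | inj₂ i = 1 , s≤s (s≤s z≤n) , sym (x∈⁅y⁆⇒x≡y v i)
    step : ∀ i → Adj G (c i) (c (suc i))
    step zero          = e
    step (suc zero)    = Graph.sym G e
    step (suc (suc i)) = step i
    nbr : ∀ i {y} → y ∈ B → Adj G (c (suc i)) y → y ≡ c i
    nbr (suc (suc i)) y∈ k = nbr i y∈ k
    nbr i y∈ k with x∈p∪q⁻ ⁅ u ⁆ ⁅ v ⁆ y∈
    nbr zero       y∈ k | inj₁ p = x∈⁅y⁆⇒x≡y u p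
    nbr zero       y∈ k | inj₂ p with x∈⁅y⁆⇒x≡y v p
    ... | refl = contradiction k (Graph.irrefl G)
    nbr (suc zero) y∈ k | inj₂ p = x∈⁅y⁆⇒x≡y v p
    nbr (suc zero) y∈ k | inj₁ p with x∈⁅y⁆⇒x≡y u p
    ... | refl = contradiction k (Graph.irrefl G)
    nbr (suc (suc i)) y∈ k | _ = nbr i y∈ k
    inj : ∀ {i j} → c i ≡ c j → i < j → 2 + i ≤ j
    inj {suc (suc i)} {suc (suc j)} eq (s≤s (s≤s h)) = s≤s (s≤s (inj {i} eq h))
    inj {zero}        {suc zero}    eq _ = contradiction eq u≢v
    inj {zero}        {suc (suc j)} eq _ = s≤s (s≤s z≤n)
    inj {suc zero}    {suc zero}    eq (s≤s ())
    inj {suc zero}    {suc (suc zero)} eq _ = contradiction (sym eq) u≢v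
    inj {suc zero}    {suc (suc (suc j))} eq _ = s≤s (s≤s (s≤s z≤n))
    inj {suc (suc i)} {suc zero} eq (s≤s ())

  cycle-listing : ∀ {B l} → IsCycle G B l → Listing B l
  cycle-listing {B} (C , spans , induced , refl) = record
    { c = c ; l≥2 = s≤s (≤-trans (s≤s z≤n) long)
    ; periodic = λ i → cong (at path) (trans (cong (_% l) (+-comm l i)) ([m+n]%n≡m%n i l))
    ; c∈ = c∈ ; onto = onto ; step = proj₂ ∘ proj₂ ∘ step ; nbr = nbr ; inj = inj }
    where
    open Cycle C
    m = ∥ path ∥
    l = suc m
    c : ℕ → Fin n
    c i = at path (i % l)
    start∈B : start ∈ B
    start∈B = proj₁ (proj₂ closing)
    c∈ : ∀ i → c i ∈ B
    c∈ i = walk⊆ {G = G} start∈B path (at∈ path (i % l))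
    small : ∀ {i} → i ≤ m → i % l ≡ i
    small h = m<n⇒m%n≡m (s≤s h)
    onto : ∀ {b} → b ∈ B → ∃[ i ] i < l × c i ≡ b
    onto b∈ with ∈-at path (spans _ b∈)
    ... | i , h , eq = i , s≤s h , trans (cong (at path) (small h)) eq
    suc-% : ∀ i → suc i % l ≡ suc (i % l) % l
    suc-% i = trans (cong (λ k → suc k % l) (m≡m%n+[m/n]*n i l)) ([m+kn]%n≡m%n (suc (i % l)) (i / l) l)
    c-injective : ∀ {i j} → c i ≡ c j → i % l ≡ j % l
    c-injective {i} {j} eq with <-cmp (i % l) (j % l)
    ... | tri≈ _ p _ = p
    ... | tri< p _ _ = contradiction eq (at-injective path simple _ _ p (≤-pred (m%n<n j l)))
    ... | tri> _ _ p = contradiction (sym eq) (at-injective path simple _ _ p (≤-pred (m%n<n i l)))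
    suc-cong : ∀ {i j} → i % l ≡ j % l → suc i % l ≡ suc j % l
    suc-cong {i} {j} eq = trans (suc-% i) (trans (cong (λ k → suc k % l) eq) (sym (suc-% j)))
    add-cong : ∀ k {i j} → i % l ≡ j % l → (k + i) % l ≡ (k + j) % l
    add-cong zero    eq = eq
    add-cong (suc k) {i} {j} eq = suc-cong {k + i} {k + j} (add-cong k eq)
    -- Since `m` is `l` minus 1, adding it undoes a successor modulo `l`; `nbr` cancels `suc` in
    -- this way.
    wrap : ∀ i → (m + suc i) % l ≡ i % l
    wrap i = trans (cong (_% l) (trans (+-suc m i) (cong suc (+-comm m i)))) (trans (cong (_% l) (sym (+-suc i m))) ([m+n]%n≡m%n i l))
    step : ∀ i → Adj (G [ B ]) (c i) (c (suc i))
    step i with m≤n⇒m<n∨m≡n (≤-pred (m%n<n i l))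
    ... | inj₁ lt = subst (λ k → Adj (G [ B ]) (c i) (at path k)) (sym (trans (suc-% i) (small lt))) (at-edge path (i % l) lt)
    ... | inj₂ eq = subst₂ (Adj (G [ B ])) (trans (sym (at-end path)) (cong (at path) (sym eq)))
      (cong (at path) (sym (trans (suc-% i) (trans (cong (λ k → suc k % l) eq) (n%n≡0 l))))) closing
    directed : ∀ {u v} → (u , v) ∈ˡ ((end , start) ∷ edges path) → ∃[ k ] u ≡ c k × v ≡ c (suc k)
    directed e with position C e
    ... | inj₁ (refl , refl) = m , trans (sym (at-end path)) (cong (at path) (sym (small ≤-refl))) ,
      cong (at path) (sym (n%n≡0 l))
    ... | inj₂ (i , h , refl , refl) = i , cong (at path) (sym (small (<⇒≤ h))) , cong (at path) (sym (small h))
    nbr : ∀ i {y} → y ∈ B → Adj G (c (suc i)) y → y ≡ c (suc (suc i)) ⊎ y ≡ c i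
    nbr i y∈ e with induced _ _ (c∈ (suc i) , y∈ , e)
    ... | inj₁ k with directed k
    ... | j , eq , refl = inj₁ (cong (at path) (suc-cong {j} {suc i} (sym (c-injective {suc i} {j} eq))))
    nbr i y∈ e | inj₂ k with directed k
    ... | j , refl , eq = inj₂ (cong (at path) (trans (sym (wrap j))
      (trans (add-cong m {suc j} {suc i} (sym (c-injective {suc i} {suc j} eq))) (wrap i))))
    inj : ∀ {i j} → c i ≡ c j → i < j → l + i ≤ j
    inj {i} {j} eq lt = begin
      l + i                       ≡⟨ cong (l +_) (m≡m%n+[m/n]*n i l) ⟩
      l + (i % l + i / l * l)     ≡⟨ +-comm l (i % l + i / l * l) ⟩
      i % l + i / l * l + l       ≡⟨ +-assoc (i % l) (i / l * l) l ⟩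
      i % l + (i / l * l + l)     ≡⟨ cong₂ _+_ same (+-comm (i / l * l) l) ⟩
      j % l + suc (i / l) * l     ≤⟨ +-monoʳ-≤ (j % l) (*-monoˡ-≤ l quotient) ⟩
      j % l + j / l * l           ≡⟨ sym (m≡m%n+[m/n]*n j l) ⟩
      j                           ∎
      where
      open ≤-Reasoning
      same = c-injective {i} {j} eq
      quotient : i / l < j / l
      quotient = ≰⇒> λ h → <⇒≱ lt (begin
        j                 ≡⟨ m≡m%n+[m/n]*n j l ⟩
        j % l + j / l * l ≤⟨ +-mono-≤ (≤= (sym same)) (*-monoˡ-≤ l h) ⟩
        i % l + i / l * l ≡⟨ sym (m≡m%n+[m/n]*n i l) ⟩
        i                 ∎)

  module _ {B : Subset n} (M : MaxClique B) where

    -- The way from `p` to `x` and the way from `x` to `q` both pass the gate of `x`, so the excess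
    -- is twice the distance from `x` to that gate.
    convex : ∀ {p x q} → p ∈ B → q ∈ B → Btw p x q → x ∈ B
    convex {p} {x} {q} p∈ q∈ h = subst (_∈ B) (sym (D-zero (n≤0⇒n≡0
      (arith (D p x) (D p g) (D g x) (D x q) (D x g) (D g q) (D p q)
        (btw-sym (r-btw M {x} p∈)) (r-btw M {x} q∈) h (D-tri p g q))))) (r∈ M x)
      where
      g = r M x
      arith : ∀ px pg gx xq xg gq pq → pg + gx ≡ px → xg + gq ≡ xq → px + xq ≡ pq → pq ≤ pg + gq → xg ≤ 0
      arith px pg gx xq xg gq pq e₁ e₂ e₃ h = linear gx (≤= e₁ ⊕ ≤= e₂ ⊕ ≤= e₃ ⊕ h)
        (solve (px ∷ pg ∷ gx ∷ xq ∷ xg ∷ gq ∷ pq ∷ []))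

    private
      inner-walk′ : ∀ k {p q} → p ∈ B → q ∈ B → D p q ≡ k → Σ (Walk (G [ B ]) p q) λ P → ∥ P ∥ ≡ k
      inner-walk′ zero p∈ q∈ eq with D-zero eq
      ... | refl = ε , refl
      inner-walk′ (suc k) {p} {q} p∈ q∈ eq with D-step (λ { refl → contradiction (trans (sym eq) (D-refl p)) λ () })
      ... | z , e , d =
        let z∈ = convex p∈ q∈ (trans (cong (_+ D z q) (D-adj e)) d)
            P , l = inner-walk′ k z∈ q∈ (suc-injective (trans d eq))
        in (p∈ , z∈ , e) ◅ P , cong suc l

      forget : ∀ {u v} → Adj (G [ B ]) u v → Adj G u v
      forget (_ , _ , e) = e

      length≥D : ∀ {p q} (P : Walk (G [ B ]) p q) → D p q ≤ ∥ P ∥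
      length≥D P = ≤-trans (D-min (mapWalk {G = G [ B ]} {H = G} forget P))
                           (≤= (length-map {G = G [ B ]} {H = G} forget P))

    -- By convexity the geodesics of `G` between vertices of the block stay inside, so the distances
    -- of `G [ B ]` and `G` agree.
    inner-walk : ∀ {p q} → p ∈ B → q ∈ B → Σ (Walk (G [ B ]) p q) λ P → ∥ P ∥ ≡ D p q
    inner-walk p∈ q∈ = inner-walk′ _ p∈ q∈ refl

    inner-shortest : ∀ {p q} (P : Walk (G [ B ]) p q) → ∥ P ∥ ≡ D p q → IsShortest P
    inner-shortest P eq Q = ≤-trans (≤= eq) (length≥D Q)

    inner-length : ∀ {p q} → p ∈ B → q ∈ B → (P : Walk (G [ B ]) p q) → IsShortest P → ∥ P ∥ ≡ D p q
    inner-length p∈ q∈ P s = let Q , eq = inner-walk p∈ q∈ in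
      ≤-antisym (≤-trans (s Q) (≤= eq)) (length≥D P)

    innerDist⇒D : ∀ {p q d} → p ∈ B → q ∈ B → Dist (G [ B ]) p q d → D p q ≡ d
    innerDist⇒D p∈ q∈ (P , s , eq) = trans (sym (inner-length p∈ q∈ P s)) eq

    innerOn⇒btw : ∀ {p q w} → p ∈ B → q ∈ B → Σ (ShortestPath (G [ B ]) p q) (LiesOn w) → Btw p w q
    innerOn⇒btw {w = w} p∈ q∈ ((P , s) , i) = ∈-shortest⇒btw (mapWalk {G = G [ B ]} {H = G} forget P)
      (trans (length-map {G = G [ B ]} {H = G} forget P) (inner-length p∈ q∈ P s))
      (subst (w ∈ˡ_) (sym (vertices-map {G = G [ B ]} {H = G} forget P)) i)

    btw⇒innerOn : ∀ {p q w} → p ∈ B → q ∈ B → Btw p w q → Σ (ShortestPath (G [ B ]) p q) (LiesOn w)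
    btw⇒innerOn p∈ q∈ h =
      let w∈ = convex p∈ q∈ h
          P , lP = inner-walk p∈ w∈
          Q , lQ = inner-walk w∈ q∈
      in (P ◅◅ Q , inner-shortest (P ◅◅ Q) (trans (length-◅◅ P Q) (trans (cong₂ _+_ lP lQ) h))) ,
         ∈-◅◅ˡ P Q (end∈ P)

  module Arc {B : Subset n} (M : MaxClique B) {l : ℕ} (L : Listing B l) where
    open Listing L

    private
      -- Each step of a geodesic inside the block changes the index by one. The hypothesis `m ≤ i`
      -- leaves room for going back at every step.
      lift : ∀ m i {y} → y ∈ B → m ≤ i → D (c i) y ≡ m → ∃[ j ] c j ≡ y × j ≤ i + m × i ≤ j + m
      lift zero i y∈ h eq = i , D-zero eq , m≤m+n i 0 , m≤m+n i 0
      lift (suc m) (suc i) {y} y∈ (s≤s h) eq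
        with D-step (λ e → contradiction (trans (sym eq) (trans (cong (D (c (suc i))) (sym e)) (D-refl (c (suc i))))) λ ())
      ... | z , e , d with convex M (c∈ (suc i)) y∈ (trans (cong (_+ D z y) (D-adj e)) d)
      ... | z∈ with nbr i z∈ e
      ... | inj₁ refl with lift m (suc (suc i)) y∈ (≤-trans h (m≤n+m i 2)) (suc-injective (trans d eq))
      ... | j , eq′ , p , q = j , eq′ , ≤-trans p (≥= (+-suc (suc i) m)) ,
        ≤-trans (≤-trans (n≤1+n _) q) (+-monoʳ-≤ j (n≤1+n m))
      lift (suc m) (suc i) {y} y∈ (s≤s h) eq | z , e , d | z∈ | inj₂ refl
        with lift m i y∈ h (suc-injective (trans d eq))
      ... | j , eq′ , p , q = j , eq′ , ≤-trans p (≤-trans (n≤1+n _) (+-monoʳ-≤ (suc i) (n≤1+n m))) ,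
        ≤-trans (s≤s q) (≥= (+-suc j m))

    periodic* : ∀ k i → c (k * l + i) ≡ c i
    periodic* zero    i = refl
    periodic* (suc k) i = trans (cong c (+-assoc l (k * l) i)) (trans (periodic _) (periodic* k i))

    D-arc≤ : ∀ i d → D (c i) (c (d + i)) ≤ d
    D-arc≤ i zero    = ≤= (D-refl (c i))
    D-arc≤ i (suc d) = ≤-trans (D-tri (c i) (c (d + i)) (c (suc d + i)))
      (≤-trans (+-mono-≤ (D-arc≤ i d) (≤= (D-adj (step (d + i))))) (≤= (+-comm d 1)))

    -- A geodesic of length `m` ends at an index at most `m` away from its start. Other indices of
    -- the same vertex are a full turn off, hence at least l - d, and so at least `d`, away.
    D-arc : ∀ i d → d + d ≤ l → D (c i) (c (d + i)) ≡ d
    D-arc i d short = ≤-antisym (D-arc≤ i d) lower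
      where
      m = D (c i) (c (d + i))
      -- Moved on by `m` full turns, as `lift` needs an index of at least `m`.
      i′ = m * l + i
      far : m ≤ i′
      far = ≤-trans (m≤m*n m l {{>-nonZero (≤-trans (s≤s z≤n) l≥2)}}) (m≤m+n (m * l) i)
      shift : c (d + i′) ≡ c (d + i)
      shift = trans (cong c (trans (sym (+-assoc d (m * l) i)) (trans (cong (_+ i) (+-comm d (m * l))) (+-assoc (m * l) d i))))
                    (periodic* m (d + i))
      below : ∀ i j d l m → l + j ≤ d + i → i ≤ j + m → d + d ≤ l → d ≤ m
      below i j d l m p q r = linear 0 (p ⊕ q ⊕ r) (solve (i ∷ j ∷ d ∷ l ∷ m ∷ []))
      above : ∀ i j d l m → l + (d + i) ≤ j → j ≤ i + m → d ≤ m
      above i j d l m p q = linear l (p ⊕ q) (solve (i ∷ j ∷ d ∷ l ∷ m ∷ []))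
      lower : d ≤ m
      lower with lift m i′ (c∈ (d + i)) far (cong (λ x → D x (c (d + i))) (periodic* m i))
      ... | j , eq , p , q with <-cmp j (d + i′)
      ... | tri≈ _ refl _ = +-cancelʳ-≤ i′ d m (≤-trans p (≤= (+-comm i′ m)))
      ... | tri< lt _ _   = below i′ j d l m (inj (trans eq (sym shift)) lt) q short
      ... | tri> _ _ gt   = above i′ j d l m (inj (trans shift (sym eq)) gt) p

    D-arc′ : ∀ {i j} d → d + i ≡ j → d + d ≤ l → D (c i) (c j) ≡ d
    D-arc′ {i} d refl = D-arc i d

    D-coarc : ∀ {i j} d → l + i ≡ d + j → d + d ≤ l → D (c i) (c j) ≡ d
    D-coarc {i} {j} d eq short = trans (D-sym (c i) (c j))
      (trans (cong (D (c j)) (trans (sym (periodic i)) (cong c eq))) (D-arc j d short))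

    rebase : ∀ {b} → b ∈ B → Σ (Listing B l) λ L′ → Listing.c L′ 0 ≡ b
    rebase b∈ with onto b∈
    ... | k , k<l , refl = record
      { c = λ i → c (k + i) ; l≥2 = l≥2
      ; periodic = λ i → trans (cong c (exchange k l i)) (periodic (k + i))
      ; c∈ = λ i → c∈ (k + i) ; onto = onto′
      ; step = λ i → subst (λ j → Adj G (c (k + i)) (c j)) (sym (+-suc k i)) (step (k + i))
      ; nbr = λ i {y} y∈ e → Sum.map₁ (λ eq → trans eq (cong c (sym (trans (+-suc k (suc i)) (cong suc (+-suc k i))))))
          (nbr (k + i) y∈ (subst (λ j → Adj G (c j) y) (+-suc k i) e))
      ; inj = λ {i} {j} eq lt → +-cancelˡ-≤ k (l + i) j
          (≤-trans (≤= (exchange k l i)) (inj eq (+-monoʳ-< k lt))) } , cong c (+-identityʳ k)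
      where
      exchange : ∀ k l i → k + (l + i) ≡ l + (k + i)
      exchange k l i = solve (k ∷ l ∷ i ∷ [])
      onto′ : ∀ {b} → b ∈ B → ∃[ i ] i < l × c (k + i) ≡ b
      onto′ b∈ with onto b∈
      ... | j , j<l , eq with k ≤? j
      ... | yes h = j ∸ k , ≤-trans (s≤s (m∸n≤m j k)) j<l , trans (cong c (m+[n∸m]≡n h)) eq
      -- This vertex comes before the new origin, so it is read one turn later.
      ... | no h  = (l + j) ∸ k , +-cancelˡ-< k _ _ (≤-trans (s≤s (≤= back′)) (≤-trans (+-monoʳ-< l (≰⇒> h)) (≤= (+-comm l k)))) ,
        trans (cong c back′) (trans (periodic j) eq)
        where
        back′ : k + ((l + j) ∸ k) ≡ l + j
        back′ = m+[n∸m]≡n (≤-trans (<⇒≤ k<l) (m≤m+n l j))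

  module _ {B : Subset n} {l : ℕ} (L : Listing B l) where
    open Listing L

    c-≢ : ∀ {i j} → i < j → j < l + i → c i ≢ c j
    c-≢ lt h eq = <⇒≱ h (inj eq lt)

  c-antipode : ∀ {B h} (L : Listing B (h + h)) → Listing.c L 0 ≢ Listing.c L h
  c-antipode {h = zero}  L with () ← Listing.l≥2 L
  c-antipode {h = suc h} L = c-≢ L (s≤s z≤n) (≤-trans (s≤s (m≤n+m (suc h) h)) (m≤m+n _ 0))

  -- Distances and simple paths on a cycle by index.

  module Position {B : Subset n} (M : MaxClique B) {l : ℕ} (L : Listing B l) where
    open Listing L
    open Arc M L public

    D-cases : ∀ i j → i ≤ j → j ≤ l + i →
              (∃[ d ] d + i ≡ j × D (c i) (c j) ≡ d) ⊎ (∃[ d ] d + j ≡ l + i × D (c i) (c j) ≡ d)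
    D-cases i j h h′ with m≤n⇒∃[o]m+o≡n h | m≤n⇒∃[o]m+o≡n h′
    ... | d , eq | e , eq′ with d + d ≤? l
    ... | yes short = inj₁ (d , trans (+-comm d i) eq , D-arc′ d (trans (+-comm d i) eq) short)
    ... | no long   = inj₂ (e , trans (+-comm e j) eq′ , D-coarc e (trans (sym eq′) (+-comm j e)) (arith i j d e l eq eq′ (≰⇒> long)))
      where
      arith : ∀ i j d e l → i + d ≡ j → j + e ≡ l + i → l < d + d → e + e ≤ l
      arith i j d e l p q r = linear 1 (≤= p ⊕ ≤= p ⊕ ≤= q ⊕ ≤= q ⊕ r) (solve (i ∷ j ∷ d ∷ e ∷ l ∷ []))

    dist-position : ∀ {i d} → i ≤ l → D (c 0) (c i) ≡ d → i ≡ d ⊎ d + i ≡ l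
    dist-position {i} h eq with D-cases 0 i z≤n (≤-trans h (m≤m+n l 0))
    ... | inj₁ (e , p , q) = inj₁ (trans (sym p) (trans (+-identityʳ e) (trans (sym q) eq)))
    ... | inj₂ (e , p , q) = inj₂ (trans (cong (_+ i) (trans (sym eq) q)) (trans p (+-identityʳ l)))

    -- The hypothesis `wide` says that the gap from `j` to `k` is more than half of the cycle. The
    -- indices from `k` to `l + j` then span less than half, so geodesics among them stay there and
    -- miss the first vertex of the gap, read here at index `l + suc j`. The four cases are the ways
    -- round in which its two distances are attained.
    gap-uncovered : ∀ {i₁ i₂ j k} → l + (j + j) < k + k → suc j < k → k ≤ i₁ → i₁ ≤ i₂ → i₂ ≤ l + j →
                    ¬ Btw (c i₁) (c (suc j)) (c i₂)
    gap-uncovered {i₁} {i₂} {j} {k} wide j<k k≤i₁ i₁≤i₂ i₂≤ b =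
      <-irrefl refl (conclude
        (D-cases i₁ (l + suc j) (≤-trans i₁≤i₂ i₂≤′) (+-monoʳ-≤ l (≤-trans (<⇒≤ j<k) k≤i₁)))
        (D-cases i₂ (l + suc j) i₂≤′ (+-monoʳ-≤ l (≤-trans (<⇒≤ j<k) (≤-trans k≤i₁ i₁≤i₂)))))
      where
      i₂≤′ : i₂ ≤ l + suc j
      i₂≤′ = ≤-trans i₂≤ (+-monoʳ-≤ l (n≤1+n j))
      e = proj₁ (m≤n⇒∃[o]m+o≡n i₁≤i₂)
      i₁+e : i₁ + e ≡ i₂
      i₁+e = proj₂ (m≤n⇒∃[o]m+o≡n i₁≤i₂)
      short : e + e < l
      short = arith i₁ i₂ e j k l i₁+e k≤i₁ i₂≤ wide
        where
        arith : ∀ i₁ i₂ e j k l → i₁ + e ≡ i₂ → k ≤ i₁ → i₂ ≤ l + j → l + (j + j) < k + k → e + e < l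
        arith i₁ i₂ e j k l p q r t = linear 0 (≤= p ⊕ ≤= p ⊕ q ⊕ q ⊕ r ⊕ r ⊕ t)
          (solve (i₁ ∷ i₂ ∷ e ∷ j ∷ k ∷ l ∷ []))
      w = c (l + suc j)
      between : ∀ {d₁ d₂} → D (c i₁) w ≡ d₁ → D (c i₂) w ≡ d₂ → d₁ + d₂ ≡ e
      between p q = trans (sym (cong₂ _+_
          (trans (cong (D (c i₁)) (sym (periodic (suc j)))) p)
          (trans (D-sym _ (c i₂)) (trans (cong (D (c i₂)) (sym (periodic (suc j)))) q))))
        (trans b (D-arc′ e (trans (+-comm e i₁) i₁+e) (<⇒≤ short)))
      Reach : ℕ → Set
      Reach i = (∃[ d ] d + i ≡ l + suc j × D (c i) w ≡ d) ⊎ (∃[ d ] d + (l + suc j) ≡ l + i × D (c i) w ≡ d)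
      conclude : Reach i₁ → Reach i₂ → 1 ≤ 0
      conclude (inj₁ (d₁ , p , p′)) (inj₁ (d₂ , q , q′)) =
        arith i₁ i₂ d₁ d₂ e j l i₁+e p q (between p′ q′) i₂≤
        where
        arith : ∀ i₁ i₂ d₁ d₂ e j l → i₁ + e ≡ i₂ → d₁ + i₁ ≡ l + suc j → d₂ + i₂ ≡ l + suc j →
                d₁ + d₂ ≡ e → i₂ ≤ l + j → 1 ≤ 0
        arith i₁ i₂ d₁ d₂ e j l a p q f h = linear 1 (≥= p ⊕ ≥= q ⊕ ≤= f ⊕ ≤= a ⊕ h ⊕ h)
          (solve (i₁ ∷ i₂ ∷ d₁ ∷ d₂ ∷ e ∷ j ∷ l ∷ []))
      conclude (inj₁ (d₁ , p , p′)) (inj₂ (d₂ , q , q′)) =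
        arith i₁ i₂ d₁ d₂ e j l i₁+e p q (between p′ q′) (≤-trans (s≤s z≤n) l≥2)
        where
        arith : ∀ i₁ i₂ d₁ d₂ e j l → i₁ + e ≡ i₂ → d₁ + i₁ ≡ l + suc j → d₂ + (l + suc j) ≡ l + i₂ →
                d₁ + d₂ ≡ e → 1 ≤ l → 1 ≤ 0
        arith i₁ i₂ d₁ d₂ e j l a p q f h = linear 0 (≥= p ⊕ ≥= q ⊕ ≤= f ⊕ ≤= a ⊕ h)
          (solve (i₁ ∷ i₂ ∷ d₁ ∷ d₂ ∷ e ∷ j ∷ l ∷ []))
      conclude (inj₂ (d₁ , p , p′)) (inj₁ (d₂ , q , q′)) =
        arith i₁ i₂ d₁ d₂ e j l i₁+e p q (between p′ q′) short
        where
        arith : ∀ i₁ i₂ d₁ d₂ e j l → i₁ + e ≡ i₂ → d₁ + (l + suc j) ≡ l + i₁ → d₂ + i₂ ≡ l + suc j →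
                d₁ + d₂ ≡ e → e + e < l → 1 ≤ 0
        arith i₁ i₂ d₁ d₂ e j l a p q f h = linear 0 (≥= p ⊕ ≥= q ⊕ ≤= f ⊕ ≥= a ⊕ h)
          (solve (i₁ ∷ i₂ ∷ d₁ ∷ d₂ ∷ e ∷ j ∷ l ∷ []))
      conclude (inj₂ (d₁ , p , p′)) (inj₂ (d₂ , q , q′)) =
        arith i₁ i₂ d₁ d₂ e j l i₁+e p q (between p′ q′) (≤-trans j<k k≤i₁)
        where
        arith : ∀ i₁ i₂ d₁ d₂ e j l → i₁ + e ≡ i₂ → d₁ + (l + suc j) ≡ l + i₁ → d₂ + (l + suc j) ≡ l + i₂ →
                d₁ + d₂ ≡ e → suc j < i₁ → 1 ≤ 0
        arith i₁ i₂ d₁ d₂ e j l a p q f h = linear 1 (≥= p ⊕ ≥= q ⊕ ≤= f ⊕ ≤= a ⊕ h ⊕ h)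
          (solve (i₁ ∷ i₂ ∷ d₁ ∷ d₂ ∷ e ∷ j ∷ l ∷ []))

    -- A path that has once stepped forward along a sequence of forced neighbours can never turn back.
    follows : (e : ℕ → Fin n) (N : ℕ) →
              (∀ i {y} → 2 + i ≤ N → y ∈ B → Adj G (e (suc i)) y → y ≡ e (2 + i) ⊎ y ≡ e i) →
              ∀ i {x z} (P : Walk (G [ B ]) x z) → x ≡ e (suc i) → ¬ e i ∈ˡ vertices P → IsPath P →
              ∀ j → j ≤ ∥ P ∥ → j + suc i ≤ N → at P j ≡ e (j + suc i)
    follows e N forced i P eq avoid u zero h b = eq
    follows e N forced i {x} (_◅_ {j = y} (_ , y∈ , xy) P) refl avoid (fresh AllPairs.∷ u) (suc j) (s≤s h) b
      with forced i (≤-trans (s≤s (m≤n+m (suc i) j)) b) y∈ xy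
    ... | inj₂ refl = contradiction (there (start∈ P)) avoid
    ... | inj₁ eq   = trans
      (follows e N forced (suc i) P eq (λ k → All.lookup fresh k refl) u j h (≤-trans (≤= (+-suc j (suc i))) b))
      (cong e (+-suc j (suc i)))

    private
      predecessor : ∀ {l} → 2 ≤ l → ∃[ k ] suc k ≡ l
      predecessor (s≤s {n = k} _) = k , refl

      -- The listing read backwards is `c (l ∸ i)`. Truncated subtraction restricts this to one
      -- turn, which is why `follows` carries a bound `N`.
      forced-down : ∀ i {y} → 2 + i ≤ l → y ∈ B → Adj G (c (l ∸ suc i)) y → y ≡ c (l ∸ (2 + i)) ⊎ y ≡ c (l ∸ i)
      forced-down i {y} h y∈ e with nbr (l ∸ (2 + i)) y∈ (subst (λ k → Adj G (c k) y) (+-∸-assoc 1 h) e)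
      ... | inj₂ eq = inj₁ eq
      ... | inj₁ eq = inj₂ (trans eq (cong c (sym (trans (+-∸-assoc 1 (≤-trans (n≤1+n _) h)) (cong suc (+-∸-assoc 1 h))))))

    -- The first step fixes the direction and a path never turns back, so only the two arcs from
    -- `c 0` to `c d` remain.
    path-shape : ∀ {d x z} → x ≡ c 0 → z ≡ c d → 0 < d → d < l → (P : Walk (G [ B ]) x z) → IsPath P →
                 (∥ P ∥ ≡ d × (∀ j → j ≤ ∥ P ∥ → at P j ≡ c j)) ⊎
                 (∥ P ∥ + d ≡ l × (∀ j → j ≤ ∥ P ∥ → at P j ≡ c (l ∸ j)))
    path-shape {d} refl z≡ d>0 d<l ε u = contradiction z≡ (c-≢ L d>0 (≤-trans d<l (m≤m+n l 0)))
    path-shape {d} refl refl d>0 d<l P₀@(_◅_ {j = y} (_ , y∈ , e) P) u@(fresh AllPairs.∷ u′)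
      with predecessor l≥2
    ... | k , sk≡l with nbr k y∈ (subst (λ x → Adj G x y) (sym (trans (cong c (trans sk≡l (sym (+-identityʳ l)))) (periodic 0))) e)
    ... | inj₁ eq = inj₁ (length≡ , along)
      where
      y≡ : y ≡ c 1
      y≡ = trans eq (trans (cong (c ∘ suc) sk≡l) (trans (cong c (+-comm 1 l)) (periodic 1)))
      along : ∀ j → j ≤ ∥ P₀ ∥ → at P₀ j ≡ c j
      along zero    h       = refl
      along (suc j) (s≤s h) = trans
        (follows c (j + 1) (λ i _ y∈ e → nbr i y∈ e) 0 P y≡ (λ k → All.lookup fresh k refl) u′ j h ≤-refl)
        (cong c (+-comm j 1))
      short : ∥ P₀ ∥ < l
      short = ≰⇒> λ h → at-injective P₀ u 0 l (≤-trans (s≤s z≤n) l≥2) h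
        (sym (trans (along l h) (trans (cong c (sym (+-identityʳ l))) (periodic 0))))
      length≡ : ∥ P₀ ∥ ≡ d
      length≡ with <-cmp ∥ P₀ ∥ d | trans (sym (along ∥ P₀ ∥ ≤-refl)) (at-end P₀)
      ... | tri≈ _ p _ | _  = p
      ... | tri< p _ _ | eq = contradiction eq (c-≢ L p (≤-trans d<l (m≤m+n l _)))
      ... | tri> _ _ p | eq = contradiction (sym eq) (c-≢ L p (≤-trans short (m≤m+n l _)))
    ... | inj₂ eq = inj₂ (length≡ , along)
      where
      y≡ : y ≡ c (l ∸ 1)
      y≡ = trans eq (cong (λ m → c (m ∸ 1)) sk≡l)
      cl≡c0 : c l ≡ c 0
      cl≡c0 = trans (cong c (sym (+-identityʳ l))) (periodic 0)
      along′ : ∀ j → j ≤ ∥ P₀ ∥ → j ≤ l → at P₀ j ≡ c (l ∸ j)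
      along′ zero    h       _  = sym cl≡c0
      along′ (suc j) (s≤s h) jl = trans
        (follows (λ i → c (l ∸ i)) l (λ i → forced-down i) 0 P y≡
          (λ k → All.lookup fresh (subst (_∈ˡ vertices P) cl≡c0 k) refl) u′ j h (≤-trans (≤= (+-comm j 1)) jl))
        (cong (λ i → c (l ∸ i)) (+-comm j 1))
      short : ∥ P₀ ∥ < l
      short = ≰⇒> λ h → at-injective P₀ u 0 l (≤-trans (s≤s z≤n) l≥2) h
        (sym (trans (along′ l h ≤-refl) (cong c (n∸n≡0 l))))
      along : ∀ j → j ≤ ∥ P₀ ∥ → at P₀ j ≡ c (l ∸ j)
      along j h = along′ j h (≤-trans h (<⇒≤ short))
      last : c (l ∸ ∥ P₀ ∥) ≡ c d
      last = trans (sym (along ∥ P₀ ∥ ≤-refl)) (at-end P₀)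
      length≡ : ∥ P₀ ∥ + d ≡ l
      length≡ with <-cmp (l ∸ ∥ P₀ ∥) d
      ... | tri≈ _ p _ = trans (cong (∥ P₀ ∥ +_) (sym p)) (m+[n∸m]≡n (<⇒≤ short))
      ... | tri< p _ _ = contradiction last (c-≢ L p (≤-trans d<l (m≤m+n l _)))
      ... | tri> _ _ p = contradiction (sym last) (c-≢ L p (≤-trans (s≤s (m∸n≤m l (suc ∥ P ∥)))
          (≤-trans (≤= (+-comm 1 l)) (+-monoʳ-≤ l d>0))))

    walk-along : (e : ℕ → Fin n) (N : ℕ) → (∀ i → i < N → Adj (G [ B ]) (e i) (e (suc i))) →
                 (∀ i j → i < j → j ≤ N → e i ≢ e j) → ∀ k i → k + i ≡ N →
                 Σ (Walk (G [ B ]) (e i) (e N)) λ P →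
                   ∥ P ∥ ≡ k × IsPath P × (∀ {z} → z ∈ˡ vertices P → ∃[ j ] i ≤ j × j ≤ N × z ≡ e j)
    walk-along e N step≤ e-≢ zero    i refl = ε , refl , All.[] AllPairs.∷ AllPairs.[] , λ { (here refl) → i , ≤-refl , ≤-refl , refl }
    walk-along e N step≤ e-≢ (suc k) i eq with walk-along e N step≤ e-≢ k (suc i) (trans (+-suc k i) eq)
    ... | P , len , u , on = step≤ i i<N ◅ P , cong suc len , All.tabulate fresh AllPairs.∷ u , on′
      where
      i<N : i < N
      i<N = ≤-trans (s≤s (m≤n+m i k)) (≤= eq)
      fresh : ∀ {z} → z ∈ˡ vertices P → e i ≢ z
      fresh z∈ eq with on z∈
      ... | j , lt , h , refl = e-≢ i j lt h eq
      on′ : ∀ {z} → z ∈ˡ (e i ∷ vertices P) → ∃[ j ] i ≤ j × j ≤ N × z ≡ e j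
      on′ (here refl) = i , ≤-refl , <⇒≤ i<N , refl
      on′ (there z∈) with on z∈
      ... | j , p , q , r = j , <⇒≤ p , q , r

    forward-path : ∀ {d} → d < l → Σ (Walk (G [ B ]) (c 0) (c d)) λ P → ∥ P ∥ ≡ d × IsPath P
    forward-path {d} d<l with walk-along c d (λ i _ → c∈ i , c∈ (suc i) , step i)
      (λ i j p q → c-≢ L p (≤-trans (s≤s q) (≤-trans d<l (m≤m+n l i)))) d 0 (+-identityʳ d)
    ... | P , len , u , _ = P , len , u

    backward-path : ∀ {d} → 0 < d → d ≤ l → Σ (Walk (G [ B ]) (c 0) (c d)) λ P → ∥ P ∥ + d ≡ l × IsPath P
    backward-path {d} d>0 d≤l with walk-along (λ i → c (l ∸ i)) (l ∸ d)
      (λ i h → c∈ _ , c∈ _ , Graph.sym G (subst (λ k → Adj G (c (l ∸ suc i)) (c k))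
        (sym (+-∸-assoc 1 (≤-trans h (m∸n≤m l d)))) (step (l ∸ suc i))))
      (λ i j p q eq → c-≢ L (∸-monoʳ-< p (≤-trans q (m∸n≤m l d)))
        (≤-trans (s≤s (m∸n≤m l i)) (≤-trans (≤= (+-comm 1 l)) (+-monoʳ-≤ l (m<n⇒0<n∸m (≤-trans (s≤s q)
          (∸-monoʳ-< d>0 d≤l)))))) (sym eq))
      (l ∸ d) 0 (+-identityʳ _)
    ... | P , len , u , _ = subst₂ (λ x y → Σ (Walk (G [ B ]) x y) λ P → ∥ P ∥ + d ≡ l × IsPath P)
      (trans (cong c (sym (+-identityʳ l))) (periodic 0)) (cong c (m∸[m∸n]≡n d≤l))
      (P , trans (cong (_+ d) len) (m∸n+n≡m d≤l) , u)

  -- Every block has three anchors on short arcs or two antipodal anchors.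

  -- In either case x turns out to be the gate, in its block, of some vertex of the constructed set.
  Anchor : Subset n → Fin n → Set
  Anchor X x = Cut x ⊎ x ∈ X

  -- All that the upper bound needs to know about the rules of steps 2 and 3. In `antipodal` the
  -- case `h ≡ 1` is an edge; there any third vertex of `S` can complete the triangle.
  data Shape (B X : Subset n) : Set where
    antipodal : ∀ {h} (L : Listing B (h + h)) → h ≡ 1 ⊎ IsCycle G B (h + h) →
                Anchor X (Listing.c L 0) → Anchor X (Listing.c L h) → Shape B X
    triple    : ∀ {l α β γ} (L : Listing B l) → α + β + γ ≡ l →
                α + α ≤ l → β + β ≤ l → γ + γ ≤ l → 0 < α → 0 < β → 0 < γ →
                Anchor X (Listing.c L 0) → Anchor X (Listing.c L α) → Anchor X (Listing.c L (α + β)) →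
                Shape B X

  module _ {B : Subset n} (M : MaxClique B) where

    edge-shape : ∀ {X a b} → IsEdge G B → a ∈ B → b ∈ B → b ≢ a → Anchor X a → Anchor X b → Shape B X
    edge-shape e a∈ b∈ b≢a A A′ with Arc.rebase M (edge-listing e) a∈
    ... | L , refl with Listing.onto L b∈
    ... | zero        , _ , refl = contradiction refl b≢a
    ... | suc zero    , _ , refl = antipodal {h = 1} L (inj₁ refl) A A′
    ... | suc (suc _) , s≤s (s≤s ()) , _

    even-shape : ∀ {X l a b} → IsCycle G B l → 2 ∣ l → a ∈ B → b ∈ B → D a b ≡ l / 2 →
                 Anchor X a → Anchor X b → Shape B X
    even-shape {X} {a = a} {b} C (divides q refl) a∈ b∈ d A A′ = go (subst (IsCycle G B) (q*2≡q+q q) C)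
      where
      go : IsCycle G B (q + q) → Shape B X
      go C with Arc.rebase M (cycle-listing C) a∈
      ... | L , refl with Listing.onto L b∈
      ... | i , i<l , refl with Position.dist-position M L (<⇒≤ i<l) (trans d (m*n/n≡m q 2))
      ... | inj₁ refl = antipodal {h = q} L (inj₂ C) A A′
      ... | inj₂ eq with +-cancelˡ-≡ q i q eq
      ... | refl = antipodal {h = q} L (inj₂ C) A A′

    odd-positions : ∀ {l a u v} → IsCycle G B l → ¬ 2 ∣ l → a ∈ B → u ∈ B → v ∈ B → u ≢ v →
      D a u ≡ l / 2 → D a v ≡ l / 2 → ∃[ h ] l ≡ suc (h + h) × Σ (Listing B l) λ L → Listing.c L 0 ≡ a ×
      ((u ≡ Listing.c L h × v ≡ Listing.c L (suc h)) ⊎ (v ≡ Listing.c L h × u ≡ Listing.c L (suc h)))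
    odd-positions {l} {a} {u} {v} C ¬2∣l a∈ u∈ v∈ u≢v du dv with Arc.rebase M (cycle-listing C) a∈
    ... | L , refl = h , odd-half l ¬2∣l , L , refl , choose (locate u∈ du) (locate v∈ dv)
      where
      open Listing L
      h = l / 2
      locate : ∀ {x} → x ∈ B → D (c 0) x ≡ h → x ≡ c h ⊎ x ≡ c (suc h)
      locate x∈ d with onto x∈
      ... | i , i<l , refl with Position.dist-position M L (<⇒≤ i<l) d
      ... | inj₁ eq = inj₁ (cong c eq)
      ... | inj₂ eq = inj₂ (cong c (+-cancelˡ-≡ h i (suc h) (trans eq (trans (odd-half l ¬2∣l) (sym (+-suc h h))))))
      choose : u ≡ c h ⊎ u ≡ c (suc h) → v ≡ c h ⊎ v ≡ c (suc h) →
               (u ≡ c h × v ≡ c (suc h)) ⊎ (v ≡ c h × u ≡ c (suc h))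
      choose (inj₁ p) (inj₁ q) = contradiction (trans p (sym q)) u≢v
      choose (inj₁ p) (inj₂ q) = inj₁ (p , q)
      choose (inj₂ p) (inj₁ q) = inj₂ (q , p)
      choose (inj₂ p) (inj₂ q) = contradiction (trans p (sym q)) u≢v

    -- With l = 2h + 1 the two vertices opposite the cut vertex are adjacent, and the arcs have
    -- lengths h, 1 and h.
    odd-shape : ∀ {X l a u v} → IsCycle G B l → ¬ 2 ∣ l → a ∈ B → u ∈ B → v ∈ B → u ≢ v →
                D a u ≡ l / 2 → D a v ≡ l / 2 → Anchor X a → Anchor X u → Anchor X v → Shape B X
    odd-shape {X} C ¬2∣l a∈ u∈ v∈ u≢v du dv A U V with odd-positions C ¬2∣l a∈ u∈ v∈ u≢v du dv
    ... | h , refl , L , refl , swapped = triple {α = h} {β = 1} {γ = h} L (arith h) (n≤1+n _) l≥2 (n≤1+n _)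
          (positive l≥2) ≤-refl (positive l≥2) A (proj₁ (ends swapped))
          (subst (Anchor X ∘ c) (+-comm 1 h) (proj₂ (ends swapped)))
      where
      open Listing L
      arith : ∀ h → h + 1 + h ≡ suc (h + h)
      arith h = solve (h ∷ [])
      positive : ∀ {h} → 2 ≤ suc (h + h) → 0 < h
      positive {suc h} _ = s≤s z≤n
      positive {zero} (s≤s ())
      ends : (_ ≡ c h × _ ≡ c (suc h)) ⊎ (_ ≡ c h × _ ≡ c (suc h)) → Anchor X (c h) × Anchor X (c (suc h))
      ends (inj₁ (refl , refl)) = U , V
      ends (inj₂ (refl , refl)) = V , U

    no-half-turn : ∀ {l d} (L : Listing B l) → let open Listing L in
                   ¬ HasAntipodalCuts G B l → Cut (c 0) → Cut (c d) → d + d ≢ l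
    no-half-turn {l} {d} L ¬anti c₀ c₁ eq =
      ¬anti (divides d l≡ , c 0 , c d , (c∈ 0 , c₀) , (c∈ d , c₁) ,
        D⇒Dist (trans (Arc.D-arc′ M L d (+-identityʳ d) (≤= eq)) (sym (trans (cong (_/ 2) l≡) (m*n/n≡m d 2)))))
      where
      open Listing L
      l≡ : l ≡ d * 2
      l≡ = trans (sym eq) (sym (q*2≡q+q d))

    -- A gap longer than half of the cycle between consecutive cut vertices cannot be covered.
    gap-shape : ∀ {X l} (L : Listing B l) → let open Listing L in
      ¬ HasAntipodalCuts G B l → CoveredByCuts G B → ∀ {j k} → Cut (c 0) → Cut (c j) → Cut (c k) →
      j + j ≤ l → j < k → k ≤ l → l < k + k → (∀ i → j < i → i < k → ¬ Cut (c i)) → Shape B X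
    gap-shape {X} {l} L ¬anti cov {j} {k} ca cj ck 2j≤l j<k k≤l l<2k gap = finish
      where
      open Listing L
      open Position M L

      -- Cut vertices with index at most `j` are read one turn later, so that all of them have
      -- indices from `k` to `l + j`.
      Window : Fin n → Set
      Window x = ∃[ i ] c i ≡ x × k ≤ i × i ≤ l + j

      window : ∀ {x} → x ∈ B → Cut x → Window x
      window x∈ cx with onto x∈
      ... | i , i<l , refl with i ≤? j | k ≤? i
      ... | yes h | _     = l + i , periodic i , ≤-trans k≤l (m≤m+n l i) , +-monoʳ-≤ l h
      ... | no _  | yes h = i , refl , h , ≤-trans (<⇒≤ i<l) (m≤m+n l j)
      ... | no p  | no q  = contradiction cx (gap i (≰⇒> p) (≰⇒> q))

      -- Otherwise the gap exceeds half of the cycle, and no geodesic between cut vertices contains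
      -- its first vertex.
      narrow : k + k ≤ l + (j + j)
      narrow = ≮⇒≥ λ wide → refute wide (cov (c (suc j)) (c∈ (suc j)))
        where
        far : l + (j + j) < k + k → suc j < k
        far wide = ≤∧≢⇒< j<k λ eq →
          <⇒≱ wide (≤-trans (≤= (trans (cong₂ _+_ (sym eq) (sym eq)) (arith j))) (+-monoˡ-≤ (j + j) l≥2))
          where
          arith : ∀ j → suc j + suc j ≡ 2 + (j + j)
          arith j = solve (j ∷ [])
        refute : l + (j + j) < k + k → ¬ (∃[ p ] ∃[ q ] CutIn G B p × CutIn G B q × Σ (ShortestPath (G [ B ]) p q) (LiesOn (c (suc j))))
        refute wide (p , q , (p∈ , cp) , (q∈ , cq) , on) with window p∈ cp | window q∈ cq | innerOn⇒btw M p∈ q∈ on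
        ... | i₁ , refl , k≤i₁ , i₁≤ | i₂ , refl , k≤i₂ , i₂≤ | b with ≤-total i₁ i₂
        ... | inj₁ h = gap-uncovered wide (far wide) k≤i₁ h i₂≤ b
        ... | inj₂ h = gap-uncovered wide (far wide) k≤i₂ h i₁≤ (btw-sym b)

      0<j : 0 < j
      0<j = n≢0⇒n>0 λ eq → <⇒≱ l<2k (≤-trans narrow (≤= (trans (cong (λ j → l + (j + j)) eq) (+-identityʳ l))))
      -- For k = l the bound `narrow` would give j + j = l, an antipodal pair of cut vertices.
      k<l : k < l
      k<l = ≤∧≢⇒< k≤l λ k≡l → no-half-turn L ¬anti ca cj (sym (2j≡l k≡l))
        where
        arith : ∀ j l → l + l ≤ l + (j + j) → l ≤ j + j
        arith j l h = +-cancelˡ-≤ l l (j + j) h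
        2j≡l : k ≡ l → l ≡ j + j
        2j≡l eq = ≤-antisym (arith j l (subst (λ k → k + k ≤ l + (j + j)) eq narrow)) 2j≤l
      g = proj₁ (m≤n⇒∃[o]m+o≡n (<⇒≤ j<k))
      j+g≡k : j + g ≡ k
      j+g≡k = proj₂ (m≤n⇒∃[o]m+o≡n (<⇒≤ j<k))
      f = proj₁ (m≤n⇒∃[o]m+o≡n k≤l)
      k+f≡l : k + f ≡ l
      k+f≡l = proj₂ (m≤n⇒∃[o]m+o≡n k≤l)
      g-short : ∀ {j g k l} → j + g ≡ k → k + k ≤ l + (j + j) → g + g ≤ l
      g-short {j} {g} {k} {l} refl h = linear 0 h (solve (j ∷ g ∷ l ∷ []))
      f-short : ∀ {f k l} → k + f ≡ l → l < k + k → f + f ≤ l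
      f-short {f} {k} refl h = linear 1 h (solve (f ∷ k ∷ []))
      g-pos : ∀ {j g k} → j + g ≡ k → j < k → 0 < g
      g-pos {j} {zero}  eq h = contradiction (trans (sym (+-identityʳ j)) eq) (<⇒≢ h)
      g-pos {j} {suc g} eq h = s≤s z≤n
      finish : Shape B X
      finish = triple {α = j} {β = g} {γ = f} L (trans (cong (_+ f) j+g≡k) k+f≡l)
        2j≤l (g-short {j} {g} {k} j+g≡k narrow) (f-short {f} {k} k+f≡l l<2k) 0<j (g-pos j+g≡k j<k) (g-pos k+f≡l k<l)
        (inj₁ ca) (inj₁ cj) (inj₁ (subst (Cut ∘ c) (sym j+g≡k) ck))

    -- Let `c j` be the last cut vertex in the first half and `c k` the next one, which exists
    -- because `c l` is `c 0` again. The arcs from 0 to `j` and from `k` to `l` are then short, and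
    -- only the middle one depends on the covering hypothesis.
    covered-shape : ∀ {X l a} → IsCycle G B l → a ∈ B → Cut a → ¬ HasAntipodalCuts G B l → CoveredByCuts G B → Shape B X
    covered-shape {X} {l} C a∈ ca ¬anti cov with Arc.rebase M (cycle-listing C) a∈
    ... | L , refl
      with last-below {A = λ i → Cut (Listing.c L i) × i + i ≤ l} (λ i → cut? _ ×-dec (i + i ≤? l)) (ca , z≤n) l
    ... | j , (cj , 2j≤l) , last with m≤n⇒∃[o]m+o≡n (half< 2j≤l)
      where
      half< : ∀ {j} → j + j ≤ l → j < l
      half< {zero}  _ = ≤-trans (s≤s z≤n) (Listing.l≥2 L)
      half< {suc j} h = ≤-trans (s≤s (≤-trans (m≤n+m (suc j) j) ≤-refl)) h
    ... | o , j+o≡l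
      with first-above {A = Cut ∘ Listing.c L} (cut? ∘ Listing.c L) o j
             (subst (Cut ∘ Listing.c L) (trans (sym j+o≡l) (cong suc (+-comm j o))) c-l)
      where
      c-l : Cut (Listing.c L l)
      c-l = subst Cut (sym (trans (cong (Listing.c L) (sym (+-identityʳ l))) (Listing.periodic L 0))) ca
    ... | k , j<k , k≤ , ck , gap = gap-shape L ¬anti cov ca cj ck 2j≤l j<k k≤l (≰⇒> λ h → last k j<k k≤l (ck , h)) gap
      where
      k≤l : k ≤ l
      k≤l = ≤-trans k≤ (≤= (trans (cong suc (+-comm o j)) j+o≡l))

  cycle≥3 : ∀ {B l} → IsCycle G B l → 3 ≤ l
  cycle≥3 (C , _ , _ , refl) = s≤s (Cycle.long C)

  middle-at : ∀ {H : Graph n} {x z w a} (P : Walk H x z) → (2 + ∥ P ∥) / 2 ≡ suc a → IsMiddle G P w → at P a ≡ w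
  middle-at {a = a} P eq (i , p , q) = trans (cong (at P) (suc-injective (trans (sym eq)
      (trans (cong (λ k → (1 + k) / 2) (sym (length-vertices P))) (sym p)))))
    (trans (sym (lookup-at P i)) q)

  at-middle : ∀ {H : Graph n} {x z a} (P : Walk H x z) → (2 + ∥ P ∥) / 2 ≡ suc a → a ≤ ∥ P ∥ → IsMiddle G P (at P a)
  at-middle {a = a} P eq h = i , trans (cong suc i≡a) (trans (sym eq) (cong (λ k → (1 + k) / 2) (sym (length-vertices P)))) ,
    trans (lookup-at P i) (cong (at P) i≡a)
    where
    lt : a < length (vertices P)
    lt = ≤-trans (s≤s h) (≥= (length-vertices P))
    i = fromℕ< lt
    i≡a : toℕ i ≡ a
    i≡a = Finₚ.toℕ-fromℕ< lt

  module _ {B : Subset n} (M : MaxClique B) where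

    -- The longest path is the longer arc, strictly more than half of the cycle as no two cut
    -- vertices are antipodal. Its middle vertex splits it evenly up to one edge, and the opposite
    -- arc is short. The two branches are the two directions in which it may leave `c 0`.
    uncovered-shape : ∀ {X l x₁ xₖ w} → IsCycle G B l → ¬ HasAntipodalCuts G B l → CutIn G B x₁ → CutIn G B xₖ → x₁ ≢ xₖ →
      (P : Walk (G [ B ]) x₁ xₖ) → IsLongestPath P → IsMiddle G P w → w ∈ X → Shape B X
    uncovered-shape {X} {l} {w = w} C ¬anti (x∈ , cx) (y∈ , cy) x≢y P (path , longest) mid w∈X
      with Arc.rebase M (cycle-listing C) x∈
    ... | L , refl with Listing.onto L y∈
    ... | zero , _ , refl = contradiction refl x≢y
    ... | d@(suc d-1) , d<l , refl
      with halves ∥ P ∥ | Position.path-shape M L refl refl (s≤s z≤n) d<l P path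
    ... | a , b , a+b , a≤b , b≤a , half | inj₁ (len , along) =
        triple {α = a} {β = b} {γ = γ} L (trans (cong (_+ γ) a+b≡d) d+γ)
          (≤-trans (+-monoʳ-≤ a a≤b) (≤-trans (≤= a+b≡d) (<⇒≤ d<l)))
          (≤-trans (+-monoˡ-≤ b b≤a) (≤-trans (s≤s (≤= a+b≡d)) d<l))
          (arith d γ l d+γ l<2d) a>0 (≤-trans a>0 a≤b)
          (n≢0⇒n>0 λ γ≡0 → <⇒≢ d<l (trans (sym (+-identityʳ d)) (trans (cong (d +_) (sym γ≡0)) d+γ)))
          (inj₁ cx) (inj₂ (subst (_∈ X) w≡ w∈X)) (inj₁ (subst (Cut ∘ c) (sym a+b≡d) cy))
      where
      open Listing L
      open Position M L
      γ = proj₁ (m≤n⇒∃[o]m+o≡n (<⇒≤ d<l))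
      d+γ : d + γ ≡ l
      d+γ = proj₂ (m≤n⇒∃[o]m+o≡n (<⇒≤ d<l))
      a+b≡d : a + b ≡ d
      a+b≡d = trans a+b len
      arith : ∀ d γ l → d + γ ≡ l → l < d + d → γ + γ ≤ l
      arith d γ l p h = linear 1 (≤= p ⊕ ≤= p ⊕ h) (solve (d ∷ γ ∷ l ∷ []))
      2d≢l = no-half-turn M {d = d} L ¬anti cx cy
      l<2d : l < d + d
      l<2d with backward-path {d} (s≤s z≤n) (<⇒≤ d<l)
      ... | Q , lenQ , pathQ = ≤∧≢⇒< (≤-trans (≥= lenQ) (+-monoˡ-≤ d (≤-trans (longest Q pathQ) (≤= len)))) (≢-sym 2d≢l)
      -- For a = 0 the path would have at most one edge, which is not more than half of a cycle of
      -- length at least 3.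
      a>0 : 0 < a
      a>0 = n≢0⇒n>0 λ { refl → <⇒≱ (≤-trans (s≤s (cycle≥3 C)) l<2d)
        (≤-trans (+-mono-≤ (≤-trans (≥= a+b≡d) b≤a) (≤-trans (≥= a+b≡d) b≤a)) (s≤s (s≤s z≤n))) }
      w≡ : w ≡ c a
      w≡ = trans (sym (middle-at {H = G [ B ]} P half mid)) (along a (≤-trans (m≤m+n a b) (≤= a+b)))
    ... | a , b , a+b , a≤b , b≤a , half | inj₂ (len , along) =
        triple {α = d} {β = b} {γ = a} L total (<⇒≤ 2d<l)
          (≤-trans (+-monoˡ-≤ b b≤a) (≤-trans (s≤s (≤= a+b))
            (≤-trans (≤= (+-comm 1 ∥ P ∥)) (≤-trans (+-monoʳ-≤ ∥ P ∥ (s≤s z≤n)) (≤= len)))))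
          (≤-trans (+-monoʳ-≤ a a≤b) (≤-trans (≤= a+b) (≤-trans (m≤m+n ∥ P ∥ d) (≤= len))))
          (s≤s z≤n) (≤-trans a>0 a≤b) a>0
          (inj₁ cx) (inj₁ cy) (inj₂ (subst (_∈ X) w≡ w∈X))
      where
      open Listing L
      open Position M L
      total : d + b + a ≡ l
      total = trans (+-assoc d b a) (trans (+-comm d (b + a)) (trans (cong (_+ d) (trans (+-comm b a) a+b)) len))
      2d≢l = no-half-turn M {d = d} L ¬anti cx cy
      2d<l : d + d < l
      2d<l with forward-path {d} d<l
      ... | Q , lenQ , pathQ = ≤∧≢⇒< (≤-trans (+-monoˡ-≤ d (≤-trans (≥= lenQ) (longest Q pathQ))) (≤= len)) 2d≢l
      a>0 : 0 < a
      a>0 = n≢0⇒n>0 λ { refl → <⇒≱ 2d<l (≤-trans (≥= total)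
              (≤-trans (≤= (+-identityʳ _)) (+-monoʳ-≤ d (≤-trans b≤a (s≤s z≤n))))) }
      w≡ : w ≡ c (d + b)
      w≡ = trans (sym (middle-at {H = G [ B ]} P half mid)) (trans (along a (≤-trans (m≤m+n a b) (≤= a+b)))
        (cong c (trans (cong (_∸ a) (sym total)) (m+n∸n≡m (d + b) a))))

    -- All walks leaving `v` start at its only neighbour, through which the remaining vertices stay
    -- connected.
    pendant-noncut : ∀ {v} → ∃! _≡_ (Adj G v) → ¬ Cut v
    pendant-noncut {v} (u , _ , unique) cv with cut⇒separates cv
    ... | x , y , x≢ , y≢ , sep with toward (≢-sym x≢) | toward (≢-sym y≢)
    ... | z , e , k | z′ , e′ , k′ with unique e | unique e′
    ... | refl | refl = sep (conn-sym k ◅◅ k′)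

    step2-shape : ∀ {X a} → a ∈ B → Cut a → Step2 G B X → Shape B X
    step2-shape a∈ ca (edge {v} e v∈ deg) =
      edge-shape M e a∈ v∈ (λ { refl → pendant-noncut deg ca }) (inj₁ ca) (inj₂ (x∈⁅x⁆ v))
    step2-shape _ _ (even {v = v} C 2∣l (a∈ , ca) v∈ dist) =
      even-shape M C 2∣l a∈ v∈ (Dist⇒D dist) (inj₁ ca) (inj₂ (x∈⁅x⁆ v))
    step2-shape _ _ (odd {u = u} {v} C ¬2∣l (a∈ , ca) u∈ v∈ u≢v du dv) =
      odd-shape M C ¬2∣l a∈ u∈ v∈ u≢v (Dist⇒D du) (Dist⇒D dv) (inj₁ ca)
        (inj₂ (p⊆p∪q ⁅ v ⁆ (x∈⁅x⁆ u))) (inj₂ (q⊆p∪q ⁅ u ⁆ ⁅ v ⁆ (x∈⁅x⁆ v)))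

    step3-shape : ∀ {X a b} → CutIn G B a → CutIn G B b → b ≢ a → Step3 G B X → Shape B X
    step3-shape (a∈ , ca) (b∈ , cb) b≢a (edge e) = edge-shape M e a∈ b∈ b≢a (inj₁ ca) (inj₁ cb)
    step3-shape _ _ _ (antipodal C (2∣l , _ , _ , (a∈ , ca) , (b∈ , cb) , dist)) =
      even-shape M C 2∣l a∈ b∈ (Dist⇒D dist) (inj₁ ca) (inj₁ cb)
    step3-shape (a∈ , ca) _ _ (covered C ¬anti cov) = covered-shape M C a∈ ca ¬anti cov
    step3-shape _ _ _ (uncovered {xⱼ = w} C ¬anti _ x y x≢y _ P longest mid) =
      uncovered-shape C ¬anti x y x≢y P longest mid (x∈⁅x⁆ w)

-- Elements of the set after the loops, found on each side of a block.

module Procedure {n} (G : Graph n) (cactus : Cactus G) (x₀ y₀ : Fin n) (x₀≢y₀ : x₀ ≢ y₀)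
                 (a₀ : Fin n) (a₀-cut : IsCutVertex G a₀) where
  open CactusBlocks G cactus x₀ y₀ x₀≢y₀

  block-cut : ∀ {B} → MaxClique B → ∃[ a ] CutIn G B a
  block-cut {B} M with a₀ ∈? B
  ... | yes a∈ = a₀ , a∈ , a₀-cut
  ... | no a∉  = r M a₀ , r∈ M a₀ , gate-cut M (λ eq → a∉ (subst (_∈ B) (sym eq) (r∈ M a₀)))

  -- As the graph has a cut vertex, every block contains one; the block is a leaf exactly when it
  -- has no second.
  leaf-or-internal : ∀ {B} → MaxClique B → ∃[ a ] CutIn G B a ×
    ((Leaf G (block B) × (∀ {c} → CutIn G B c → c ≡ a)) ⊎ (Internal G (block B) × ∃[ b ] CutIn G B b × b ≢ a))
  leaf-or-internal {B} M with block-cut M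
  ... | a , a∈ , ca with Finₚ.any? (λ b → ((b ∈? B) ×-dec cut? b) ×-dec ¬? (b Finₚ.≟ a))
  ... | yes (b , (b∈ , cb) , b≢a) = a , (a∈ , ca) , inj₂ ((bl , not-leaf) , b , (b∈ , cb) , b≢a)
    where
    bl = maxClique⇒block M
    not-leaf : ¬ Leaf G (block B)
    not-leaf (_ , y , _ , unique) with unique (block—cut bl ca a∈) | unique (block—cut bl cb b∈)
    ... | refl | refl = b≢a refl
  ... | no none = a , (a∈ , ca) , inj₁ ((bl , cut a , block—cut bl ca a∈ , unique) , only)
    where
    bl = maxClique⇒block M
    only : ∀ {c} → CutIn G B c → c ≡ a
    only {c} k = decidable-stable (c Finₚ.≟ a) λ ne → none (c , k , ne)
    unique : ∀ {y} → TreeEdge G (block B) y → cut a ≡ y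
    unique (block—cut _ cc c∈) = cong cut (sym (only (c∈ , cc)))

  -- This gives `away` an exit from the block other than the vertex by which it entered.
  two-anchors : ∀ {B X} → Shape B X → ∀ a → ∃[ p ] p ∈ B × p ≢ a × Anchor X p
  two-anchors (antipodal {h} L _ A A′) a with Listing.c L 0 Finₚ.≟ a
  ... | no ne    = _ , Listing.c∈ L 0 , ne , A
  ... | yes refl = _ , Listing.c∈ L h , ≢-sym (c-antipode {h = h} L) , A′
  two-anchors (triple {l} {α} {β} {γ} L eq _ _ _ α>0 β>0 _ A A′ _) a with Listing.c L 0 Finₚ.≟ a
  ... | no ne    = _ , Listing.c∈ L 0 , ne , A
  ... | yes refl = _ , Listing.c∈ L α , ≢-sym (c-≢ L α>0 α<) , A′
    where
    α< : α < l + 0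
    α< = ≤-trans (≤-trans (≤= (+-comm 1 α)) (+-monoʳ-≤ α β>0))
           (≤-trans (m≤m+n (α + β) γ) (≤-trans (≤= eq) (≥= (+-identityʳ l))))

  module Run {S₃ : Subset n} (run : AfterLoops G S₃) where
    open AfterLoops run public

    added⊆ : ∀ {B x} → MaxClique B → x ∈ added B → x ∈ S₃
    added⊆ {B} {x} M x∈ = Equivalence.from (union x) (B , maxClique⇒block M , x∈)

    shape : ∀ {B} → MaxClique B → Shape B (added B)
    shape {B} M with leaf-or-internal M
    ... | a , (a∈ , ca) , inj₁ (lf , _)              = step2-shape M a∈ ca (leaf B lf)
    ... | a , cin , inj₂ (int , b , cin′ , b≢a) = step3-shape M cin cin′ b≢a (internal B int)

    private
      -- Walking away from b₀ through cut vertices must end in a block contributing to S₃.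
      away : ∀ k m b₀ → (∀ x → D b₀ x < m) → ∀ {B a} (M : MaxClique B) → a ∈ B → r M b₀ ≡ a →
             m ≤ D b₀ a + k → ∃[ s ] s ∈ S₃ × r M s ≢ a
      away zero m b₀ bound {a = a} M a∈ eq h = contradiction (≤-trans h (≤= (+-identityʳ _))) (<⇒≱ (bound a))
      away (suc k) m b₀ bound {a = a} M a∈ eq h with two-anchors (shape M) a
      ... | p , p∈ , p≢a , inj₂ p∈X = p , added⊆ M p∈X , λ eq′ → p≢a (trans (sym (r-id M p∈)) eq′)
      ... | p , p∈ , p≢a , inj₁ cp with another-block M p∈ cp
      ... | B′ , M′ , p∈′ , B≢
        with away k m b₀ bound M′ p∈′ (other-side M M′ B≢ p∈ p∈′ (λ eq′ → p≢a (trans (sym eq′) eq))) farther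
        where
        arith : ∀ m a p d k → m ≤ a + suc k → a + d ≡ p → 1 ≤ d → m ≤ p + k
        arith m a p d k h e h′ = linear 0 (h ⊕ ≤= e ⊕ h′) (solve (m ∷ a ∷ p ∷ d ∷ k ∷ []))
        -- As `a` is the gate of `b₀`, it lies between `b₀` and `p`. Moving on to `p` thus increases
        -- the distance from `b₀` and pays for the fuel.
        farther : m ≤ D b₀ p + k
        farther = arith m (D b₀ a) (D b₀ p) (D a p) k h (subst (λ g → Btw b₀ g p) eq (r-btw M p∈)) (D-pos (≢-sym p≢a))
      ... | s , s∈ , ne = s , s∈ , λ eq′ → p≢a (trans (sym (other-side M′ M (≢-sym B≢) p∈′ p∈ ne)) eq′)

    avoiding : ∀ {B} (M : MaxClique B) {a} → a ∈ B → ∃[ s ] s ∈ S₃ × r M s ≢ a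
    avoiding M {a} a∈ with bounded (D a)
    ... | m , bound = away m m a bound M a∈ (r-id M a∈) (m≤n+m m _)

    -- In another block at `a`, an element of `S₃` whose gate is not `a` exists; seen from `B` it
    -- lies behind `a`.
    beyond : ∀ {B} (M : MaxClique B) {a} → a ∈ B → Cut a → ∃[ s ] s ∈ S₃ × r M s ≡ a
    beyond M a∈ ca with another-block M a∈ ca
    ... | B′ , M′ , a∈′ , B≢ with avoiding M′ a∈′
    ... | s , s∈ , ne = s , s∈ , other-side M′ M (≢-sym B≢) a∈′ a∈ ne

    source : ∀ {B} (M : MaxClique B) {x} → x ∈ B → Anchor (added B) x → ∃[ s ] s ∈ S₃ × r M s ≡ x
    source M x∈ (inj₁ cx) = beyond M x∈ cx
    source M {x} x∈ (inj₂ x∈X) = x , added⊆ M x∈X , r-id M x∈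

    around-cut : ∀ {w} → Cut w → ∃[ s ] ∃[ t ] s ∈ S₃ × t ∈ S₃ × s ≢ t × ¬ Conn w s t
    around-cut {w} cw with block-at w
    ... | B , M , w∈ with beyond M w∈ cw | avoiding M w∈
    ... | s , s∈ , eq | t , t∈ , ne = s , t , s∈ , t∈ , (λ { refl → ne eq }) ,
      subst (λ c → ¬ Conn c s t) eq (separated M λ eq′ → ne (trans (sym eq′) eq))

  -- Upper bound: charging vertices to arcs and choosing one geodesic for each pair.

  module UpperBound {S₃ : Subset n} (run : AfterLoops G S₃) where
    open Run run

    -- The hypothesis `third` condenses step 4: an antipodal block needs a vertex of `S` beyond its
    -- two, unless there is no even cycle and only edges are antipodal.
    module Cover {S : Subset n} (S₃⊆S : S₃ ⊆ S)
                 (third : (∀ {s t} → s ∈ S₃ → t ∈ S₃ → ∃[ u ] u ∈ S × u ≢ s × u ≢ t) ⊎ ¬ HasEvenCycleBlock G) where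

      record ArcOf (B : Subset n) : Set where
        field
          M       : MaxClique B
          {l}     : ℕ
          L       : Listing B l
          i δ     : ℕ
          half    : δ + δ ≤ l
          s t     : Fin n
          s∈      : s ∈ S
          t∈      : t ∈ S
          gate-s  : r M s ≡ Listing.c L i
          gate-t  : r M t ≡ Listing.c L (δ + i)

        On : Fin n → Set
        On w = ∃[ x ] x ≤ δ × w ≡ Listing.c L (x + i)

      -- The case `none` makes a cover available for arbitrary sets. The distinctness conditions in
      -- `three` give the arcs different pairs of ends.
      data Cover (B : Subset n) : Set where
        none  : ¬ MaxClique B → Cover B
        done  : (∀ {w} → w ∈ B → ¬ Cut w → w ∈ S) → Cover B
        three : (a₁ a₂ a₃ : ArcOf B) → let open ArcOf in
                t a₁ ≡ s a₂ → t a₂ ≡ s a₃ → t a₃ ≡ s a₁ → s a₁ ≢ s a₂ → s a₂ ≢ s a₃ → s a₁ ≢ s a₃ →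
                (∀ {w} → w ∈ B → On a₁ w ⊎ On a₂ w ⊎ On a₃ w) → Cover B

      module _ {B : Subset n} (M : MaxClique B) where

        triangle : ∀ {l α β γ s t u} (L : Listing B l) → α + β + γ ≡ l → α + α ≤ l → β + β ≤ l → γ + γ ≤ l →
                   s ∈ S → t ∈ S → u ∈ S → s ≢ t → t ≢ u → s ≢ u →
                   r M s ≡ Listing.c L 0 → r M t ≡ Listing.c L α → r M u ≡ Listing.c L (α + β) → Cover B
        triangle {l} {α} {β} {γ} {s} {t} {u} L total hα hβ hγ s∈ t∈ u∈ s≢t t≢u s≢u gs gt gu =
          three (arc 0 α hα s∈ t∈ gs (trans gt (cong c (sym (+-identityʳ α)))))
                (arc α β hβ t∈ u∈ gt (trans gu (cong c (+-comm α β))))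
                (arc (α + β) γ hγ u∈ s∈ gu (trans gs (sym around)))
                refl refl refl s≢t t≢u s≢u place
          where
          open Listing L
          arc : ∀ i δ → δ + δ ≤ l → ∀ {s t} → s ∈ S → t ∈ S → r M s ≡ c i → r M t ≡ c (δ + i) → ArcOf B
          arc i δ h {s} {t} s∈ t∈ g g′ = record
            { M = M ; L = L ; i = i ; δ = δ ; half = h ; s = s ; t = t ; s∈ = s∈ ; t∈ = t∈ ; gate-s = g ; gate-t = g′ }
          around : c (γ + (α + β)) ≡ c 0
          around = trans (cong c (trans (+-comm γ (α + β)) (trans total (sym (+-identityʳ l))))) (periodic 0)
          On′ : ℕ → ℕ → Fin n → Set
          On′ i δ w = ∃[ x ] x ≤ δ × w ≡ c (x + i)
          place : ∀ {w} → w ∈ B → On′ 0 α w ⊎ On′ α β w ⊎ On′ (α + β) γ w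
          place w∈ with onto w∈
          ... | k , k<l , refl with k ≤? α
          ... | yes h = inj₁ (k , h , cong c (sym (+-identityʳ k)))
          ... | no h with k ≤? α + β | m≤n⇒∃[o]m+o≡n (<⇒≤ (≰⇒> h))
          ... | yes h′ | x , refl = inj₂ (inj₁ (x , +-cancelˡ-≤ α x β h′ , cong c (+-comm α x)))
          ... | no h′ | _ with m≤n⇒∃[o]m+o≡n (<⇒≤ (≰⇒> h′))
          ... | x , refl = inj₂ (inj₂ (x , +-cancelˡ-≤ (α + β) x γ (≤-trans (<⇒≤ k<l) (≥= total)) , cong c (+-comm (α + β) x)))

        private
          gates-differ : ∀ {x y s t} → r M s ≡ x → r M t ≡ y → x ≢ y → s ≢ t
          gates-differ p q ne refl = ne (trans (sym p) q)

        -- With antipodal gates of s and t, any third vertex u completes the triangle.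
        antipodal-cover : ∀ {h s t u} (L : Listing B (h + h)) → s ∈ S → t ∈ S → u ∈ S → s ≢ t → u ≢ s → u ≢ t →
                          r M s ≡ Listing.c L 0 → r M t ≡ Listing.c L h → Cover B
        antipodal-cover {h} {s} {t} {u} L s∈ t∈ u∈ s≢t u≢s u≢t gs gt with Listing.onto L (r∈ M u)
        ... | m , m<l , gu with ≤-total m h
        ... | inj₁ m≤h with m≤n⇒∃[o]m+o≡n m≤h
        ... | o , eq = triangle {α = m} {β = o} {γ = h} L (cong (_+ h) eq) (+-mono-≤ m≤h m≤h) (+-mono-≤ o≤h o≤h) ≤-refl
              s∈ u∈ t∈ (≢-sym u≢s) u≢t s≢t gs (sym gu) (trans gt (cong (Listing.c L) (sym eq)))
          where
          o≤h : o ≤ h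
          o≤h = ≤-trans (m≤n+m o m) (≤= eq)
        antipodal-cover {h} {s} {t} {u} L s∈ t∈ u∈ s≢t u≢s u≢t gs gt | m , m<l , gu | inj₂ h≤m
          with m≤n⇒∃[o]m+o≡n h≤m | m≤n⇒∃[o]m+o≡n (<⇒≤ m<l)
        ... | o , eq | p , eq′ = triangle {α = h} {β = o} {γ = p} L (trans (cong (_+ p) eq) eq′) ≤-refl
              (+-mono-≤ o≤h o≤h) (+-mono-≤ p≤h p≤h)
              s∈ t∈ u∈ s≢t (≢-sym u≢t) (≢-sym u≢s) gs gt (trans (sym gu) (cong (Listing.c L) (sym eq)))
          where
          o≤h : o ≤ h
          o≤h = +-cancelˡ-≤ h o h (≤-trans (≤= eq) (<⇒≤ m<l))
          p≤h : p ≤ h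
          p≤h = +-cancelˡ-≤ m p h (≤-trans (≤= eq′) (+-monoˡ-≤ h h≤m))

        private
          antipodal-case : ∀ {h} (L : Listing B (h + h)) → h ≡ 1 ⊎ IsCycle G B (h + h) →
            Anchor (added B) (Listing.c L 0) → Anchor (added B) (Listing.c L h) →
            (∀ {s t} → s ∈ S₃ → t ∈ S₃ → ∃[ u ] u ∈ S × u ≢ s × u ≢ t) ⊎ ¬ HasEvenCycleBlock G → Cover B
          antipodal-case {h} L kind A A′ (inj₁ f) with source M (Listing.c∈ L 0) A | source M (Listing.c∈ L h) A′
          ... | s , s∈ , gs | t , t∈ , gt with f s∈ t∈
          ... | u , u∈ , u≢s , u≢t = antipodal-cover {h} L (S₃⊆S s∈) (S₃⊆S t∈) u∈
                (gates-differ gs gt (c-antipode {h = h} L)) u≢s u≢t gs gt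
          antipodal-case {h} L (inj₂ C) A A′ (inj₂ ¬even) =
            contradiction (B , h + h , maxClique⇒block M , C , divides h (sym (q*2≡q+q h))) ¬even
          -- Both vertices of the edge are anchors, hence cut vertices or elements of `S`.
          antipodal-case L (inj₁ refl) A A′ (inj₂ ¬even) = done on
            where
            settled : ∀ {w} → Anchor (added B) w → ¬ Cut w → w ∈ S
            settled (inj₁ cw) nc = contradiction cw nc
            settled (inj₂ w∈) nc = S₃⊆S (added⊆ M w∈)
            on : ∀ {w} → w ∈ B → ¬ Cut w → w ∈ S
            on w∈ with Listing.onto L w∈
            ... | zero        , _ , refl = settled A
            ... | suc zero    , _ , refl = settled A′
            ... | suc (suc _) , s≤s (s≤s ()) , _

        cover : Cover B
        cover with shape M
        ... | triple {l} {α} {β} {γ} L total hα hβ hγ α>0 β>0 γ>0 A A′ A″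
          with source M (Listing.c∈ L 0) A | source M (Listing.c∈ L α) A′ | source M (Listing.c∈ L (α + β)) A″
        ... | s , s∈ , gs | t , t∈ , gt | u , u∈ , gu =
          triangle L total hα hβ hγ (S₃⊆S s∈) (S₃⊆S t∈) (S₃⊆S u∈)
            (gates-differ gs gt (c-≢ L α>0 (≤-trans (≤-trans α<αβ (<⇒≤ αβ<l)) (m≤m+n l 0))))
            (gates-differ gt gu (c-≢ L α<αβ (≤-trans αβ<l (m≤m+n l α))))
            (gates-differ gs gu (c-≢ L (≤-trans α>0 (m≤m+n α β)) (≤-trans αβ<l (m≤m+n l 0))))
            gs gt gu
          where
          α<αβ : α < α + β
          α<αβ = ≤-trans (≤= (+-comm 1 α)) (+-monoʳ-≤ α β>0)
          αβ<l : α + β < l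
          αβ<l = ≤-trans (≤-trans (≤= (+-comm 1 (α + β))) (+-monoʳ-≤ (α + β) γ>0)) (≤= total)
        cover | antipodal {h} L kind A A′ = antipodal-case {h} L kind A A′ third

      abstract
        -- One cover is fixed for each set, so that all vertices of a block are charged to the same
        -- three arcs.
        coverOf : ∀ B → Cover B
        coverOf B with block? B
        ... | yes M = cover M
        ... | no ¬M = none ¬M

      arcs : ∀ {B} → Cover B → List (ArcOf B)
      arcs (three a₁ a₂ a₃ _ _ _ _ _ _ _) = a₁ ∷ a₂ ∷ a₃ ∷ []
      arcs _ = []

      Ends : ∀ {B} → ArcOf B → Fin n → Fin n → Set
      Ends a u v = (ArcOf.s a ≡ u × ArcOf.t a ≡ v) ⊎ (ArcOf.s a ≡ v × ArcOf.t a ≡ u)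

      -- Three distinct ends give three distinct unordered pairs. Hence vertices of one block
      -- charged to one pair lie on one arc.
      ends-unique : ∀ {B} (C : Cover B) {a a′ : ArcOf B} → a ∈ˡ arcs C → a′ ∈ˡ arcs C →
                    ∀ {u v} → Ends a u v → Ends a′ u v → a ≡ a′
      ends-unique (three a₁ a₂ a₃ e₁ e₂ e₃ n₁ n₂ n₃ _) = go
        where
        open ArcOf using (s; t)
        collide : ∀ {a a′ : ArcOf _} → s a ≢ s a′ → (s a ≡ t a′ → ¬ t a ≡ s a′) →
                  ∀ {u v} → Ends a u v → Ends a′ u v → a ≡ a′
        collide p q (inj₁ (x , y)) (inj₁ (x′ , y′)) = contradiction (trans x (sym x′)) p
        collide p q (inj₂ (x , y)) (inj₂ (x′ , y′)) = contradiction (trans x (sym x′)) p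
        collide p q (inj₁ (x , y)) (inj₂ (x′ , y′)) = contradiction (trans y (sym x′)) (q (trans x (sym y′)))
        collide p q (inj₂ (x , y)) (inj₁ (x′ , y′)) = contradiction (trans y (sym x′)) (q (trans x (sym y′)))
        go : ∀ {a a′ : ArcOf _} → a ∈ˡ (a₁ ∷ a₂ ∷ a₃ ∷ []) → a′ ∈ˡ (a₁ ∷ a₂ ∷ a₃ ∷ []) →
             ∀ {u v} → Ends a u v → Ends a′ u v → a ≡ a′
        go (here refl)                 (here refl)                 = λ _ _ → refl
        go (here refl)                 (there (here refl))         = collide n₁ λ p _ → n₃ (trans p e₂)
        go (here refl)                 (there (there (here refl))) = collide n₃ λ _ q → n₂ (trans (sym e₁) q)
        go (there (here refl))         (here refl)                 = collide (≢-sym n₁) λ _ q → n₃ (trans (sym q) e₂)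
        go (there (here refl))         (there (here refl))         = λ _ _ → refl
        go (there (here refl))         (there (there (here refl))) = collide n₂ λ p _ → n₁ (sym (trans p e₃))
        go (there (there (here refl))) (here refl)                 = collide (≢-sym n₃) λ p _ → n₂ (sym (trans p e₁))
        go (there (there (here refl))) (there (here refl))         = collide (≢-sym n₂) λ _ q → n₁ (trans (sym e₃) q)
        go (there (there (here refl))) (there (there (here refl))) = λ _ _ → refl

      Task : Fin n → Set
      Task w = ¬ Cut w × w ∉ S × ∃[ B ] MaxClique B × w ∈ B × Σ (ArcOf B) λ a → ArcOf.On a w × a ∈ˡ arcs (coverOf B)

      abstract
        task : ∀ w → (Cut w ⊎ w ∈ S) ⊎ Task w
        task w with cut? w | w ∈? S
        ... | yes cw | _      = inj₁ (inj₁ cw)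
        ... | no _   | yes w∈ = inj₁ (inj₂ w∈)
        ... | no nc  | no w∉  with block-at w
        ... | B , M , w∈ with coverOf B in eq
        ... | none ¬M = contradiction M ¬M
        ... | done f  = contradiction (f w∈ nc) w∉
        ... | three a₁ a₂ a₃ e₁ e₂ e₃ n₁ n₂ n₃ place = inj₂ (nc , w∉ , B , M , w∈ , pick (place w∈))
          where
          open ArcOf using (On)
          pick : On a₁ w ⊎ On a₂ w ⊎ On a₃ w → Σ (ArcOf B) λ a → On a w × a ∈ˡ arcs (coverOf B)
          pick k rewrite eq with k
          ... | inj₁ o        = a₁ , o , here refl
          ... | inj₂ (inj₁ o) = a₂ , o , there (here refl)
          ... | inj₂ (inj₂ o) = a₃ , o , there (there (here refl))

      Owned : ∀ {w} → (Cut w ⊎ w ∈ S) ⊎ Task w → Fin n → Fin n → Set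
      Owned (inj₁ _) u v = Empty
      Owned (inj₂ (_ , _ , _ , _ , _ , a , _)) u v = Ends a u v

      owned? : ∀ {w} (k : (Cut w ⊎ w ∈ S) ⊎ Task w) u v → Dec (Owned k u v)
      owned? (inj₁ _) u v = no λ ()
      owned? (inj₂ (_ , _ , _ , _ , _ , a , _)) u v =
        ((s Finₚ.≟ u) ×-dec (t Finₚ.≟ v)) ⊎-dec ((s Finₚ.≟ v) ×-dec (t Finₚ.≟ u))
        where open ArcOf a

      module _ {B : Subset n} (a : ArcOf B) where
        open ArcOf a
        open Listing L
        open Arc M L

        private
          Free : Fin n → Set
          Free w = ¬ Cut w × w ∉ S

          -- The gate of an element of `S` is this element itself or a cut vertex, and a free vertex
          -- is neither.
          not-gate : ∀ {w} → Free w → w ≢ c i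
          not-gate (nc , w∉) eq with s Finₚ.≟ r M s
          ... | yes p = w∉ (subst (_∈ S) (trans p (trans gate-s (sym eq))) s∈)
          ... | no p  = nc (subst Cut (trans gate-s (sym eq)) (gate-cut M p))

          gates-distinct : ∀ {w} → Free w → On w → r M s ≢ r M t
          gates-distinct free (x , x≤ , w≡) eq with δ ≟ 0
          ... | yes δ≡0 = not-gate free (trans w≡ (cong (λ x → c (x + i)) (n≤0⇒n≡0 (≤-trans x≤ (≤= δ≡0)))))
          ... | no δ≢0 = c-≢ L (+-monoˡ-≤ i δ>0) (+-monoˡ-< i (≤-trans (+-monoˡ-≤ δ δ>0) half))
            (trans (sym gate-s) (trans eq gate-t))
            where
            δ>0 : 0 < δ
            δ>0 = n≢0⇒n>0 δ≢0

        -- A geodesic from `s` to `t` passes both gates, and the arc between them is at most half of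
        -- the cycle, so distances along it are differences of positions.
        on-arc : ∀ {w w′} → Free w → (o : On w) (o′ : On w′) → proj₁ o ≤ proj₁ o′ →
                 D s w + D w w′ + D w′ t ≡ D s t
        on-arc {w} {w′} free o@(x , x≤ , refl) (x′ , x′≤ , refl) x≤x′
          with m≤n⇒∃[o]m+o≡n x≤x′ | m≤n⇒∃[o]m+o≡n x′≤
        ... | y , eq | z , eq′ = trans
          (arith {D s p} {D q t} x y x′ z (before x x≤) (D-arc′ y shift₁ (twice (≤-trans (m≤n+m y x) (≤= eq)) x′≤)) after eq eq′)
          (sym (trans (D-via-gates M (gates-distinct free o)) (cong (λ k → D s p + (k + D q t)) pq)))
          where
          p = r M s
          q = r M t
          twice : ∀ {y x} → y ≤ x → x ≤ δ → y + y ≤ l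
          twice a b = ≤-trans (+-mono-≤ (≤-trans a b) (≤-trans a b)) half
          shift₁ : y + (x + i) ≡ x′ + i
          shift₁ = trans (sym (+-assoc y x i)) (cong (_+ i) (trans (+-comm y x) eq))
          before : ∀ x → x ≤ δ → D s (c (x + i)) ≡ D s p + x
          before x h = trans (sym (r-btw M (c∈ (x + i))))
            (cong (D s p +_) (trans (cong (λ g → D g (c (x + i))) gate-s) (D-arc i x (twice ≤-refl h))))
          after : D (c (x′ + i)) t ≡ z + D q t
          after = trans (sym (btw-sym (r-btw M (c∈ (x′ + i)))))
            (cong (_+ D q t) (trans (cong (D (c (x′ + i))) gate-t)
              (D-arc′ z (trans (sym (+-assoc z x′ i)) (cong (_+ i) (trans (+-comm z x′) eq′)))
                (twice (≤-trans (m≤n+m z x′) (≤= eq′)) ≤-refl))))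
          pq : D p q ≡ δ
          pq = trans (cong₂ D gate-s gate-t) (D-arc i δ half)
          arith : ∀ {sp qt sw ww′ w′t} x y x′ z → sw ≡ sp + x → ww′ ≡ y → w′t ≡ z + qt → x + y ≡ x′ → x′ + z ≡ δ →
                  sw + ww′ + w′t ≡ sp + (δ + qt)
          arith {sp} {qt} x y x′ z refl refl refl refl eq rewrite sym eq = solve (sp ∷ qt ∷ x ∷ y ∷ z ∷ [])

        arc-compatible : ∀ {w w′} → Free w → Free w′ → On w → On w′ → Compatible s t w w′
        arc-compatible f f′ o o′ with ≤-total (proj₁ o) (proj₁ o′)
        ... | inj₁ h = inj₁ (on-arc f o o′ h)
        ... | inj₂ h = inj₂ (on-arc f′ o′ o h)

      compatible-sym : ∀ {s t w w′} → Compatible s t w w′ → Compatible t s w w′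
      compatible-sym {s} {t} {w} {w′} = Sum.[ inj₂ ∘ rev , inj₁ ∘ rev ]′
        where
        rev : ∀ {w w′} → D s w + D w w′ + D w′ t ≡ D s t → D t w′ + D w′ w + D w s ≡ D t s
        rev {w} {w′} e = trans (arith (D t w′) (D w′ w) (D w s))
          (trans (cong₂ _+_ (cong₂ _+_ (D-sym w s) (D-sym w′ w)) (D-sym t w′)) (trans e (D-sym s t)))
          where
          arith : ∀ a b c → a + b + c ≡ c + b + a
          arith a b c = solve (a ∷ b ∷ c ∷ [])

      ends-compatible : ∀ {B} (a : ArcOf B) {u v w w′} → Ends a u v →
        Compatible (ArcOf.s a) (ArcOf.t a) w w′ → Compatible u v w w′
      ends-compatible a (inj₁ (refl , refl)) k = k
      ends-compatible a (inj₂ (refl , refl)) k = compatible-sym k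

      private
        R : Fin n → Fin n → Fin n → Set
        R u v w = Owned (task w) u v

        -- Inseparable vertices share a block, and a vertex that is not a cut vertex has only one.
        -- So some vertex separates `w` from `w′`.
        apart : ∀ {B B′ u v w w′} → MaxClique B → MaxClique B′ → w ∈ B → w′ ∈ B′ → ¬ Cut w → ¬ Cut w′ → B ≢ B′ →
                Btw u w v → Btw u w′ v → Compatible u v w w′
        apart {w = w} {w′} M M′ w∈ w∈′ nc nc′ B≢ h h′ with insep? w w′
        ... | no ¬i = let c , c≢w , c≢w′ , sep = separator ¬i in separated-compatible c≢w c≢w′ sep h h′
        ... | yes i with pair-block i
        ... | B″ , M″ , p , q = contradiction (trans (noncut-block M M″ nc w∈ p) (noncut-block M″ M′ nc′ q w∈′)) B≢

        tasks-compatible : ∀ {u v w w′} (k : (Cut w ⊎ w ∈ S) ⊎ Task w) (k′ : (Cut w′ ⊎ w′ ∈ S) ⊎ Task w′) →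
          Owned k u v → Owned k′ u v → Btw u w v → Btw u w′ v → Compatible u v w w′
        tasks-compatible (inj₂ (nc , w∉ , B , M , w∈ , a , o , a∈)) (inj₂ (nc′ , w∉′ , B′ , M′ , w∈′ , a′ , o′ , a∈′)) e e′ h h′
          with Vecₚ.≡-dec Bool._≟_ B B′
        ... | no B≢ = apart M M′ w∈ w∈′ nc nc′ B≢ h h′
        ... | yes refl with ends-unique (coverOf B) a∈ a∈′ e e′
        ... | refl = ends-compatible a e (arc-compatible a (nc , w∉) (nc′ , w∉′) o o′)

        abstract
          path : ∀ u v → Through (R u v) (λ w → owned? (task w) u v) u v
          path u v = common-geodesic (R u v) (λ w → owned? (task w) u v) (D u v) u v ≤-refl
            λ w w′ k k′ h h′ → tasks-compatible (task w) (task w′) k k′ h h′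

        assignment : Assignment G S
        assignment u v _ _ _ = let P , len , _ = path u v in P , shortest-D P len

        own-btw : ∀ {w} u v (k : (Cut w ⊎ w ∈ S) ⊎ Task w) → Owned k u v → Btw u w v
        own-btw {w} u v (inj₂ (nc , w∉ , B , M , w∈ , a , o , a∈)) e = simplify (ends-compatible a e (arc-compatible a (nc , w∉) (nc , w∉) o o))
          where
          simplify : Compatible u v w w → Btw u w v
          simplify k = trans (cong (_+ D w v) (sym (trans (cong (D u w +_) (D-refl w)) (+-identityʳ _)))) ([ id , id ]′ k)

        Covered : Fin n → Set
        Covered w = Σ (Fin n) λ u → Σ (Fin n) λ v → Σ (u ∈ S) λ u∈S → Σ (v ∈ S) λ v∈S → Σ (u Fin.< v) λ u<v →
                    LiesOn w (assignment u v u∈S v∈S u<v)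

        -- The assignment keeps only the path for the increasing order of the ends, while an arc has
        -- a direction of its own; hence both paths are asked to contain `w`.
        ordered : ∀ w s t → s ∈ S → t ∈ S → s ≢ t →
                  w ∈ˡ vertices (proj₁ (path s t)) → w ∈ˡ vertices (proj₁ (path t s)) → Covered w
        ordered w s t s∈ t∈ ne p q = by-order (Finₚ.<-cmp s t)
          where
          by-order : Tri (s Fin.< t) (s ≡ t) (t Fin.< s) → Covered w
          by-order (tri< lt _ _) = s , t , s∈ , t∈ , lt , p
          by-order (tri≈ _ eq _) = contradiction eq ne
          by-order (tri> _ _ gt) = t , s , t∈ , s∈ , gt , q

        cut-covered : ∀ w → Cut w → Covered w
        cut-covered w cw = along (around-cut cw)
          where
          along : ∃[ s ] ∃[ t ] s ∈ S₃ × t ∈ S₃ × s ≢ t × ¬ Conn w s t → Covered w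
          along (s , t , s∈ , t∈ , ne , sep) = ordered w s t (S₃⊆S s∈) (S₃⊆S t∈) ne
            (separator-on-walk {w} {s} {t} sep (proj₁ (path s t)))
            (separator-on-walk {w} {t} {s} (λ k → sep (conn-sym {w} {t} {s} k)) (proj₁ (path t s)))

        ends-differ : ∀ {B} (C : Cover B) {a} → a ∈ˡ arcs C → ArcOf.s a ≢ ArcOf.t a
        ends-differ (three _ _ _ e₁ e₂ e₃ n₁ n₂ n₃ _) (here refl) eq = n₁ (trans eq e₁)
        ends-differ (three _ _ _ e₁ e₂ e₃ n₁ n₂ n₃ _) (there (here refl)) eq = n₂ (trans eq e₂)
        ends-differ (three _ _ _ e₁ e₂ e₃ n₁ n₂ n₃ _) (there (there (here refl))) eq = n₃ (sym (trans eq e₃))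

        on-path : ∀ w u v → R u v w → w ∈ˡ vertices (proj₁ (path u v))
        on-path w u v k = proj₂ (proj₂ (path u v)) w k (own-btw u v (task w) k)

        task-covered : ∀ w (k : Task w) → task w ≡ inj₂ k → Covered w
        task-covered w k@(_ , _ , B , _ , _ , a , _ , a∈) eq =
          ordered w (ArcOf.s a) (ArcOf.t a) (ArcOf.s∈ a) (ArcOf.t∈ a) (ends-differ (coverOf B) a∈)
            (on-path w (ArcOf.s a) (ArcOf.t a) (subst (λ k → Owned k (ArcOf.s a) (ArcOf.t a)) (sym eq) (inj₁ (refl , refl))))
            (on-path w (ArcOf.t a) (ArcOf.s a) (subst (λ k → Owned k (ArcOf.t a) (ArcOf.s a)) (sym eq) (inj₂ (refl , refl))))

        all-covered : ∀ w → w ∉ S → Covered w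
        all-covered w w∉ = by-task (task w) refl
          where
          by-task : (k : (Cut w ⊎ w ∈ S) ⊎ Task w) → task w ≡ k → Covered w
          by-task (inj₁ (inj₁ cw)) _  = cut-covered w cw
          by-task (inj₁ (inj₂ w∈)) _  = contradiction w∈ w∉
          by-task (inj₂ k)         eq = task-covered w k eq

      strongGeodetic : StrongGeodetic G S
      strongGeodetic = assignment , all-covered

  -- Lower bound: projecting an arbitrary strong geodetic set onto the blocks.

  module Against {S : Subset n} (sg : StrongGeodetic G S) where

    on-geodesic : ∀ w → w ∉ S → ∃[ s ] ∃[ t ] s ∈ S × t ∈ S × Btw s w t
    on-geodesic w w∉ with proj₂ sg w w∉
    ... | s , t , s∈ , t∈ , lt , on = s , t , s∈ , t∈ ,
      ∈-shortest⇒btw (proj₁ (proj₁ sg s t s∈ t∈ lt))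
        (D-shortest (proj₁ (proj₁ sg s t s∈ t∈ lt)) (proj₂ (proj₁ sg s t s∈ t∈ lt))) on

    module _ {B : Subset n} (M : MaxClique B) where

      -- Both halves pass through the gates; the stretches before the first gate and after the
      -- second cancel.
      gates-btw : ∀ {s w t} → w ∈ B → Btw s w t → Btw (r M s) w (r M t)
      gates-btw {s} {w} {t} w∈ h = ≤-antisym
        (arith (D s p) (D p w) (D s w) (D w q) (D q t) (D w t) (D s t) (D p q) (D p t)
          (r-btw M w∈) (btw-sym (r-btw M w∈)) h (D-tri s p t) (D-tri p q t))
        (D-tri p w q)
        where
        p = r M s
        q = r M t
        arith : ∀ sp pw sw wq qt wt st pq pt → sp + pw ≡ sw → wq + qt ≡ wt → sw + wt ≡ st → st ≤ sp + pt →
                pt ≤ pq + qt → pw + wq ≤ pq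
        arith sp pw sw wq qt wt st pq pt e₁ e₂ e₃ h h′ = linear 0 (≤= e₁ ⊕ ≤= e₂ ⊕ ≤= e₃ ⊕ h ⊕ h′)
          (solve (sp ∷ pw ∷ sw ∷ wq ∷ qt ∷ wt ∷ st ∷ pq ∷ pt ∷ []))

      -- These elements of `S` can be credited to this block alone, since a vertex shared by two
      -- blocks is a cut vertex.
      Private : Fin n → Set
      Private y = y ∈ S × y ∈ B × ¬ Cut y

      private? : ∀ y → Dec (Private y)
      private? y = (y ∈? S) ×-dec (y ∈? B) ×-dec ¬? (cut? y)

      gate-kind : ∀ {s} → s ∈ S → Cut (r M s) ⊎ Private (r M s)
      gate-kind {s} s∈ with s Finₚ.≟ r M s | cut? (r M s)
      ... | _      | yes cs = inj₁ cs
      ... | no ne  | _      = inj₁ (gate-cut M ne)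
      ... | yes eq | no nc  = inj₂ (subst (_∈ S) eq s∈ , r∈ M s , nc)

      covered-by-gates : ∀ {w} → w ∈ B → w ∉ S → ∃[ s ] ∃[ t ] s ∈ S × t ∈ S × Btw (r M s) w (r M t)
      covered-by-gates {w} w∈ w∉ with on-geodesic w w∉
      ... | s , t , s∈ , t∈ , h = s , t , s∈ , t∈ , gates-btw w∈ h

      btw-same : ∀ {a w} → Btw a w a → w ≡ a
      btw-same {a} {w} h = sym (D-zero (m+n≡0⇒m≡0 (D a w) (trans h (D-refl a))))

      -- Without a private vertex every gate is `a`, so all projected geodesics shrink to `a` and
      -- leave another vertex of the block uncovered.
      leaf-private : ∀ {a} → (∀ {c} → CutIn G B c → c ≡ a) → ∃[ y ] Private y
      leaf-private {a} only with Finₚ.any? private?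
      ... | yes k = k
      ... | no none with another-vertex M a
      ... | w , w∈ , w≢a with cut? w | w ∈? S
      ... | yes cw | _      = contradiction (only (w∈ , cw)) w≢a
      ... | no nc  | yes w∈S = contradiction (w , w∈S , w∈ , nc) none
      ... | no nc  | no w∉ with covered-by-gates w∈ w∉
      ... | s , t , s∈ , t∈ , h = contradiction (btw-same (subst₂ (λ p q → Btw p w q) (at-cut s∈) (at-cut t∈) h)) w≢a
        where
        at-cut : ∀ {s} → s ∈ S → r M s ≡ a
        at-cut {s} s∈ with gate-kind s∈
        ... | inj₁ cs = only (r∈ M s , cs)
        ... | inj₂ k  = contradiction (_ , k) none

      -- Without a private vertex all gates of `S` are cut vertices, and the projected geodesics
      -- would witness the covering.
      uncovered-private : ¬ CoveredByCuts G B → ∃[ y ] Private y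
      uncovered-private ¬cov with Finₚ.any? private?
      ... | yes k = k
      ... | no none = contradiction cov ¬cov
        where
        cut-gate : ∀ {s} → s ∈ S → CutIn G B (r M s)
        cut-gate {s} s∈ = r∈ M s , [ id , (λ k → contradiction (_ , k) none) ]′ (gate-kind s∈)
        cov : CoveredByCuts G B
        cov w w∈ with cut? w | w ∈? S
        ... | yes cw | _       = w , w , (w∈ , cw) , (w∈ , cw) , btw⇒innerOn M w∈ w∈ btw-start
        ... | no nc  | yes w∈S = contradiction (w , w∈S , w∈ , nc) none
        ... | no nc  | no w∉ with covered-by-gates w∈ w∉
        ... | s , t , s∈ , t∈ , h = r M s , r M t , cut-gate s∈ , cut-gate t∈ , btw⇒innerOn M (r∈ M s) (r∈ M t) h

      -- In an odd cycle one arc from `a` to `y` is strictly longer than the other; the witness is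
      -- the neighbour of `a` on the longer arc.
      odd-not-between : ∀ {h a y} → IsCycle G B (suc (h + h)) → a ∈ B → y ∈ B → y ≢ a → ∃[ w ] w ∈ B × ¬ Btw a w y
      odd-not-between {h} C a∈ y∈ y≢a with Arc.rebase M (cycle-listing C) a∈
      ... | L , refl with Listing.onto L y∈
      ... | zero  , _   , refl = contradiction refl y≢a
      ... | suc k , k<l , refl with suc k ≤? h
      ... | yes k<h = c (h + h) , c∈ _ , λ b → <-irrefl refl (near b
          (D-cases (suc k) (h + h) (≤-trans k<h (m≤m+n h h)) (≤-trans (n≤1+n _) (m≤m+n _ (suc k)))))
        where
        open Listing L
        open Position M L
        from : D (c 0) (c (suc k)) ≡ suc k
        from = D-arc′ (suc k) (+-identityʳ _) (≤-trans (+-mono-≤ k<h k<h) (n≤1+n _))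
        to : D (c 0) (c (h + h)) ≡ 1
        to = D-coarc 1 (+-identityʳ _) l≥2
        near : Btw (c 0) (c (h + h)) (c (suc k)) →
               (∃[ d ] d + suc k ≡ h + h × D (c (suc k)) (c (h + h)) ≡ d) ⊎
               (∃[ d ] d + (h + h) ≡ suc (h + h) + suc k × D (c (suc k)) (c (h + h)) ≡ d) → 1 ≤ 0
        near b (inj₁ (d , p , q)) = arith h k d p (trans (sym (cong₂ _+_ to (trans (D-sym _ _) q))) (trans b from)) k<h
          where
          arith : ∀ h k d → d + suc k ≡ h + h → 1 + d ≡ suc k → suc k ≤ h → 1 ≤ 0
          arith h k d p q r = linear 0 (≥= p ⊕ ≤= q ⊕ r ⊕ r) (solve (h ∷ k ∷ d ∷ []))
        near b (inj₂ (d , p , q)) = arith h k d p (trans (sym (cong₂ _+_ to (trans (D-sym _ _) q))) (trans b from))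
          where
          arith : ∀ h k d → d + (h + h) ≡ suc (h + h) + suc k → 1 + d ≡ suc k → 1 ≤ 0
          arith h k d p q = linear 1 (≥= p ⊕ ≤= q) (solve (h ∷ k ∷ d ∷ []))
      ... | no k≮h = c 1 , c∈ 1 , λ b → <-irrefl refl (near b (D-cases 1 (suc k) (s≤s z≤n) (≤-trans (<⇒≤ k<l) (m≤m+n _ 1))))
        where
        open Listing L
        open Position M L
        e = proj₁ (m≤n⇒∃[o]m+o≡n (<⇒≤ k<l))
        k+e : suc k + e ≡ suc (h + h)
        k+e = proj₂ (m≤n⇒∃[o]m+o≡n (<⇒≤ k<l))
        h≤k : h ≤ k
        h≤k = ≤-pred (≰⇒> k≮h)
        e-short : ∀ h k e → suc k + e ≡ suc (h + h) → h ≤ k → e + e ≤ suc (h + h)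
        e-short h k e p r = linear 1 (≤= p ⊕ ≤= p ⊕ r ⊕ r) (solve (h ∷ k ∷ e ∷ []))
        from : D (c 0) (c (suc k)) ≡ e
        from = D-coarc e (trans (+-identityʳ _) (trans (sym k+e) (+-comm (suc k) e))) (e-short h k e k+e h≤k)
        to : D (c 0) (c 1) ≡ 1
        to = D-arc′ 1 refl l≥2
        near : Btw (c 0) (c 1) (c (suc k)) →
               (∃[ d ] d + 1 ≡ suc k × D (c 1) (c (suc k)) ≡ d) ⊎
               (∃[ d ] d + suc k ≡ suc (h + h) + 1 × D (c 1) (c (suc k)) ≡ d) → 1 ≤ 0
        near b (inj₁ (d , p , q)) = arith h k d e p (trans (sym (cong₂ _+_ to q)) (trans b from)) k+e h≤k
          where
          arith : ∀ h k d e → d + 1 ≡ suc k → 1 + d ≡ e → suc k + e ≡ suc (h + h) → h ≤ k → 1 ≤ 0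
          arith h k d e p q r s = linear 0 (≥= p ⊕ ≤= q ⊕ ≤= r ⊕ s ⊕ s) (solve (h ∷ k ∷ d ∷ e ∷ []))
        near b (inj₂ (d , p , q)) = arith h k d e p (trans (sym (cong₂ _+_ to q)) (trans b from)) k+e
          where
          arith : ∀ h k d e → d + suc k ≡ suc (h + h) + 1 → 1 + d ≡ e → suc k + e ≡ suc (h + h) → 1 ≤ 0
          arith h k d e p q r = linear 1 (≥= p ⊕ ≤= q ⊕ ≤= r) (solve (h ∷ k ∷ d ∷ e ∷ []))

      -- With a single private vertex `y` every gate would be `a` or `y`, and the whole cycle would
      -- lie between these two.
      odd-private : ∀ {a l} → CutIn G B a → (∀ {c} → CutIn G B c → c ≡ a) → IsCycle G B l → ¬ 2 ∣ l →
                    ∃[ y ] ∃[ z ] Private y × Private z × y ≢ z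
      odd-private {a} {l} (a∈ , ca) only C ¬2∣l with leaf-private only
      ... | y , py@(_ , y∈ , ncy) with Finₚ.any? (λ z → private? z ×-dec ¬? (y Finₚ.≟ z))
      ... | yes (z , pz , ne) = y , z , py , pz , ne
      ... | no none with odd-not-between {l / 2} (subst (IsCycle G B) (odd-half l ¬2∣l) C) a∈ y∈ (λ { refl → ncy ca })
      ... | w , w∈ , ¬b = contradiction (between w∈) ¬b
        where
        is-y : ∀ {z} → Private z → z ≡ y
        is-y {z} pz = sym (decidable-stable (y Finₚ.≟ z) λ ne → none (z , pz , ne))
        kinds : ∀ {s} → s ∈ S → r M s ≡ a ⊎ r M s ≡ y
        kinds {s} s∈ = Sum.map (λ cs → only (r∈ M s , cs)) is-y (gate-kind s∈)
        cases : ∀ {w p q} → p ≡ a ⊎ p ≡ y → q ≡ a ⊎ q ≡ y → Btw p w q → Btw a w y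
        cases (inj₁ refl) (inj₂ refl) h = h
        cases (inj₂ refl) (inj₁ refl) h = btw-sym h
        cases (inj₁ refl) (inj₁ refl) h = subst (λ w → Btw a w y) (sym (btw-same h)) btw-start
        cases (inj₂ refl) (inj₂ refl) h = subst (λ w → Btw a w y) (sym (btw-same h)) btw-end
        between : ∀ {w} → w ∈ B → Btw a w y
        between {w} w∈ with cut? w | w ∈? S
        ... | yes cw | _       = subst (λ w → Btw a w y) (sym (only (w∈ , cw))) btw-start
        ... | no nc  | yes w∈S = subst (λ w → Btw a w y) (sym (is-y (w∈S , w∈ , nc))) btw-end
        ... | no nc  | no w∉ with covered-by-gates w∈ w∉
        ... | s , t , s∈ , t∈ , h = cases (kinds s∈) (kinds t∈) h

      Charging : Subset n → Set
      Charging X = Σ (Fin n → Fin n) λ g → (∀ {x} → x ∈ X → Private (g x)) × (∀ {x y} → x ∈ X → y ∈ X → g x ≡ g y → x ≡ y)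

      none-charging : Charging ⊥
      none-charging = id , (λ x∈ → contradiction x∈ ∉⊥) , λ x∈ → contradiction x∈ ∉⊥

      one-charging : ∀ {v} → ∃[ y ] Private y → Charging ⁅ v ⁆
      one-charging {v} (y , py) = (λ _ → y) , (λ _ → py) , λ x∈ x∈′ _ → trans (x∈⁅y⁆⇒x≡y v x∈) (sym (x∈⁅y⁆⇒x≡y v x∈′))

      two-charging : ∀ {u v} → ∃[ y ] ∃[ z ] Private y × Private z × y ≢ z → Charging (⁅ u ⁆ ∪ ⁅ v ⁆)
      two-charging {u} {v} (y , z , py , pz , y≢z) = g , (λ {x} _ → into x) , λ {x} {x′} x∈ x∈′ → inj x∈ x∈′
        where
        g : Fin n → Fin n
        g x with x Finₚ.≟ u
        ... | yes _ = y
        ... | no _  = z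
        into : ∀ x → Private (g x)
        into x with x Finₚ.≟ u
        ... | yes _ = py
        ... | no _  = pz
        is-v : ∀ {x} → x ∈ ⁅ u ⁆ ∪ ⁅ v ⁆ → x ≢ u → x ≡ v
        is-v x∈ ne with x∈p∪q⁻ ⁅ u ⁆ ⁅ v ⁆ x∈
        ... | inj₁ i = contradiction (x∈⁅y⁆⇒x≡y u i) ne
        ... | inj₂ i = x∈⁅y⁆⇒x≡y v i
        inj : ∀ {x x′} → x ∈ ⁅ u ⁆ ∪ ⁅ v ⁆ → x′ ∈ ⁅ u ⁆ ∪ ⁅ v ⁆ → g x ≡ g x′ → x ≡ x′
        inj {x} {x′} x∈ x∈′ eq with x Finₚ.≟ u | x′ Finₚ.≟ u
        ... | yes p | yes q = trans p (sym q)
        ... | yes p | no q  = contradiction eq y≢z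
        ... | no p  | yes q = contradiction (sym eq) y≢z
        ... | no p  | no q  = trans (is-v x∈ p) (sym (is-v x∈′ q))

      step2-charging : ∀ {X a} → CutIn G B a → (∀ {c} → CutIn G B c → c ≡ a) → Step2 G B X → Charging X
      step2-charging cin only (edge _ _ _)         = one-charging (leaf-private only)
      step2-charging cin only (even _ _ _ _ _)     = one-charging (leaf-private only)
      step2-charging cin only (odd C ¬2∣l _ _ _ _ _ _) = two-charging (odd-private cin only C ¬2∣l)

      step3-charging : ∀ {X} → Step3 G B X → Charging X
      step3-charging (edge _)        = none-charging
      step3-charging (antipodal _ _) = none-charging
      step3-charging (covered _ _ _) = none-charging
      step3-charging (uncovered _ _ ¬cov _ _ _ _ _ _ _) = one-charging (uncovered-private ¬cov)

    -- Distinct blocks are charged to distinct vertices, as a vertex that is not a cut vertex lies in one block only.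
    loops-minimal : ∀ {S₃} → AfterLoops G S₃ → ∣ S₃ ∣ ≤ ∣ S ∣
    loops-minimal {S₃} run = count-injection S₃ S f into inj
      where
      open AfterLoops run
      charging : ∀ {B} (M : MaxClique B) → Charging M (added B)
      charging {B} M with leaf-or-internal M
      ... | a , cin , inj₁ (lf , only) = step2-charging M cin only (leaf B lf)
      ... | a , cin , inj₂ (int , _)   = step3-charging M (internal B int)
      chargingOf : ∀ B → Dec (MaxClique B) → Fin n → Fin n
      chargingOf B (yes M) = proj₁ (charging M)
      chargingOf B (no _)  = id
      private-in : ∀ {B} (d : Dec (MaxClique B)) → MaxClique B → ∀ {x} → x ∈ added B →
                   chargingOf B d x ∈ S × chargingOf B d x ∈ B × ¬ Cut (chargingOf B d x)
      private-in (yes M) _ x∈ = proj₁ (proj₂ (charging M)) x∈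
      private-in (no ¬M) M _  = contradiction M ¬M
      injective-on : ∀ {B} (d : Dec (MaxClique B)) → MaxClique B → ∀ {x y} → x ∈ added B → y ∈ added B →
                     chargingOf B d x ≡ chargingOf B d y → x ≡ y
      injective-on (yes M) _ = proj₂ (proj₂ (charging M))
      injective-on (no ¬M) M _ = contradiction M ¬M
      g : ∀ x → Dec (x ∈ S₃) → Fin n
      g x (yes x∈) = let B , _ = Equivalence.to (union x) x∈ in chargingOf B (block? B) x
      g x (no _)   = x
      f : Fin n → Fin n
      f x = g x (x ∈? S₃)
      into : ∀ {x} → x ∈ S₃ → f x ∈ S
      into {x} x∈ = go (x ∈? S₃)
        where
        go : ∀ d → g x d ∈ S
        go (yes x∈) with Equivalence.to (union x) x∈
        ... | B , bl , i = proj₁ (private-in (block? B) (block⇒maxClique bl) i)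
        go (no x∉) = contradiction x∈ x∉
      inj : ∀ {x y} → x ∈ S₃ → y ∈ S₃ → f x ≡ f y → x ≡ y
      inj {x} {y} x∈ y∈ = go (x ∈? S₃) (y ∈? S₃)
        where
        go : ∀ d d′ → g x d ≡ g y d′ → x ≡ y
        go (no x∉) _ _ = contradiction x∈ x∉
        go (yes _) (no y∉) _ = contradiction y∈ y∉
        go (yes x∈) (yes y∈) eq with Equivalence.to (union x) x∈ | Equivalence.to (union y) y∈
        -- The common image lies in both blocks and is not a cut vertex, so the blocks are equal and
        -- the charging of that one block decides.
        ... | B , bl , i | B′ , bl′ , i′ = same (noncut-block (block⇒maxClique bl) (block⇒maxClique bl′)
              (proj₂ (proj₂ pi)) (proj₁ (proj₂ pi)) (subst (_∈ B′) (sym eq) (proj₁ (proj₂ (private-in (block? B′) (block⇒maxClique bl′) i′))))) i′ eq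
          where
          pi = private-in (block? B) (block⇒maxClique bl) i
          same : ∀ {B′} → B ≡ B′ → y ∈ added B′ → chargingOf B (block? B) x ≡ chargingOf B′ (block? B′) y → x ≡ y
          same refl i′ = injective-on (block? B) (block⇒maxClique bl) i i′

    private
      radial : ∀ {s t x y} (P : Walk G s t) → ∥ P ∥ ≡ D s t → x ∈ˡ vertices P → y ∈ˡ vertices P → Btw s x y ⊎ Btw s y x
      radial P@ε       eq (here refl) _           = inj₁ btw-start
      radial P@(_ ◅ _) eq (here refl) _           = inj₁ btw-start
      radial P@(_ ◅ _) eq (there _)   (here refl) = inj₂ btw-start
      radial {s} {t} {x} {y} (_◅_ {j = s′} e P) eq (there i) (there j) =
        Sum.map (lengthen x y i j) (lengthen y x j i) (radial P tail i j)
        where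
        shortest-e : IsShortest (e ◅ P)
        shortest-e = shortest-D (e ◅ P) eq
        tail : ∥ P ∥ ≡ D s′ t
        tail = D-shortest P λ Q → ≤-pred (shortest-e (e ◅ Q))
        further : ∀ z → z ∈ˡ vertices P → D s z ≡ suc (D s′ z)
        further z k = +-cancelʳ-≡ (D z t) _ _ (trans (∈-shortest⇒btw (e ◅ P) eq (there k))
          (trans (sym eq) (cong suc (trans tail (sym (∈-shortest⇒btw P tail k))))))
        lengthen : ∀ x y → x ∈ˡ vertices P → y ∈ˡ vertices P → Btw s′ x y → Btw s x y
        lengthen x y i j h = trans (cong (_+ D x y) (further x i)) (trans (cong suc h) (sym (further y j)))

      -- The vertices of a geodesic are linearly ordered by betweenness from `s`, and equal
      -- distances leave no room between two of them.
      equidistant : ∀ {s t x y} (P : Walk G s t) → ∥ P ∥ ≡ D s t → x ∈ˡ vertices P → y ∈ˡ vertices P →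
                    D s x ≡ D s y → x ≡ y
      equidistant {s} {x = x} {y} P eq i j d with radial P eq i j
      ... | inj₁ h = D-zero (+-cancelˡ-≡ (D s x) _ _ (trans h (trans (sym d) (sym (+-identityʳ _)))))
      ... | inj₂ h = sym (D-zero (+-cancelˡ-≡ (D s y) _ _ (trans h (trans d (sym (+-identityʳ _))))))

    -- The two cycle neighbours of the gate of s are equidistant from s, so one geodesic cannot contain both.
    cycle⇒three : ∀ {B l} → MaxClique B → IsCycle G B l → 3 ≤ ∣ S ∣
    cycle⇒three {B} {l} M C = ≮⇒≥ λ small → conclude small
      where
      L = cycle-listing C
      module _ (small : ∣ S ∣ < 3) where
        at-most-two : ∀ {x y z} → x ∈ S → y ∈ S → z ∈ S → x ≢ y → z ≡ x ⊎ z ≡ y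
        at-most-two {x} {y} {z} x∈ y∈ z∈ ne with z Finₚ.≟ x | z Finₚ.≟ y
        ... | yes p | _     = inj₁ p
        ... | no _  | yes q = inj₂ q
        ... | no p  | no q  = contradiction (three∈⇒3≤ x∈ y∈ z∈ ne (≢-sym q) (≢-sym p)) (<⇒≱ small)
        open Listing L
        l≥3 : 3 ≤ l
        l≥3 = cycle≥3 C
        -- Three cycle vertices cannot all lie in `S`. The pair whose path covers one outside
        -- supplies two elements of `S`.
        outside : ∃[ w ] w ∈ B × w ∉ S
        outside with c 0 ∈? S | c 1 ∈? S | c 2 ∈? S
        ... | no h  | _     | _     = c 0 , c∈ 0 , h
        ... | yes _ | no h  | _     = c 1 , c∈ 1 , h
        ... | yes _ | yes _ | no h  = c 2 , c∈ 2 , h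
        ... | yes p | yes q | yes o = contradiction
          (three∈⇒3≤ p q o (c-≢ L (s≤s z≤n) (≤-trans (≤-trans (s≤s (s≤s z≤n)) l≥3) (m≤m+n l 0)))
            (c-≢ L (s≤s (s≤s z≤n)) (≤-trans l≥3 (m≤m+n l 1))) (c-≢ L (s≤s z≤n) (≤-trans l≥3 (m≤m+n l 0))))
          (<⇒≱ small)
        conclude : Empty
        conclude with outside
        ... | w , w∈ , w∉ with proj₂ sg w w∉
        ... | s , t , s∈ , t∈ , lt , _ = two-neighbours (Arc.rebase M L (r∈ M s))
          where
          s≢t : s ≢ t
          s≢t refl = Finₚ.<-irrefl refl lt
          P = proj₁ (proj₁ sg s t s∈ t∈ lt)
          lenP : ∥ P ∥ ≡ D s t
          lenP = D-shortest P (proj₂ (proj₁ sg s t s∈ t∈ lt))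
          -- With only `s` and `t` in `S`, the path assigned to them has to contain every vertex.
          on-P : ∀ x → x ∈ˡ vertices P
          on-P x with x ∈? S
          ... | yes x∈ with at-most-two s∈ t∈ x∈ s≢t
          ... | inj₁ refl = start∈ P
          ... | inj₂ refl = end∈ P
          on-P x | no x∉ with proj₂ sg x x∉
          ... | u , v , u∈ , v∈ , u<v , i with at-most-two s∈ t∈ u∈ s≢t | at-most-two s∈ t∈ v∈ s≢t
          ... | inj₁ refl | inj₂ refl = i
          ... | inj₁ refl | inj₁ refl = contradiction u<v (Finₚ.<-irrefl refl)
          ... | inj₂ refl | inj₂ refl = contradiction u<v (Finₚ.<-irrefl refl)
          ... | inj₂ refl | inj₁ refl = contradiction u<v (Finₚ.<-asym lt)
          two-neighbours : ¬ (Σ (Listing B l) λ L′ → Listing.c L′ 0 ≡ r M s)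
          two-neighbours (L′ , eq) = next≢ (equidistant P lenP (on-P _) (on-P _)
              (trans (one-away 1 (D-arc′ 1 refl (≤-trans (s≤s (s≤s z≤n)) l≥3)))
                (sym (one-away m (D-coarc 1 (trans (+-identityʳ l) (sym sm)) (≤-trans (s≤s (s≤s z≤n)) l≥3))))))
            where
            open Listing L′ renaming (c to c′; c∈ to c′∈) using ()
            open Position M L′
            -- The number `m` is `l` minus 1, the index of the neighbour of `c′ 0` on the far side.
            m = proj₁ (m≤n⇒∃[o]m+o≡n (≤-trans (s≤s z≤n) l≥3))
            sm : suc m ≡ l
            sm = proj₂ (m≤n⇒∃[o]m+o≡n (≤-trans (s≤s z≤n) l≥3))
            next≢ : c′ 1 ≢ c′ m
            next≢ = c-≢ L′ (≤-pred (≤-trans l≥3 (≥= sm))) (≤-trans (≤= sm) (m≤m+n l 1))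
            one-away : ∀ i → D (c′ 0) (c′ i) ≡ 1 → D s (c′ i) ≡ D s (r M s) + 1
            one-away i d = trans (sym (r-btw M (c′∈ i))) (cong (D s (r M s) +_) (trans (cong (λ g → D g (c′ i)) (sym eq)) d))

  -- Existence of an output: every choice of the procedure can be made.

  abstract
    middle : ∀ {H : Graph n} {x z} (P : Walk H x z) → ∃ (IsMiddle G P)
    middle {H} P with halves ∥ P ∥
    ... | a , b , total , _ , _ , half = at P a , at-middle {H = H} P half (≤-trans (m≤m+n a b) (≤= total))

  module _ {B : Subset n} (M : MaxClique B) where

    make-step2 : ∀ {a} → CutIn G B a → (∀ {c} → CutIn G B c → c ≡ a) → ∃ (Step2 G B)
    make-step2 {a} (a∈ , ca) only with edge-or-cycle M
    ... | inj₁ e with Arc.rebase M (edge-listing e) a∈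
    ... | L , refl = _ , edge e (c∈ 1) (c 0 , Graph.sym G (step 0) , unique)
      where
      open Listing L
      c1-noncut : ¬ Cut (c 1)
      c1-noncut k = c-≢ L (s≤s z≤n) (s≤s (s≤s z≤n)) (sym (only (c∈ 1 , k)))
      -- The far end is not a cut vertex, so each of its edges belongs to this block and leads back
      -- to `c 0`.
      unique : ∀ {z} → Adj G (c 1) z → c 0 ≡ z
      unique {z} k with pair-block (insep-adj k)
      ... | B′ , M′ , p , q with nbr 0 (subst (z ∈_) (sym (noncut-block M M′ c1-noncut (c∈ 1) p)) q) k
      ... | inj₁ eq = sym (trans eq (periodic 0))
      ... | inj₂ eq = sym eq
    make-step2 {a} (a∈ , ca) only | inj₂ (l , C) with Arc.rebase M (cycle-listing C) a∈ | 2 ∣? l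
    ... | L , refl | yes d@(divides q refl) = _ , even C d (a∈ , ca) (Listing.c∈ L q)
          (D⇒Dist (trans (Arc.D-arc′ M L q (+-identityʳ q) (≥= (q*2≡q+q q))) (sym (m*n/n≡m q 2))))
    ... | L , refl | no ¬2∣l = _ , odd C ¬2∣l (a∈ , ca) (c∈ h) (c∈ (suc h))
          (c-≢ L ≤-refl (≤-trans (n≤1+n _) (+-monoˡ-≤ h (cycle≥3 C))))
          (D⇒Dist (D-arc′ h (+-identityʳ h) (≤-trans (n≤1+n _) (≥= l≡))))
          (D⇒Dist (D-coarc h (trans (+-identityʳ l) (trans l≡ (sym (+-suc h h)))) (≤-trans (n≤1+n _) (≥= l≡))))
      where
      open Listing L
      open Arc M L
      h = l / 2
      l≡ : l ≡ suc (h + h)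
      l≡ = odd-half l ¬2∣l

    cutIn? : ∀ p → Dec (CutIn G B p)
    cutIn? p = (p ∈? B) ×-dec cut? p

    abstract
      antipodal? : ∀ l → Dec (HasAntipodalCuts G B l)
      antipodal? l = (2 ∣? l) ×-dec Finₚ.any? λ p → Finₚ.any? λ q → cutIn? p ×-dec cutIn? q ×-dec
        map′ D⇒Dist Dist⇒D (D p q ≟ l / 2)

      covered? : Dec (CoveredByCuts G B)
      covered? = map′ to from
        (Finₚ.all? λ w → (w ∈? B) →-dec (Finₚ.any? λ p → Finₚ.any? λ q → cutIn? p ×-dec cutIn? q ×-dec btw? p w q))
        where
        Within : Set
        Within = ∀ w → w ∈ B → ∃[ p ] ∃[ q ] CutIn G B p × CutIn G B q × Btw p w q
        to : Within → CoveredByCuts G B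
        to f w w∈ with f w w∈
        ... | p , q , cp , cq , h = p , q , cp , cq , btw⇒innerOn M (proj₁ cp) (proj₁ cq) h
        from : CoveredByCuts G B → Within
        from f w w∈ with f w w∈
        ... | p , q , cp , cq , h = p , q , cp , cq , innerOn⇒btw M (proj₁ cp) (proj₁ cq) h

    -- Two nested maximisations: a best partner for every vertex, then a best vertex.
    farthest : ∀ {a b} → CutIn G B a → CutIn G B b → b ≢ a →
               ∃[ x ] ∃[ y ] CutIn G B x × CutIn G B y × x ≢ y × Farthest G B x y
    farthest {a} {b} ca cb b≢a = x , y , cx , cy , x≢y , far
      where
      partner : ∀ x → ∃[ y ] CutIn G B y × (∀ {z} → CutIn G B z → D x z ≤ D x y)
      partner x = argmax (D x) cutIn? (a , ca)
      best = argmax (λ x → D x (proj₁ (partner x))) cutIn? (a , ca)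
      x = proj₁ best
      cx = proj₁ (proj₂ best)
      y = proj₁ (partner x)
      cy = proj₁ (proj₂ (partner x))
      max : ∀ {p q} → CutIn G B p → CutIn G B q → D p q ≤ D x y
      max {p} cp cq = ≤-trans (proj₂ (proj₂ (partner p)) cq) (proj₂ (proj₂ best) cp)
      x≢y : x ≢ y
      x≢y eq = <⇒≱ (D-pos (≢-sym b≢a)) (≤-trans (max ca cb) (≤= (trans (cong (D x) (sym eq)) (D-refl x))))
      far : Farthest G B x y
      far p q d e cp cq dist dist′ = ≤-trans (≥= (innerDist⇒D M (proj₁ cp) (proj₁ cq) dist))
        (≤-trans (max cp cq) (≤= (innerDist⇒D M (proj₁ cx) (proj₁ cy) dist′)))

    -- By `path-shape` there are only two candidate lengths, d and l - d.
    longest-path : ∀ {l x y} → IsCycle G B l → x ∈ B → y ∈ B → x ≢ y → Σ (Walk (G [ B ]) x y) IsLongestPath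
    longest-path {l} C x∈ y∈ x≢y with Arc.rebase M (cycle-listing C) x∈
    ... | L , refl with Listing.onto L y∈
    ... | zero , _ , refl = contradiction refl x≢y
    ... | d@(suc _) , d<l , refl with l ≤? d + d
    ... | yes h with Position.forward-path M L {d} d<l
    ... | P , len , path = P , path , λ Q q → bound Q (Sum.map proj₁ proj₁ (Position.path-shape M L refl refl (s≤s z≤n) d<l Q q))
      where
      bound : ∀ (Q : Walk (G [ B ]) (Listing.c L 0) (Listing.c L d)) → ∥ Q ∥ ≡ d ⊎ ∥ Q ∥ + d ≡ l → ∥ Q ∥ ≤ ∥ P ∥
      bound Q (inj₁ e) = ≤-trans (≤= e) (≥= len)
      bound Q (inj₂ e) = ≤-trans (+-cancelʳ-≤ d _ _ (≤-trans (≤= e) h)) (≥= len)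
    longest-path {l} C x∈ y∈ x≢y | L , refl | d@(suc _) , d<l , refl | no h with Position.backward-path M L {d} (s≤s z≤n) (<⇒≤ d<l)
    ... | P , len , path = P , path , λ Q q → bound Q (Sum.map proj₁ proj₁ (Position.path-shape M L refl refl (s≤s z≤n) d<l Q q))
      where
      bound : ∀ (Q : Walk (G [ B ]) (Listing.c L 0) (Listing.c L d)) → ∥ Q ∥ ≡ d ⊎ ∥ Q ∥ + d ≡ l → ∥ Q ∥ ≤ ∥ P ∥
      bound Q (inj₁ e) = ≤-trans (≤= e) (+-cancelʳ-≤ d _ _ (≤-trans (<⇒≤ (≰⇒> h)) (≥= len)))
      bound Q (inj₂ e) = ≤= (+-cancelʳ-≡ d _ _ (trans e (sym len)))

    make-step3 : ∀ {a b} → CutIn G B a → CutIn G B b → b ≢ a → ∃ (Step3 G B)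
    make-step3 {a} {b} ca cb b≢a = [ (λ e → ⊥ , edge e) , (λ { (l , C) → around C (antipodal? l) covered? }) ]′ (edge-or-cycle M)
      where
      put : ∀ {l x y} → IsCycle G B l → ¬ HasAntipodalCuts G B l → ¬ CoveredByCuts G B →
            CutIn G B x → CutIn G B y → x ≢ y → Farthest G B x y →
            (P : Walk (G [ B ]) x y) → IsLongestPath P → ∃ (Step3 G B)
      put C ¬anti ¬cov cx cy x≢y far P longest =
        let w , mid = middle {H = G [ B ]} P in ⁅ w ⁆ , uncovered C ¬anti ¬cov cx cy x≢y far P longest mid
      around : ∀ {l} → IsCycle G B l → Dec (HasAntipodalCuts G B l) → Dec (CoveredByCuts G B) → ∃ (Step3 G B)
      around C (yes anti) _         = ⊥ , antipodal C anti
      around C (no ¬anti) (yes cov) = ⊥ , covered C ¬anti cov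
      around C (no ¬anti) (no ¬cov) =
        let x , y , cx , cy , x≢y , far = farthest ca cb b≢a
            P , longest = longest-path C (proj₁ cx) (proj₁ cy) x≢y
        in put C ¬anti ¬cov cx cy x≢y far P longest

  private
    -- Defined on all sets so that it can serve as `added`. A block falls under one of the two
    -- rules, and the other holds vacuously.
    choice : ∀ B → Dec (MaxClique B) →
             ∃[ X ] (Leaf G (block B) → Step2 G B X) × (Internal G (block B) → Step3 G B X)
    choice B (no ¬M) = ⊥ ,
      (λ lf → contradiction (block⇒maxClique (proj₁ lf)) ¬M) , λ int → contradiction (block⇒maxClique (proj₁ int)) ¬M
    choice B (yes M) with leaf-or-internal M
    ... | a , ca , inj₁ (lf , only) = let X , st = make-step2 M ca only in X , (λ _ → st) , λ int → contradiction lf (proj₂ int)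
    ... | a , ca , inj₂ ((bl , ¬lf) , b , cb , b≢a) = let X , st = make-step3 M ca cb b≢a in X , (λ lf → contradiction lf ¬lf) , λ _ → st

    member? : ∀ v → Dec (∃[ B ] MaxClique B × v ∈ proj₁ (choice B (block? B)))
    member? v = anySubset? λ B → block? B ×-dec (v ∈? proj₁ (choice B (block? B)))

  run-loops : ∃ (AfterLoops G)
  run-loops = toSubset member? , record
    { added    = λ B → proj₁ (choice B (block? B))
    ; leaf     = λ B → proj₁ (proj₂ (choice B (block? B)))
    ; internal = λ B → proj₂ (proj₂ (choice B (block? B)))
    ; union    = λ v → mk⇔
        (λ v∈ → let B , M , i = ∈-toSubset⁻ member? v∈ in B , maxClique⇒block M , i)
        (λ { (B , bl , i) → ∈-toSubset⁺ member? (B , block⇒maxClique bl , i) }) }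

  -- The vertices of one turn of `L` are distinct and have indices below `l′` in the other listing.
  -- The length of a block is thus unique, which decides its parity in `even-block?`.
  listing-length : ∀ {B l l′} → Listing B l → Listing B l′ → l ≤ l′
  listing-length {l = l} {l′} L L′ = Finₚ.injective⇒≤ {f = f} λ {i} {j} eq → f-injective i j eq
    where
    open Listing L
    open Listing L′ renaming (c to c′; onto to onto′) using ()
    index : ∀ i → ∃[ j ] j < l′ × c′ j ≡ c i
    index i = onto′ (c∈ i)
    f : Fin l → Fin l′
    f i = fromℕ< (proj₁ (proj₂ (index (toℕ i))))
    same : ∀ i j → c i ≡ c j → i < l → j < l → i ≡ j
    same i j eq p q with <-cmp i j
    ... | tri≈ _ e _ = e
    ... | tri< h _ _ = contradiction eq (c-≢ L h (≤-trans q (m≤m+n l i)))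
    ... | tri> _ _ h = contradiction (sym eq) (c-≢ L h (≤-trans p (m≤m+n l j)))
    f-injective : ∀ i j → f i ≡ f j → i ≡ j
    f-injective i j eq = Finₚ.toℕ-injective (same (toℕ i) (toℕ j)
      (trans (sym (proj₂ (proj₂ (index (toℕ i))))) (trans (cong c′ (Finₚ.fromℕ<-injective _ _ _ _ eq)) (proj₂ (proj₂ (index (toℕ j))))))
      (Finₚ.toℕ<n i) (Finₚ.toℕ<n j))

  even-block? : Dec (HasEvenCycleBlock G)
  even-block? = anySubset? per-block
    where
    per-block : ∀ B → Dec (∃[ l ] IsBlock G B × IsCycle G B l × 2 ∣ l)
    per-block B with block? B
    ... | no ¬M = no λ { (_ , bl , _) → ¬M (block⇒maxClique bl) }
    ... | yes M with edge-or-cycle M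
    ... | inj₁ e = no λ { (l , _ , C , _) → <⇒≱ (cycle≥3 C) (listing-length (cycle-listing C) (edge-listing e)) }
    ... | inj₂ (l , C) with 2 ∣? l
    ... | yes 2∣l = yes (l , maxClique⇒block M , C , 2∣l)
    ... | no ¬2∣l = no λ { (l′ , _ , C′ , 2∣l′) → ¬2∣l (subst (2 ∣_)
      (≤-antisym (listing-length (cycle-listing C′) (cycle-listing C)) (listing-length (cycle-listing C) (cycle-listing C′))) 2∣l′) }

  run-step4 : ∀ S → ∃ (Step4 G S)
  run-step4 S with 3 ≤? ∣ S ∣ | even-block?
  ... | yes h | _      = S , enough h
  ... | no h  | no ¬ev = S , noEven (≰⇒> h) ¬ev
  ... | no h  | yes ev@(B , l , bl , C , _) with Finₚ.any? (λ v → ¬? (v ∈? S))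
  ... | yes (v , v∉) = _ , extra (≰⇒> h) ev v∉
  ... | no none = contradiction (three∈⇒3≤ (full _) (full _) (full _)
        (c-≢ L (s≤s z≤n) (≤-trans (≤-trans (s≤s (s≤s z≤n)) (cycle≥3 C)) (m≤m+n l 0)))
        (c-≢ L (s≤s (s≤s z≤n)) (≤-trans (cycle≥3 C) (m≤m+n l 1))) (c-≢ L (s≤s z≤n) (≤-trans (cycle≥3 C) (m≤m+n l 0)))) h
    where
    L = cycle-listing C
    full : ∀ v → v ∈ S
    full v = decidable-stable (v ∈? S) λ v∉ → none (v , v∉)

  terminates : ∃ (CactusSG G)
  terminates = let S₃ , run = run-loops ; S , st = run-step4 S₃ in S , S₃ , run , st

  -- The three outcomes of step 4.

  geodetic : ∀ {S₃ S} (run : AfterLoops G S₃) → Step4 G S₃ S → StrongGeodetic G S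
  geodetic run (enough h) = Upper.strongGeodetic id (inj₁ λ {s} {t} _ _ → third∈ h s t)
    where module Upper = UpperBound.Cover run
  geodetic {S₃} run (extra {v} _ _ v∉) = Upper.strongGeodetic (p⊆p∪q ⁅ v ⁆)
    (inj₁ λ s∈ t∈ → v , q⊆p∪q S₃ ⁅ v ⁆ (x∈⁅x⁆ v) , (λ eq → v∉ (subst (_∈ S₃) (sym eq) s∈)) , λ eq → v∉ (subst (_∈ S₃) (sym eq) t∈))
    where module Upper = UpperBound.Cover run
  geodetic run (noEven _ ¬even) = Upper.strongGeodetic id (inj₂ ¬even)
    where module Upper = UpperBound.Cover run

  minimum : ∀ {S₃ S} → AfterLoops G S₃ → Step4 G S₃ S → ∀ S′ → StrongGeodetic G S′ → ∣ S ∣ ≤ ∣ S′ ∣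
  minimum run (enough _)   S′ sg = Against.loops-minimal sg run
  minimum run (noEven _ _) S′ sg = Against.loops-minimal sg run
  -- The additional vertex brings the size to at most 3, and a cycle forces every strong geodetic
  -- set to have three elements.
  minimum {S₃} run (extra {v} small (B , l , bl , C , _) _) S′ sg =
    ≤-trans (count-insert S₃ v) (≤-trans small (Against.cycle⇒three sg (block⇒maxClique bl) C))

theorem12 : ∀ {n : ℕ} (G : Graph n) → Cactus G → CutTreeHasTwoNodes G →
    (∃ λ S → CactusSG G S) × (∀ S → CactusSG G S → MinimumStrongGeodetic G S)
theorem12 G cactus nodes with BlockStructure.two-vertices G (proj₁ cactus) nodes
... | x , y , x≢y with BlockStructure.cut-vertex G (proj₁ cactus) x≢y nodes
... | a , ca = terminates , λ { S (S₃ , run , st) → geodetic run st , minimum run st }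
  where open Procedure G cactus x y x≢y a ca using (terminates; geodetic; minimum)
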